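{- Let $L_0\subseteq L$, $\mathbf{G}=\{\mathcal{G}_n:n\in\mathbb{N}\}$, $\mathbf{K}_n=\mathbf{K}(\mathcal{G}_n)$, $\mathbf{K}=\bigcup_n\mathbf{K}_n$ and the dimension conditional measures $\delta_n$ be as in the context. Let $k>0$. Suppose that $(\mathcal{G}_n:n\in\mathbb{N})$ is uniformly bounded and polynomially $k$-saturated and that $\mathbf{K}$ accepts $k$-substitutions over $L_0$. Then: (i) For every $(k-1)$-extension axiom $\varphi$ of $\mathbf{K}$, $\lim_{n\to\infty}\delta_n(\varphi)=1$, where $\delta_n(\varphi)=\delta_n(\{\mathcal{M}\in\mathbf{K}_n:\mathcal{M}\models\varphi\})$. (ii) $\mathbf{K}$ is polynomially $k$-saturated.
   Context: Setting. $L_0\subseteq L$ are first-order languages with vocabularies $V_0\subseteq V$ such that $V\setminus V_0$ is finite and consists of relation symbols. $\mathbf{G}=\{\mathcal{G}_n:n\in\mathbb{N}\}$ is a set of finite $L_0$-structures; each $\mathcal{G}_n$ carries a closure operator $\mathrm{cl}_{\mathcal{G}_n}$ on its universe making it a pregeometry (matroid), closed sets are closed under the interpretations of function and constant symbols, and there are $L_0$-formulas $\theta_m(x_1,\ldots,x_{m+1})$, $m\in\mathbb{N}$, such that for all $n,m$ and all $a_1,\ldots,a_{m+1}\in G_n$: $a_{m+1}\in\mathrm{cl}_{\mathcal{G}_n}(a_1,\ldots,a_m)$ iff $\mathcal{G}_n\models\theta_m(a_1,\ldots,a_{m+1})$. For each $n$, $\mathbf{K}_n=\mathbf{K}(\mathcal{G}_n)$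 is a set of expansions of $\mathcal{G}_n$ to $L$; $\mathbf{K}=\bigcup_n\mathbf{K}_n$. For $\mathcal{M}\in\mathbf{K}_n$, $\mathrm{cl}_{\mathcal{M}}=\mathrm{cl}_{\mathcal{G}_n}$. A structure is represented (with respect to $\mathbf{K}$) if it is isomorphic to a member of $\mathbf{K}$; its closure operator is the one defined by the formulas $\theta_m$. $\dim_{\mathcal{M}}$ is pregeometry dimension. $\mathcal{A}\subseteq_{cl}\mathcal{M}$ means $\mathcal{A}$ is a substructure of $\mathcal{M}$ with closed universe. Standing assumption: if $\mathcal{M}$ is represented and $\mathcal{A}\subseteq_{cl}\mathcal{M}$, then $\mathcal{A}$ is represented. Structures with empty universe are allowed if there are no constant symbols. Uniformly bounded: there is $u:\mathbb{N}\to\mathbb{N}$ with $|\mathrm{cl}_{\mathcal{G}_n}(X)|\le u(\dim_{\mathcal{G}_n}(X))$ for all $n$ and all $X\subseteq G_n$. Multiplicity and extension axioms: let $\mathcal{A}\subset\mathcal{B}$ be closed substructures of some represented structure. The $\mathcal{B}/\mathcal{A}$-multiplicity of $\mathcal{M}$ is at least $m$ if whenever $\mathcal{A}'\subseteq_{cl}\mathcal{M}$ and $\sigma:\mathcal{A}'\to\mathcal{A}$ is an isomorphism, there are $\mathcal{B}'_i\subseteq_{cl}\mathcal{M}$ and isomorphisms $\sigma_i:\mathcal{B}'_i\to\mathcal{B}$, $i=1,\ldots,m$, with $\mathcal{A}'\subseteq\mathcal{B}'_i$, $\sigma_i\upharpoonright A'=\sigma$ and $B'_i\cap B'_j=A'$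 for $i\neq j$. The $\mathcal{B}/\mathcal{A}$-extension axiom is the (first-order expressible) statement that the $\mathcal{B}/\mathcal{A}$-multiplicity is at least $1$; it is a $k$-extension axiom of $\mathbf{K}$ if $\mathcal{B}$ has dimension at most $k+1$. Polynomial $k$-saturation: let $\mathbf{C}$ be a class of structures that are pregeometries uniformly defined by formulas (here $\mathbf{C}=\mathbf{G}$ or $\mathbf{C}=\mathbf{K}$), with "represented" meaning isomorphic to a member of $\mathbf{C}$. A sequence $(\mathcal{M}_n:n\in\mathbb{N})$ from $\mathbf{C}$ is polynomially $k$-saturated if there are numbers $\lambda_n$ with $\lim_{n\to\infty}\lambda_n=\infty$ and a polynomial $P$ such that for every $n$: (1) $\lambda_n\le|M_n|\le P(\lambda_n)$, and (2) whenever $\mathcal{N}$ is represented, $\mathcal{A}\subset\mathcal{B}\subseteq\mathcal{N}$ are closed in $\mathcal{N}$ and $\dim_{\mathcal{N}}(A)+1=\dim_{\mathcal{N}}(B)\le k$, the $\mathcal{B}/\mathcal{A}$-multiplicity of $\mathcal{M}_n$ is at least $\lambda_n$. $\mathbf{C}$ is polynomially $k$-saturated if there is a polynomially $k$-saturated sequence $(\mathcal{M}_n:n\in\mathbb{N})$ with all $\mathcal{M}_n\in\mathbf{C}$. Acceptance of substitutions: represented $\mathcal{A},\mathcal{A}'$ agree on $L_0$ and on closed proper substructures if $\mathcal{A}\upharpoonright L_0=\mathcal{A}'\upharpoonright L_0$ and $\mathcal{A}\upharpoonright U=\mathcal{A}'\upharpoonright U$ for every closed $U\subseteq A$ with $\dim_{\mathcal{A}}(U)<\dim_{\mathcal{A}}(A)$.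 $\mathbf{K}$ accepts the substitution $[\mathcal{A}\triangleright\mathcal{A}']$ over $L_0$ if whenever $\mathcal{M}$ is represented and $\mathcal{A}\subseteq_{cl}\mathcal{M}$, there is a represented $\mathcal{N}$ such that $\mathcal{N}\upharpoonright L_0=\mathcal{M}\upharpoonright L_0$, $\mathcal{N}\upharpoonright A=\mathcal{A}'$, and if $\mathcal{U}\subseteq_{cl}\mathcal{N}$, $\dim_{\mathcal{N}}(U)\le\dim_{\mathcal{N}}(A')$ and $\mathcal{U}\ne\mathcal{A}'$, then $\mathcal{N}\upharpoonright U=\mathcal{M}\upharpoonright U$. $\mathbf{K}$ accepts $k$-substitutions over $L_0$ if it accepts $[\mathcal{A}\triangleright\mathcal{A}']$ over $L_0$ for all represented $\mathcal{A},\mathcal{A}'$ of dimension at most $k$ which agree on $L_0$ and on closed proper substructures. Dimension conditional measure: for $\mathcal{M}\in\mathbf{K}$ and $d\in\mathbb{N}$, $\mathcal{M}\upharpoonright d$ has the same universe and the same interpretations of symbols in $V_0$, and for $R\in V\setminus V_0$, $\bar a\in R^{\mathcal{M}\upharpoonright d}$ iff $\bar a\in R^{\mathcal{M}}$ and $\dim_{\mathcal{M}}(\bar a)\le d$. $\mathbf{K}_n\upharpoonright d=\{\mathcal{M}\upharpoonright d:\mathcal{M}\in\mathbf{K}_n\}$. $\mathbb{P}_{n,0}$ is the uniform probability measure on $\mathbf{K}_n\upharpoonright 0$, and for $\mathcal{B}\in\mathbf{K}_n\upharpoonright(r+1)$, $\mathbb{P}_{n,r+1}(\mathcal{B})=\mathbb{P}_{n,r}(\mathcal{B}\upharpoonright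 r)\big/\big|\{\mathcal{B}'\in\mathbf{K}_n\upharpoonright(r+1):\mathcal{B}'\upharpoonright r=\mathcal{B}\upharpoonright r\}\big|$. With $\rho$ the largest arity of a relation symbol of $L$ (so $\mathbf{K}_n\upharpoonright\rho=\mathbf{K}_n$), $\delta_n=\mathbb{P}_{n,\rho}$.
   Formalization: Two conventions are added, since the claim fails without either: the closure operator of a closed substructure of a represented structure is the restriction of the ambient one, and K_n contains every represented expansion of G_n (closure under isomorphism). Each K_n is nonempty. -}

module Defs where

open import Axiom.ExcludedMiddle using (ExcludedMiddle)
open import Data.Bool using (Bool; T; _∧_)
open import Data.Empty using (⊥)
open import Data.Fin using (Fin)
import Data.Integer as ℤ
open import Data.List as List using (List; []; _∷_; deduplicate; filter; map; length; foldr)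
import Data.List.Membership.Propositional as ListMem
open import Data.Nat as ℕ using (ℕ; zero; suc; _≤_; _<_; _⊔_)
open import Data.Product using (∃-syntax; Σ-syntax; _×_; _,_; proj₁; proj₂)
open import Data.Rational as ℚ using (ℚ; 0ℚ; 1ℚ)
open import Data.Sum using (_⊎_; inj₁; inj₂)
open import Data.Vec as Vec using (Vec; []; _∷_; _∷ʳ_; lookup)
import Data.Vec.Functional as VecF
open import Data.Vec.Membership.Propositional using (_∈_)
open import Data.Vec.Relation.Unary.All using (All)
open import Function.Bundles using (_↔_; _⇔_; Inverse)
open import Function.Definitions using (Injective)
open import Level using (0ℓ)
open import Relation.Binary.Definitions using () renaming (Decidable to Decidable₂)
open import Relation.Binary.PropositionalEquality using (_≡_; _≢_)
open import Relation.Nullary using (¬_; does)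
open import Relation.Unary using (Pred; U; _⊆_; _⊂_; _∪_; ｛_｝)

------------------------------------------------------------------------
-- First-order structures

record Vocabulary : Set₁ where
  field
    Fun      : Set
    funArity : Fun → ℕ
    Rel      : Set
    relArity : Rel → ℕ

-- Constant symbols are the function symbols of arity 0.
record Structure (V : Vocabulary) (A : Set) : Set where
  open Vocabulary V
  field
    fun : (f : Fun) → Vec A (funArity f) → A
    rel : (R : Rel) → Vec A (relArity R) → Bool

open Structure public

-- ⊥, ⇒ and ∀ are a complete set of connectives, as excluded middle is
-- assumed wherever it matters.
module _ (V : Vocabulary) where
  open Vocabulary V

  data Term (n : ℕ) : Set where
    var : Fin n → Term n
    app : (f : Fun) → Vec (Term n) (funArity f) → Term n

  data Formula (n : ℕ) : Set where
    _≈′_ : Term n → Term n → Formula n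
    atom : (R : Rel) → Vec (Term n) (relArity R) → Formula n
    ⊥′   : Formula n
    _⇒′_ : Formula n → Formula n → Formula n
    ∀′   : Formula (suc n) → Formula n

module _ {V : Vocabulary} {A : Set} (M : Structure V A) where

  evalTerm  : ∀ {n} → Vec A n → Term V n → A
  evalTerms : ∀ {n m} → Vec A n → Vec (Term V n) m → Vec A m

  evalTerm ρ (var i)    = lookup ρ i
  evalTerm ρ (app f ts) = fun M f (evalTerms ρ ts)

  evalTerms ρ []       = []
  evalTerms ρ (t ∷ ts) = evalTerm ρ t ∷ evalTerms ρ ts

  infix 4 _⊨_
  _⊨_ : ∀ {n} → Vec A n → Formula V n → Set
  _⊨_ ρ (s ≈′ t)    = evalTerm ρ s ≡ evalTerm ρ t
  _⊨_ ρ (atom R ts) = T (rel M R (evalTerms ρ ts))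
  _⊨_ ρ ⊥′          = ⊥
  _⊨_ ρ (φ ⇒′ ψ)    = _⊨_ ρ φ → _⊨_ ρ ψ
  _⊨_ ρ (∀′ φ)      = ∀ a → _⊨_ (a ∷ ρ) φ

module _ {V : Vocabulary} where

  -- M and N coincide on tuples from X.  When X is (the universe of) a
  -- substructure of both, this says M ↾ X = N ↾ X.
  AgreeOn : {A : Set} → Pred A 0ℓ → Structure V A → Structure V A → Set
  AgreeOn X M N =
      (∀ f xs → All X xs → fun M f xs ≡ fun N f xs)
    × (∀ R xs → All X xs → rel M R xs ≡ rel N R xs)

  -- Equality of structures with the same universe.
  _≐_ : {A : Set} → Structure V A → Structure V A → Set
  M ≐ N = AgreeOn U M N

  record Iso {A B : Set} (M : Structure V A) (N : Structure V B) : Set where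
    field
      bijection : A ↔ B
    to : A → B
    to = Inverse.to bijection
    field
      fun-pres : ∀ f xs → to (fun M f xs) ≡ fun N f (Vec.map to xs)
      rel-pres : ∀ R xs → rel M R xs ≡ rel N R (Vec.map to xs)

  record IsEmbedding {A B : Set} (M : Structure V A) (N : Structure V B)
                     (h : A → B) : Set where
    field
      injective : Injective _≡_ _≡_ h
      fun-pres  : ∀ f xs → h (fun M f xs) ≡ fun N f (Vec.map h xs)
      rel-pres  : ∀ R xs → rel M R xs ≡ rel N R (Vec.map h xs)

------------------------------------------------------------------------
-- Pregeometries

ClosureOp : Set → Set₁
ClosureOp A = Pred A 0ℓ → Pred A 0ℓ

Closed : {A : Set} → ClosureOp A → Pred A 0ℓ → Set
Closed cl X = cl X ⊆ X

record IsPregeometry {A : Set} (cl : ClosureOp A) : Set₁ where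
  field
    extensive  : ∀ X → X ⊆ cl X
    monotone   : ∀ {X Y} → X ⊆ Y → cl X ⊆ cl Y
    idempotent : ∀ X → cl (cl X) ⊆ cl X
    exchange   : ∀ X {a b} → cl (X ∪ ｛ a ｝) b → ¬ cl X b → cl (X ∪ ｛ b ｝) a
    finitary   : ∀ X {a} → cl X a →
                 ∃[ m ] Σ[ xs ∈ Vec A m ] All X xs × cl (_∈ xs) a

module _ {A : Set} (cl : ClosureOp A) where

  Independent : ∀ {d} → Vec A d → Set
  Independent b =
    ∀ i → ¬ cl (λ x → ∃[ j ] j ≢ i × lookup b j ≡ x) (lookup b i)

  IsBasis : ∀ {d} → Vec A d → Pred A 0ℓ → Set
  IsBasis b X = All X b × Independent b × X ⊆ cl (_∈ b)

  -- dim X = d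
  HasDim : Pred A 0ℓ → ℕ → Set
  HasDim X d = Σ[ b ∈ Vec A d ] IsBasis b X

  DimAtMost : Pred A 0ℓ → ℕ → Set
  DimAtMost X d = ∃[ e ] HasDim X e × e ≤ d

  Dim≤Dim : Pred A 0ℓ → Pred A 0ℓ → Set
  Dim≤Dim X Y = ∃[ d ] ∃[ e ] HasDim X d × HasDim Y e × d ≤ e

  Dim<Dim : Pred A 0ℓ → Pred A 0ℓ → Set
  Dim<Dim X Y = ∃[ d ] ∃[ e ] HasDim X d × HasDim Y e × d < e

------------------------------------------------------------------------
-- Limits and polynomials

fromℕ : ℕ → ℚ
fromℕ n = ℤ.+ n ℚ./ 1

-- 1/n, with the junk value 0 at n = 0.
recip : ℕ → ℚ
recip zero    = 0ℚ
recip (suc n) = ℤ.+ 1 ℚ./ suc n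

sumℚ : List ℚ → ℚ
sumℚ = foldr ℚ._+_ 0ℚ

-- Coefficients are listed from the constant term upwards.
evalPoly : List ℚ → ℚ → ℚ
evalPoly cs x = foldr (λ c y → c ℚ.+ x ℚ.* y) 0ℚ cs

TendsToInfinity : (ℕ → ℕ) → Set
TendsToInfinity f = ∀ c → ∃[ N ] (∀ n → N ≤ n → c ≤ f n)

TendsTo : (ℕ → ℚ) → ℚ → Set
TendsTo f l = ∀ ε → 0ℚ ℚ.< ε →
  ∃[ N ] (∀ n → N ≤ n → ℚ.∣ f n ℚ.- l ∣ ℚ.< ε)

------------------------------------------------------------------------
-- Classes of finite structures which are pregeometries uniformly
-- defined by formulas θ m (x₁ , … , x_{m+1})

record Class (V : Vocabulary) : Set₁ where
  field
    Index : Set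
    size  : Index → ℕ
    str   : (i : Index) → Structure V (Fin (size i))
    θ     : (m : ℕ) → Formula V (suc m)

module InClass {V : Vocabulary} (C : Class V) where
  open Vocabulary V
  open Class C

  Represented : {A : Set} → Structure V A → Set
  Represented M = ∃[ i ] Iso M (str i)

  cl : {A : Set} → Structure V A → ClosureOp A
  cl {A} M X a =
    ∃[ m ] Σ[ xs ∈ Vec A m ] All X xs × _⊨_ M (xs ∷ʳ a) (θ m)

  -- Substructures with closed universe.  Subsets are Bool-valued so that
  -- membership proofs are unique and El is the subset itself.
  record ClosedSub {A : Set} (M : Structure V A) : Set where
    field
      mem : A → Bool
    El : Set
    El = Σ[ a ∈ A ] T (mem a)
    ⟦_⟧ : Pred A 0ℓ
    ⟦_⟧ a = T (mem a)
    field
      closed     : Closed (cl M) ⟦_⟧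
      fun-closed : ∀ f (xs : Vec El (funArity f)) →
                   T (mem (fun M f (Vec.map proj₁ xs)))

  open ClosedSub public using (El; ⟦_⟧)

  _↾_ : {A : Set} (M : Structure V A) (S : ClosedSub M) → Structure V (El S)
  fun (M ↾ S) f xs = fun M f (Vec.map proj₁ xs) , ClosedSub.fun-closed S f xs
  rel (M ↾ S) R xs = rel M R (Vec.map proj₁ xs)

  record ClosedPair : Set₁ where
    field
      {universe}  : Set
      N           : Structure V universe
      represented : Represented N
      A B         : ClosedSub N
      A⊂B         : ⟦ A ⟧ ⊂ ⟦ B ⟧

  -- The B/A-multiplicity of M is at least m.
  MultiplicityAtLeast : ClosedPair → {D : Set} → Structure V D → ℕ → Set
  MultiplicityAtLeast p M m =
    (A′ : ClosedSub M) (σ : Iso (M ↾ A′) (N ↾ A)) →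
    Σ[ B′ ∈ (Fin m → ClosedSub M) ]
    Σ[ τ ∈ (∀ i → Iso (M ↾ B′ i) (N ↾ B)) ]
        (∀ i → ⟦ A′ ⟧ ⊆ ⟦ B′ i ⟧)
      × (∀ i x (x∈A′ : ⟦ A′ ⟧ x) (x∈B′ : ⟦ B′ i ⟧ x) →
           proj₁ (Iso.to (τ i) (x , x∈B′)) ≡ proj₁ (Iso.to σ (x , x∈A′)))
      × (∀ i j → i ≢ j → ∀ x → ⟦ B′ i ⟧ x → ⟦ B′ j ⟧ x → ⟦ A′ ⟧ x)
    where open ClosedPair p

  ExtensionAxiom : ClosedPair → {D : Set} → Structure V D → Set
  ExtensionAxiom p M = MultiplicityAtLeast p M 1

  -- The extension axiom given by the pair is a k-extension axiom.
  IsExtensionAxiomOf : ℕ → ClosedPair → Set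
  IsExtensionAxiomOf k p = DimAtMost (cl N) ⟦ B ⟧ (suc k)
    where open ClosedPair p

  PolynomiallySaturatedSeq : ℕ → (ℕ → Index) → Set₁
  PolynomiallySaturatedSeq k s =
    Σ[ lam ∈ (ℕ → ℕ) ] Σ[ P ∈ List ℚ ] TendsToInfinity lam × (∀ n →
        lam n ≤ size (s n)
      × fromℕ (size (s n)) ℚ.≤ evalPoly P (fromℕ (lam n))
      × (∀ (p : ClosedPair) → let open ClosedPair p in
         ∀ d → HasDim (cl N) ⟦ A ⟧ d → HasDim (cl N) ⟦ B ⟧ (suc d) →
         suc d ≤ k → MultiplicityAtLeast p (str (s n)) (lam n)))

  PolynomiallySaturated : ℕ → Set₁
  PolynomiallySaturated k = Σ[ s ∈ (ℕ → Index) ] PolynomiallySaturatedSeq k s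

------------------------------------------------------------------------
-- Adding finitely many relation symbols to a vocabulary

module Extend (V₀ : Vocabulary) (r : ℕ) (arity : Fin r → ℕ) where
  open Vocabulary V₀

  V : Vocabulary
  V = record
    { Fun      = Fun
    ; funArity = funArity
    ; Rel      = Rel ⊎ Fin r
    ; relArity = λ { (inj₁ R) → relArity R ; (inj₂ R) → arity R }
    }

  reduct : {A : Set} → Structure V A → Structure V₀ A
  fun (reduct M) f = fun M f
  rel (reduct M) R = rel M (inj₁ R)

  -- Interpretations of the new symbols, i.e. expansions of a structure
  -- with universe A.
  Expansion : Set → Set
  Expansion A = (R : Fin r) → Vec A (arity R) → Bool

  expand : {A : Set} → Structure V₀ A → Expansion A → Structure V A
  fun (expand M E) f        = fun M f
  rel (expand M E) (inj₁ R) = rel M R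
  rel (expand M E) (inj₂ R) = E R

  _≋_ : {A : Set} → Expansion A → Expansion A → Set
  E ≋ E′ = ∀ R xs → E R xs ≡ E′ R xs

  liftTerm  : ∀ {n} → Term V₀ n → Term V n
  liftTerms : ∀ {n m} → Vec (Term V₀ n) m → Vec (Term V n) m

  liftTerm (var i)    = var i
  liftTerm (app f ts) = app f (liftTerms ts)

  liftTerms []       = []
  liftTerms (t ∷ ts) = liftTerm t ∷ liftTerms ts

  liftFormula : ∀ {n} → Formula V₀ n → Formula V n
  liftFormula (s ≈′ t)    = liftTerm s ≈′ liftTerm t
  liftFormula (atom R ts) = atom (inj₁ R) (liftTerms ts)
  liftFormula ⊥′          = ⊥′
  liftFormula (φ ⇒′ ψ)    = liftFormula φ ⇒′ liftFormula ψ
  liftFormula (∀′ φ)      = ∀′ (liftFormula φ)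

------------------------------------------------------------------------
-- The setting: the classes G and K

record Setting : Set₁ where
  field
    V₀    : Vocabulary
    r     : ℕ
    arity : Fin r → ℕ

  open Extend V₀ r arity public

  field
    size : ℕ → ℕ
    𝓖    : (n : ℕ) → Structure V₀ (Fin (size n))
    clG  : (n : ℕ) → ClosureOp (Fin (size n))
    θ    : (m : ℕ) → Formula V₀ (suc m)

    pregeometry : ∀ n → IsPregeometry (clG n)
    fun-closed  : ∀ n X → Closed (clG n) X →
                  ∀ f xs → All X xs → X (fun (𝓖 n) f xs)
    definable   : ∀ n m (xs : Vec (Fin (size n)) m) a →
                  clG n (_∈ xs) a ⇔ _⊨_ (𝓖 n) (xs ∷ʳ a) (θ m)

    -- The finite set 𝐊ₙ is given by an enumeration of its elements.
    -- Repetitions, and distinct entries related by _≋_, are allowed and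
    -- count once.
    𝓚          : (n : ℕ) → List (Expansion (Fin (size n)))
    𝓚-nonempty : ∀ n → 𝓚 n ≢ []

  Gclass : Class V₀
  Gclass = record { Index = ℕ ; size = size ; str = 𝓖 ; θ = θ }

  Kclass : Class V
  Kclass = record
    { Index = Σ[ n ∈ ℕ ] Σ[ E ∈ Expansion (Fin (size n)) ] E ListMem.∈ 𝓚 n
    ; size  = λ { (n , _) → size n }
    ; str   = λ { (n , E , _) → expand (𝓖 n) E }
    ; θ     = λ m → liftFormula (θ m)
    }

  module InG = InClass Gclass
  module InK = InClass Kclass
  open InK using (Represented; cl; ClosedSub; El; ⟦_⟧; _↾_)

  field
    closedSub-represented :
      ∀ {A : Set} (M : Structure V A) → Represented M →
      (S : ClosedSub M) → Represented (M ↾ S)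

    -- The pregeometry of a closed substructure is the restriction of the
    -- ambient one.  Only then is "the dimension of 𝓐" for 𝓐 ⊆cl 𝓜
    -- unambiguous; it is not automatic, since the θ m may contain
    -- quantifiers.
    closedSub-cl :
      ∀ {A : Set} (M : Structure V A) → Represented M →
      (S : ClosedSub M) → ∀ {m} (xs : Vec (El S) m) a →
      cl (M ↾ S) (_∈ xs) a ⇔ cl M (_∈ Vec.map proj₁ xs) (proj₁ a)

    -- 𝐊ₙ consists of all expansions of 𝓖ₙ that are represented.  Otherwise
    -- the measures, which count elements of 𝐊ₙ, are unrelated to
    -- acceptance of substitutions, which is invariant under isomorphism.
    𝓚-full :
      ∀ n (E : Expansion (Fin (size n))) → Represented (expand (𝓖 n) E) →
      Σ[ E′ ∈ Expansion (Fin (size n)) ] E′ ListMem.∈ 𝓚 n × E ≋ E′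

  UniformlyBounded : Set₁
  UniformlyBounded =
    Σ[ u ∈ (ℕ → ℕ) ] (∀ n (X : Pred (Fin (size n)) 0ℓ) d → HasDim (clG n) X d →
      Σ[ ys ∈ List (Fin (size n)) ]
        length ys ≤ u d × clG n X ⊆ (ListMem._∈ ys))

  -- Agreement on L₀ and on closed proper substructures, for structures
  -- with the same universe.
  Agree : {A : Set} → Structure V A → Structure V A → Set
  Agree {A} 𝓐 𝓐′ =
      reduct 𝓐 ≐ reduct 𝓐′
    × (∀ (S : ClosedSub 𝓐) → Dim<Dim (cl 𝓐) ⟦ S ⟧ U → AgreeOn ⟦ S ⟧ 𝓐 𝓐′)

  -- 𝓐 ⊆cl 𝓜 is expressed by an inclusion map ι, which is an embedding with
  -- closed image; the image is then a substructure on which 𝓜 restricts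
  -- to 𝓐.
  Accepts : {A : Set} → Structure V A → Structure V A → Set₁
  Accepts {A} 𝓐 𝓐′ =
    ∀ {D : Set} (M : Structure V D) → Represented M →
    ∀ (ι : A → D) → IsEmbedding 𝓐 M ι →
    let image = λ x → ∃[ a ] ι a ≡ x in
    Closed (cl M) image →
    Σ[ N ∈ Structure V D ] Represented N
      × (reduct N ≐ reduct M)
      × IsEmbedding 𝓐′ N ι
      × (∀ (S : ClosedSub N) → Dim≤Dim (cl N) ⟦ S ⟧ image →
         ¬ (∀ x → ⟦ S ⟧ x ⇔ image x) → AgreeOn ⟦ S ⟧ N M)

  AcceptsSubstitutions : ℕ → Set₁
  AcceptsSubstitutions k =
    ∀ {A : Set} (𝓐 𝓐′ : Structure V A) → Represented 𝓐 → Represented 𝓐′ →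
    DimAtMost (cl 𝓐) U k → DimAtMost (cl 𝓐′) U k →
    Agree 𝓐 𝓐′ → Accepts 𝓐 𝓐′

------------------------------------------------------------------------
-- The dimension conditional measures.  Excluded middle provides the
-- decisions (of dimensions, and of truth of statements about structures
-- whose vocabulary may be infinite) that make them rational-valued
-- functions.

module Measure (em : ExcludedMiddle 0ℓ) (𝐒 : Setting) where
  open Setting 𝐒

  Exp : ℕ → Set
  Exp n = Expansion (Fin (size n))

  _≋?_ : ∀ {n} → Decidable₂ (_≋_ {Fin (size n)})
  E ≋? E′ = em

  _↾dim_ : ∀ {n} → Exp n → ℕ → Exp n
  _↾dim_ {n} E d R xs = E R xs ∧ does (em {P = DimAtMost (clG n) (_∈ xs) d})

  -- 𝐊ₙ ↾ d, listed without repetitions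
  𝓚↾ : (n d : ℕ) → List (Exp n)
  𝓚↾ n d = deduplicate _≋?_ (map (_↾dim d) (𝓚 n))

  ℙ : (n d : ℕ) → Exp n → ℚ
  ℙ n zero    E = recip (length (𝓚↾ n 0))
  ℙ n (suc d) E = ℙ n d (E ↾dim d) ℚ.* recip (length
    (filter (λ E′ → (E′ ↾dim d) ≋? (E ↾dim d)) (𝓚↾ n (suc d))))

  -- The largest arity of a new relation symbol.  Taking symbols of V₀
  -- into account as well (whose arities may be unbounded) would not change
  -- δ, because 𝐊ₙ ↾ d = 𝐊ₙ, and hence ℙ n d is constant, from d = ρ on.
  ρ : ℕ
  ρ = VecF.foldr _⊔_ 0 arity

  δ : (n : ℕ) → Exp n → ℚ
  δ n = ℙ n ρ

  -- δₙ { 𝓜 ∈ 𝐊ₙ : Q 𝓜 }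
  δ[_] : (n : ℕ) → Pred (Structure V (Fin (size n))) 0ℓ → ℚ
  δ[ n ] Q = sumℚ (map (δ n)
    (filter (λ E → em {P = Q (expand (𝓖 n) E)}) (deduplicate _≋?_ (𝓚 n))))

{-# OPTIONS --safe #-}
module Submission where

-- Over a closed set A′ of dimension d < k, G_n contains λ_n copies over A′, pairwise disjoint over A′, of every
-- closed extension B₁ of dimension d+1.  Expose a random member of K_n dimension by dimension.  Given the relations on
-- tuples of dimension ≤ e, acceptance of substitutions lets one overwrite the (e+1)-dimensional part of the
-- structure on one copy with the part prescribed by B₁, without touching the other copies.  This map on the
-- fiber is at most C-to-one, where C bounds the number of structures on a set of size u(k), so a copy which is
-- correct up to dimension e stays correct in dimension e+1 with conditional probability at least 1/C, independently of the other
-- copies.  Hence the probability that μ given copies all fail is at most (1 - C^{-ρ})^μ.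
--
-- With μ = ⌊√λ_n⌋, split μ² copies into μ groups of μ: outside an event of probability μ (1 - C^{-ρ})^μ every group
-- contains a correct copy, so the multiplicity is at least μ.  Since V₀ may be infinite there can be infinitely
-- many extensions up to isomorphism, so the union bound ranges over concrete data in G_n instead: a basis of A′,
-- one more point, and a table of the new relations on B₁.  There are polynomially many in |G_n| of these, hence
-- polynomially many in μ, and the total tends to 0.  Extensions by more than one dimension are obtained by iteration.

open import Defs
open import Axiom.ExcludedMiddle using (ExcludedMiddle)
open import Data.Bool using (Bool; true; false; T; _∧_; if_then_else_)
open import Data.Bool.Properties using (T-irrelevant; T?; ∧-identityʳ; ∧-zeroʳ)
open import Data.Empty using (⊥)
open import Data.Fin as Fin using (Fin; zero; suc; punchIn)
import Data.Fin.Properties as Finₚ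
import Data.Integer as ℤ
import Data.Integer.Properties as ℤₚ
open import Data.List as List
  using (List; []; _∷_; _++_; map; length; filter; foldr; deduplicate; concatMap; cartesianProductWith; cartesianProduct; allFin; replicate)
import Data.List.Properties as Listₚ
open import Data.List.Membership.Propositional using (find) renaming (_∈_ to _∈ₗ_)
import Data.List.Membership.Propositional.Properties as ∈ₗ
open import Data.List.Relation.Unary.All as Allₗ using () renaming (All to Allₗ; [] to []ₗ; _∷_ to _∷ₗ_)
import Data.List.Relation.Unary.All.Properties as Allₗₚ
open import Data.List.Relation.Unary.AllPairs as AllPairs using (AllPairs; []; _∷_)
import Data.List.Relation.Unary.AllPairs.Properties as AllPairsₚ
open import Data.List.Relation.Unary.Any as Anyₗ using (here; there) renaming (Any to Anyₗ)
import Data.List.Relation.Unary.Any.Properties as Anyₗₚ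
open import Data.Nat as ℕ using (ℕ; zero; suc; _+_; _*_; _∸_; _^_; _≤_; _<_; _⊔_; z≤n; s≤s)
import Data.Nat.Properties as ℕₚ
import Data.Nat.Solver as ℕ-Solver
open import Data.Nat.Coprimality using (Coprime)
open import Data.Product using (∃-syntax; Σ-syntax; _×_; _,_; proj₁; proj₂)
open import Data.Rational as ℚ using (ℚ; 0ℚ; 1ℚ; mkℚ)
import Data.Rational.Properties as ℚₚ
import Data.Rational.Solver as ℚ-Solver
open import Data.Rational.Unnormalised as ℚᵘ using (mkℚᵘ)
import Data.Rational.Unnormalised.Properties as ℚᵘₚ
open import Data.Sum using (_⊎_; inj₁; inj₂)
open import Data.Unit using (tt)
open import Data.Vec as Vec using (Vec; []; _∷_; _∷ʳ_; lookup)
import Data.Vec.Functional as VecF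
import Data.Vec.Properties as Vecₚ
open import Data.Vec.Membership.Propositional using (_∈_)
import Data.Vec.Membership.Propositional.Properties as ∈ₚ
open import Data.Vec.Relation.Unary.All as All using (All; []; _∷_)
import Data.Vec.Relation.Unary.All.Properties as Allₚ
open import Data.Vec.Relation.Unary.Any as Any using (here; there)
import Data.Vec.Relation.Unary.Any.Properties as Anyₚ
open import Function using (_∘_; id; case_of_)
open import Function.Bundles using (_⇔_; mk↔ₛ′; Inverse; Equivalence)
open import Level using (0ℓ)
open import Relation.Binary.PropositionalEquality
open import Relation.Nullary using (¬_; Dec; yes; no; does; contradiction; ¬?)
open import Relation.Nullary.Decidable using (decidable-stable)
open import Relation.Unary using (Pred; U; _⊆_; _⊂_; _∪_; ｛_｝)

-- The new relations on different copies are not independent random variables, since `𝓚 n` need not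
-- be a product. What is available is counting in a fibre: it carries the uniform distribution, so a
-- map with at most `C` preimages per point has an image that makes up at least a fraction `1/C`. To
-- treat many copies at once, the fibre is weighted by a product with one factor `1 - p [alive]` per
-- copy. Overwriting one copy leaves the factors of the others alone, so the fraction `1/C` persists
-- for the weighted count, and the product is worked off copy by copy. The copies share `A′`; weight
-- is therefore given only to structures that already carry the prescribed relations there, and
-- these are not changed on `A′`.
--
-- A copy may have larger dimension than the level being exposed, whereas a substitution is
-- admissible only on a closed set whose lower-dimensional part is already correct. So a copy is
-- overwritten piecewise, along its closed subsets of the dimension at hand.
--
-- The square root serves two ends: there are `μ` groups, as multiplicity `μ` demands, and each has
-- `μ` members, so that its failure probability beats every polynomial in `μ`.

-- Finite sums, products and powers of rationals

module _ where
  open ℚ-Solver.+-*-Solver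

  factor-out : ∀ s q → s ℚ.- q ℚ.* s ≡ (1ℚ ℚ.- q) ℚ.* s
  factor-out = solve 2 (λ s q → s :- q :* s := (con 1ℚ :- q) :* s) refl

  *-interchange : ∀ a b c d → (a ℚ.* b) ℚ.* (c ℚ.* d) ≡ (a ℚ.* c) ℚ.* (b ℚ.* d)
  *-interchange = solve 4 (λ a b c d → (a :* b) :* (c :* d) := (a :* c) :* (b :* d)) refl

  *-swapˡ : ∀ a b c → a ℚ.* (b ℚ.* c) ≡ b ℚ.* (a ℚ.* c)
  *-swapˡ = solve 3 (λ a b c → a :* (b :* c) := b :* (a :* c)) refl

  expand-factor : ∀ b q a r → b ℚ.* ((1ℚ ℚ.- q ℚ.* a) ℚ.* r) ≡ b ℚ.* r ℚ.+ (ℚ.- q) ℚ.* (a ℚ.* (b ℚ.* r))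
  expand-factor = solve 4 (λ b q a r → b :* ((con 1ℚ :- q :* a) :* r) := b :* r :+ (:- q) :* (a :* (b :* r))) refl

  ∑ : {A : Set} → (A → ℚ) → List A → ℚ
  ∑ f xs = sumℚ (map f xs)

  ⟦_⟧? : {P : Set} → Dec P → ℚ
  ⟦ d ⟧? = if does d then 1ℚ else 0ℚ

  ⟦⟧?-yes : {P : Set} (d : Dec P) → P → ⟦ d ⟧? ≡ 1ℚ
  ⟦⟧?-yes (yes _) _ = refl
  ⟦⟧?-yes (no ¬p) p = contradiction p ¬p

  ⟦⟧?-no : {P : Set} (d : Dec P) → ¬ P → ⟦ d ⟧? ≡ 0ℚ
  ⟦⟧?-no (yes p) ¬p = contradiction p ¬p
  ⟦⟧?-no (no _)  _  = refl

  0≤1 : 0ℚ ℚ.≤ 1ℚ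
  0≤1 = ℚₚ.nonNegative⁻¹ 1ℚ

  ⟦⟧?-≥0 : {P : Set} (d : Dec P) → 0ℚ ℚ.≤ ⟦ d ⟧?
  ⟦⟧?-≥0 (yes _) = 0≤1
  ⟦⟧?-≥0 (no _)  = ℚₚ.≤-refl

  ⟦⟧?-≤1 : {P : Set} (d : Dec P) → ⟦ d ⟧? ℚ.≤ 1ℚ
  ⟦⟧?-≤1 (yes _) = ℚₚ.≤-refl
  ⟦⟧?-≤1 (no _)  = 0≤1

  ⟦⟧?-cong : {P Q : Set} (d : Dec P) (e : Dec Q) → (P → Q) → (Q → P) → ⟦ d ⟧? ≡ ⟦ e ⟧?
  ⟦⟧?-cong (yes _) (yes _) _ _ = refl
  ⟦⟧?-cong (yes p) (no ¬q) f _ = contradiction (f p) ¬q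
  ⟦⟧?-cong (no ¬p) (yes q) _ g = contradiction (g q) ¬p
  ⟦⟧?-cong (no _)  (no _)  _ _ = refl

  *-monoʳ-≤ : ∀ {r p q} → 0ℚ ℚ.≤ r → p ℚ.≤ q → r ℚ.* p ℚ.≤ r ℚ.* q
  *-monoʳ-≤ {r} 0≤r p≤q = ℚₚ.*-monoˡ-≤-nonNeg r {{ℚ.nonNegative 0≤r}} p≤q

  *-monoˡ-≤ : ∀ {r p q} → 0ℚ ℚ.≤ r → p ℚ.≤ q → p ℚ.* r ℚ.≤ q ℚ.* r
  *-monoˡ-≤ {r} 0≤r p≤q = ℚₚ.*-monoʳ-≤-nonNeg r {{ℚ.nonNegative 0≤r}} p≤q

  *-mono-≤ : ∀ {p q r s} → 0ℚ ℚ.≤ p → 0ℚ ℚ.≤ s → p ℚ.≤ q → r ℚ.≤ s → p ℚ.* r ℚ.≤ q ℚ.* s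
  *-mono-≤ 0≤p 0≤s p≤q r≤s = ℚₚ.≤-trans (*-monoʳ-≤ 0≤p r≤s) (*-monoˡ-≤ 0≤s p≤q)

  *-≥0 : ∀ {p q} → 0ℚ ℚ.≤ p → 0ℚ ℚ.≤ q → 0ℚ ℚ.≤ p ℚ.* q
  *-≥0 {p} {q} 0≤p 0≤q = subst (ℚ._≤ p ℚ.* q) (ℚₚ.*-zeroʳ p) (*-monoʳ-≤ 0≤p 0≤q)

  +-≥0 : ∀ {p q} → 0ℚ ℚ.≤ p → 0ℚ ℚ.≤ q → 0ℚ ℚ.≤ p ℚ.+ q
  +-≥0 = ℚₚ.+-mono-≤

  p≤p+q : ∀ {p q} → 0ℚ ℚ.≤ q → p ℚ.≤ p ℚ.+ q
  p≤p+q {p} {q} 0≤q = subst (ℚ._≤ p ℚ.+ q) (ℚₚ.+-identityʳ p) (ℚₚ.+-monoʳ-≤ p 0≤q)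

  p≤q+p : ∀ {p q} → 0ℚ ℚ.≤ q → p ℚ.≤ q ℚ.+ p
  p≤q+p {p} {q} 0≤q = subst (ℚ._≤ q ℚ.+ p) (ℚₚ.+-identityˡ p) (ℚₚ.+-monoˡ-≤ p 0≤q)

  p-q≤p : ∀ {p q} → 0ℚ ℚ.≤ q → p ℚ.- q ℚ.≤ p
  p-q≤p {p} {q} 0≤q = subst (p ℚ.- q ℚ.≤_) (ℚₚ.+-identityʳ p) (ℚₚ.+-monoʳ-≤ p (ℚₚ.neg-antimono-≤ 0≤q))

  p≤q⇒0≤q-p : ∀ {p q} → p ℚ.≤ q → 0ℚ ℚ.≤ q ℚ.- p
  p≤q⇒0≤q-p {p} {q} p≤q = subst (ℚ._≤ q ℚ.- p) (ℚₚ.+-inverseʳ p) (ℚₚ.+-monoˡ-≤ (ℚ.- p) p≤q)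

  -- `fromℕ` normalises its fraction and does not compute on variables, so the equation is checked
  -- on unnormalised rationals.
  fromℕ-+ : ∀ m n → fromℕ (m + n) ≡ fromℕ m ℚ.+ fromℕ n
  fromℕ-+ m n = ℚₚ.toℚᵘ-injective
    (ℚᵘₚ.≃-trans (ℚₚ.toℚᵘ-fromℚᵘ (mkℚᵘ (ℤ.+ (m + n)) 0))
    (ℚᵘₚ.≃-trans (ℚᵘ.*≡* (cong (ℤ._* ℤ.+ 1) (trans (ℤₚ.pos-+ m n)
       (cong₂ ℤ._+_ (sym (ℤₚ.*-identityʳ (ℤ.+ m))) (sym (ℤₚ.*-identityʳ (ℤ.+ n)))))))
    (ℚᵘₚ.≃-trans (ℚᵘₚ.+-cong (ℚᵘₚ.≃-sym (ℚₚ.toℚᵘ-fromℚᵘ (mkℚᵘ (ℤ.+ m) 0)))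
                             (ℚᵘₚ.≃-sym (ℚₚ.toℚᵘ-fromℚᵘ (mkℚᵘ (ℤ.+ n) 0))))
     (ℚᵘₚ.≃-sym (ℚₚ.toℚᵘ-homo-+ (fromℕ m) (fromℕ n))))))

  fromℕ-* : ∀ m n → fromℕ (m * n) ≡ fromℕ m ℚ.* fromℕ n
  fromℕ-* zero    n = sym (ℚₚ.*-zeroˡ (fromℕ n))
  fromℕ-* (suc m) n = begin
    fromℕ (n + m * n)                     ≡⟨ fromℕ-+ n (m * n) ⟩
    fromℕ n ℚ.+ fromℕ (m * n)             ≡⟨ cong (fromℕ n ℚ.+_) (fromℕ-* m n) ⟩
    fromℕ n ℚ.+ fromℕ m ℚ.* fromℕ n       ≡⟨ solve 2 (λ a b → b :+ a :* b := (con 1ℚ :+ a) :* b) refl (fromℕ m) (fromℕ n) ⟩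
    (1ℚ ℚ.+ fromℕ m) ℚ.* fromℕ n          ≡⟨ cong (ℚ._* fromℕ n) (sym (fromℕ-+ 1 m)) ⟩
    fromℕ (suc m) ℚ.* fromℕ n             ∎
    where open ≡-Reasoning

  fromℕ-≥0 : ∀ n → 0ℚ ℚ.≤ fromℕ n
  fromℕ-≥0 zero    = ℚₚ.≤-refl
  fromℕ-≥0 (suc n) = subst (0ℚ ℚ.≤_) (sym (fromℕ-+ 1 n)) (+-≥0 0≤1 (fromℕ-≥0 n))

  fromℕ-mono : ∀ {m n} → m ≤ n → fromℕ m ℚ.≤ fromℕ n
  fromℕ-mono {m} {n} m≤n = subst (fromℕ m ℚ.≤_)
    (trans (sym (fromℕ-+ m (n ∸ m))) (cong fromℕ (ℕₚ.m+[n∸m]≡n m≤n))) (p≤p+q (fromℕ-≥0 (n ∸ m)))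

  fromℕ-mono-< : ∀ {m n} → m < n → fromℕ m ℚ.< fromℕ n
  fromℕ-mono-< {m} m<n = ℚₚ.<-≤-trans
    (subst₂ ℚ._<_ (ℚₚ.+-identityˡ (fromℕ m)) (sym (fromℕ-+ 1 m)) (ℚₚ.+-monoˡ-< (fromℕ m) (ℚₚ.positive⁻¹ 1ℚ)))
    (fromℕ-mono m<n)

  fromℕ-cancel-≤ : ∀ {m n} → fromℕ m ℚ.≤ fromℕ n → m ≤ n
  fromℕ-cancel-≤ {m} {n} le with m ℕ.≤? n
  ... | yes m≤n = m≤n
  ... | no m≰n = contradiction (ℚₚ.<-≤-trans (fromℕ-mono-< (ℕₚ.≰⇒> m≰n)) le) (ℚₚ.<-irrefl refl)

  recip-* : ∀ n → n ≢ 0 → recip n ℚ.* fromℕ n ≡ 1ℚ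
  recip-* zero    n≢0 = contradiction refl n≢0
  recip-* (suc n) _   = ℚₚ.toℚᵘ-injective
    (ℚᵘₚ.≃-trans (ℚₚ.toℚᵘ-homo-* (recip (suc n)) (fromℕ (suc n)))
    (ℚᵘₚ.≃-trans (ℚᵘₚ.*-cong (ℚₚ.toℚᵘ-fromℚᵘ (mkℚᵘ (ℤ.+ 1) n)) (ℚₚ.toℚᵘ-fromℚᵘ (mkℚᵘ (ℤ.+ suc n) 0)))
     (ℚᵘ.*≡* (trans (ℤₚ.*-identityʳ (ℤ.+ 1 ℤ.* ℤ.+ suc n))
       (cong (λ m → ℤ.+ 1 ℤ.* ℤ.+ m) (sym (ℕₚ.*-identityʳ (suc n))))))))

  recip-≥0 : ∀ n → 0ℚ ℚ.≤ recip n
  recip-≥0 zero    = ℚₚ.≤-refl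
  recip-≥0 (suc n) = ℚₚ.nonNegative⁻¹ _ {{ℚₚ.normalize-nonNeg 1 (suc n)}}

  recip-≤1 : ∀ {n} → n ≢ 0 → recip n ℚ.≤ 1ℚ
  recip-≤1 {n} n≢0 = subst₂ ℚ._≤_ (ℚₚ.*-identityʳ (recip n)) (recip-* n n≢0)
    (*-monoʳ-≤ (recip-≥0 n) (fromℕ-mono (ℕₚ.n≢0⇒n>0 n≢0)))

  module _ {A : Set} where

    ∑-cong : ∀ {f g : A → ℚ} xs → (∀ x → x ∈ₗ xs → f x ≡ g x) → ∑ f xs ≡ ∑ g xs
    ∑-cong []       eq = refl
    ∑-cong (x ∷ xs) eq = cong₂ ℚ._+_ (eq x (here refl)) (∑-cong xs (λ y y∈ → eq y (there y∈)))

    ∑-mono : ∀ {f g : A → ℚ} xs → (∀ x → x ∈ₗ xs → f x ℚ.≤ g x) → ∑ f xs ℚ.≤ ∑ g xs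
    ∑-mono []       le = ℚₚ.≤-refl
    ∑-mono (x ∷ xs) le = ℚₚ.+-mono-≤ (le x (here refl)) (∑-mono xs (λ y y∈ → le y (there y∈)))

    ∑-0 : ∀ (xs : List A) → ∑ (λ _ → 0ℚ) xs ≡ 0ℚ
    ∑-0 []       = refl
    ∑-0 (x ∷ xs) = trans (ℚₚ.+-identityˡ _) (∑-0 xs)

    ∑-≥0 : ∀ {f : A → ℚ} xs → (∀ x → 0ℚ ℚ.≤ f x) → 0ℚ ℚ.≤ ∑ f xs
    ∑-≥0 {f} xs f≥0 = subst (ℚ._≤ ∑ f xs) (∑-0 xs) (∑-mono {f = λ _ → 0ℚ} xs (λ x _ → f≥0 x))

    ∑-+ : ∀ (f g : A → ℚ) xs → ∑ (λ x → f x ℚ.+ g x) xs ≡ ∑ f xs ℚ.+ ∑ g xs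
    ∑-+ f g []       = refl
    ∑-+ f g (x ∷ xs) = trans (cong (f x ℚ.+ g x ℚ.+_) (∑-+ f g xs))
      (solve 4 (λ a b c d → (a :+ b) :+ (c :+ d) := (a :+ c) :+ (b :+ d)) refl (f x) (g x) (∑ f xs) (∑ g xs))

    ∑-*ˡ : ∀ c (f : A → ℚ) xs → ∑ (λ x → c ℚ.* f x) xs ≡ c ℚ.* ∑ f xs
    ∑-*ˡ c f []       = sym (ℚₚ.*-zeroʳ c)
    ∑-*ˡ c f (x ∷ xs) = trans (cong (c ℚ.* f x ℚ.+_) (∑-*ˡ c f xs)) (sym (ℚₚ.*-distribˡ-+ c (f x) (∑ f xs)))

    ∑-const : ∀ c (xs : List A) → ∑ (λ _ → c) xs ≡ fromℕ (length xs) ℚ.* c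
    ∑-const c []       = sym (ℚₚ.*-zeroˡ c)
    ∑-const c (x ∷ xs) = begin
      c ℚ.+ ∑ (λ _ → c) xs              ≡⟨ cong (c ℚ.+_) (∑-const c xs) ⟩
      c ℚ.+ fromℕ (length xs) ℚ.* c     ≡⟨ solve 2 (λ c l → c :+ l :* c := (con 1ℚ :+ l) :* c) refl c (fromℕ (length xs)) ⟩
      (1ℚ ℚ.+ fromℕ (length xs)) ℚ.* c  ≡⟨ cong (ℚ._* c) (sym (fromℕ-+ 1 (length xs))) ⟩
      fromℕ (suc (length xs)) ℚ.* c     ∎
      where open ≡-Reasoning

    ∑-bound : ∀ {f : A → ℚ} {c} xs → (∀ x → x ∈ₗ xs → f x ℚ.≤ c) → ∑ f xs ℚ.≤ fromℕ (length xs) ℚ.* c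
    ∑-bound {f} xs le = subst (∑ f xs ℚ.≤_) (∑-const _ xs) (∑-mono xs le)

    ∑-filter : ∀ {P : Pred A 0ℓ} (P? : ∀ x → Dec (P x)) f xs →
               ∑ f (filter P? xs) ≡ ∑ (λ x → ⟦ P? x ⟧? ℚ.* f x) xs
    ∑-filter P? f []       = refl
    ∑-filter P? f (x ∷ xs) with P? x
    ... | yes _ = cong₂ ℚ._+_ (sym (ℚₚ.*-identityˡ (f x))) (∑-filter P? f xs)
    ... | no  _ = trans (∑-filter P? f xs)
                    (sym (trans (cong (ℚ._+ _) (ℚₚ.*-zeroˡ (f x))) (ℚₚ.+-identityˡ _)))

    ∑-++ : ∀ (f : A → ℚ) xs ys → ∑ f (xs ++ ys) ≡ ∑ f xs ℚ.+ ∑ f ys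
    ∑-++ f []       ys = sym (ℚₚ.+-identityˡ _)
    ∑-++ f (x ∷ xs) ys = trans (cong (f x ℚ.+_) (∑-++ f xs ys)) (sym (ℚₚ.+-assoc (f x) _ _))

  term≤∑ : {A : Set} {f : A → ℚ} {x : A} {xs : List A} → (∀ y → 0ℚ ℚ.≤ f y) → x ∈ₗ xs → f x ℚ.≤ ∑ f xs
  term≤∑ {xs = _ ∷ xs} f≥0 (here refl) = p≤p+q (∑-≥0 xs f≥0)
  term≤∑ {xs = y ∷ xs} f≥0 (there x∈)  = ℚₚ.≤-trans (term≤∑ f≥0 x∈) (p≤q+p (f≥0 y))

  ∑-swap : {A B : Set} (h : A → B → ℚ) (xs : List A) (ys : List B) →
           ∑ (λ x → ∑ (h x) ys) xs ≡ ∑ (λ y → ∑ (λ x → h x y) xs) ys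
  ∑-swap h []       ys = sym (∑-0 ys)
  ∑-swap h (x ∷ xs) ys = trans (cong (∑ (h x) ys ℚ.+_) (∑-swap h xs ys))
    (sym (∑-+ (h x) (λ y → ∑ (λ x → h x y) xs) ys))

  ∑-cartesianProduct : {A B : Set} (h : A × B → ℚ) (xs : List A) (ys : List B) →
                       ∑ h (cartesianProduct xs ys) ≡ ∑ (λ x → ∑ (λ y → h (x , y)) ys) xs
  ∑-cartesianProduct h []       ys = refl
  ∑-cartesianProduct h (x ∷ xs) ys = trans (∑-++ h (map (x ,_) ys) _)
    (cong₂ ℚ._+_ (cong sumℚ (sym (Listₚ.map-∘ ys))) (∑-cartesianProduct h xs ys))

  -- The partner of the head is cut out of `ys`, and the last hypothesis ensures that no later
  -- element needs it. A relation takes the place of an injective function because expansions are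
  -- compared only by their values on tuples.
  ∑-injection : {A B : Set} (R : A → B → Set) {f : A → ℚ} {g : B → ℚ} (xs : List A) (ys : List B) →
    (∀ y → 0ℚ ℚ.≤ g y) →
    (∀ x → x ∈ₗ xs → ∃[ y ] y ∈ₗ ys × R x y × f x ℚ.≤ g y) →
    AllPairs (λ x x′ → ∀ y → R x y → ¬ R x′ y) xs →
    ∑ f xs ℚ.≤ ∑ g ys
  ∑-injection R []       ys g≥0 tot inj = ∑-≥0 ys g≥0
  ∑-injection {A} {B} R {f} {g} (x ∷ xs) ys g≥0 tot (x# ∷ inj)
    with y , y∈ys , Rxy , fx≤gy ← tot x (here refl)
    with ys₁ , ys₂ , refl ← ∈ₗ.∈-∃++ y∈ys = begin
      f x ℚ.+ ∑ f xs                   ≤⟨ ℚₚ.+-mono-≤ fx≤gy (∑-injection R xs (ys₁ ++ ys₂) g≥0 tot′ inj) ⟩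
      g y ℚ.+ ∑ g (ys₁ ++ ys₂)         ≡⟨ cong (g y ℚ.+_) (∑-++ g ys₁ ys₂) ⟩
      g y ℚ.+ (∑ g ys₁ ℚ.+ ∑ g ys₂)    ≡⟨ solve 3 (λ a b c → a :+ (b :+ c) := b :+ (a :+ c)) refl (g y) (∑ g ys₁) (∑ g ys₂) ⟩
      ∑ g ys₁ ℚ.+ ∑ g (y ∷ ys₂)        ≡⟨ sym (∑-++ g ys₁ (y ∷ ys₂)) ⟩
      ∑ g (ys₁ ++ y ∷ ys₂)             ∎
    where
      open ℚₚ.≤-Reasoning
      tot′ : ∀ x′ → x′ ∈ₗ xs → ∃[ y′ ] y′ ∈ₗ (ys₁ ++ ys₂) × R x′ y′ × f x′ ℚ.≤ g y′
      tot′ x′ x′∈ with y′ , y′∈ , Rx′y′ , le ← tot x′ (there x′∈) | ∈ₗ.∈-++⁻ ys₁ y′∈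
      ... | inj₁ y′∈₁         = y′ , ∈ₗ.∈-++⁺ˡ y′∈₁ , Rx′y′ , le
      ... | inj₂ (there y′∈₂) = y′ , ∈ₗ.∈-++⁺ʳ ys₁ y′∈₂ , Rx′y′ , le
      ... | inj₂ (here refl)  = contradiction Rx′y′ (Allₗ.lookup x# x′∈ y Rxy)

  ∑-one-hot : {A : Set} {P : Pred A 0ℓ} (P? : ∀ x → Dec (P x)) (c : ℚ) (xs : List A) →
    (∃[ x ] x ∈ₗ xs × P x) → AllPairs (λ x y → P x → ¬ P y) xs →
    ∑ (λ x → ⟦ P? x ⟧? ℚ.* c) xs ≡ c
  ∑-one-hot {A} {P} P? c (x ∷ xs) (z , z∈ , Pz) (x# ∷ inj) with P? x
  ... | yes Px = trans (cong₂ ℚ._+_ (ℚₚ.*-identityˡ c)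
          (trans (∑-cong xs (λ y y∈ → trans (cong (ℚ._* c) (⟦⟧?-no (P? y) (Allₗ.lookup x# y∈ Px))) (ℚₚ.*-zeroˡ c)))
                 (∑-0 xs))) (ℚₚ.+-identityʳ c)
  ... | no ¬Px = trans (cong₂ ℚ._+_ (ℚₚ.*-zeroˡ c) (∑-one-hot P? c xs (tail z∈) inj)) (ℚₚ.+-identityˡ c)
    where
      tail : z ∈ₗ (x ∷ xs) → ∃[ x ] x ∈ₗ xs × P x
      tail (here refl) = contradiction Pz ¬Px
      tail (there z∈)  = z , z∈ , Pz

  ∏ : {A : Set} → (A → ℚ) → List A → ℚ
  ∏ f []       = 1ℚ
  ∏ f (x ∷ xs) = f x ℚ.* ∏ f xs

  ∏-cong : {A : Set} {f g : A → ℚ} (xs : List A) → (∀ x → x ∈ₗ xs → f x ≡ g x) → ∏ f xs ≡ ∏ g xs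
  ∏-cong []       eq = refl
  ∏-cong (x ∷ xs) eq = cong₂ ℚ._*_ (eq x (here refl)) (∏-cong xs (λ y y∈ → eq y (there y∈)))

  ∏-≥0 : {A : Set} {f : A → ℚ} (xs : List A) → (∀ x → 0ℚ ℚ.≤ f x) → 0ℚ ℚ.≤ ∏ f xs
  ∏-≥0 []       f≥0 = 0≤1
  ∏-≥0 (x ∷ xs) f≥0 = *-≥0 (f≥0 x) (∏-≥0 xs f≥0)

  infixr 8 _^ℚ_
  _^ℚ_ : ℚ → ℕ → ℚ
  x ^ℚ zero  = 1ℚ
  x ^ℚ suc n = x ℚ.* x ^ℚ n

  ∏-const : {A : Set} (c : ℚ) (xs : List A) → ∏ (λ _ → c) xs ≡ c ^ℚ length xs
  ∏-const c []       = refl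
  ∏-const c (x ∷ xs) = cong (c ℚ.*_) (∏-const c xs)

  ^ℚ-≥0 : ∀ {x} n → 0ℚ ℚ.≤ x → 0ℚ ℚ.≤ x ^ℚ n
  ^ℚ-≥0 zero    0≤x = 0≤1
  ^ℚ-≥0 (suc n) 0≤x = *-≥0 0≤x (^ℚ-≥0 n 0≤x)

  ^ℚ-mono : ∀ {x y} n → 0ℚ ℚ.≤ x → x ℚ.≤ y → x ^ℚ n ℚ.≤ y ^ℚ n
  ^ℚ-mono zero    0≤x x≤y = ℚₚ.≤-refl
  ^ℚ-mono (suc n) 0≤x x≤y = *-mono-≤ 0≤x (^ℚ-≥0 n (ℚₚ.≤-trans 0≤x x≤y)) x≤y (^ℚ-mono n 0≤x x≤y)

  ^ℚ-distrib-* : ∀ x y n → (x ℚ.* y) ^ℚ n ≡ x ^ℚ n ℚ.* y ^ℚ n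
  ^ℚ-distrib-* x y zero    = refl
  ^ℚ-distrib-* x y (suc n) = trans (cong (x ℚ.* y ℚ.*_) (^ℚ-distrib-* x y n))
    (*-interchange x y (x ^ℚ n) (y ^ℚ n))

  1^ℚ : ∀ n → 1ℚ ^ℚ n ≡ 1ℚ
  1^ℚ zero    = refl
  1^ℚ (suc n) = trans (ℚₚ.*-identityˡ _) (1^ℚ n)

  ^ℚ-swap : ∀ x m n → (x ^ℚ m) ^ℚ n ≡ (x ^ℚ n) ^ℚ m
  ^ℚ-swap x zero    n = 1^ℚ n
  ^ℚ-swap x (suc m) n = trans (^ℚ-distrib-* x (x ^ℚ m) n) (cong (x ^ℚ n ℚ.*_) (^ℚ-swap x m n))

  fromℕ-^ : ∀ m n → fromℕ (m ^ n) ≡ fromℕ m ^ℚ n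
  fromℕ-^ m zero    = refl
  fromℕ-^ m (suc n) = trans (fromℕ-* m (m ^ n)) (cong (fromℕ m ℚ.*_) (fromℕ-^ m n))

-- Pregeometries: exchange, dimension, restriction along a map

image : {A D : Set} → (A → D) → Pred A 0ℓ → Pred D 0ℓ
image ι X y = ∃[ x ] X x × ι x ≡ y

∈-lookup : {A : Set} {m : ℕ} (xs : Vec A m) {x : A} → x ∈ xs → ∃[ j ] lookup xs j ≡ x
∈-lookup xs x∈ = Any.index x∈ , sym (Anyₚ.lookup-index x∈)

All⇒⊆ : {A : Set} {X : Pred A 0ℓ} {m : ℕ} {xs : Vec A m} → All X xs → (_∈ xs) ⊆ X
All⇒⊆ Xxs x∈ = All.lookup Xxs x∈

⊆⇒All : {A : Set} {X : Pred A 0ℓ} {m : ℕ} (xs : Vec A m) → (_∈ xs) ⊆ X → All X xs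
⊆⇒All []       f = []
⊆⇒All (x ∷ xs) f = f (here refl) ∷ ⊆⇒All xs (λ x∈ → f (there x∈))

module _ {A : Set} {cl : ClosureOp A} where

  HasDim-resp : ∀ {X Y d} → X ⊆ Y → Y ⊆ X → HasDim cl X d → HasDim cl Y d
  HasDim-resp X⊆Y Y⊆X (b , Xb , ind , span) = b , All.map X⊆Y Xb , ind , λ Ya → span (Y⊆X Ya)

  DimAtMost-mono : ∀ {X d e} → d ≤ e → DimAtMost cl X d → DimAtMost cl X e
  DimAtMost-mono d≤e (c , h , c≤d) = c , h , ℕₚ.≤-trans c≤d d≤e

HasDim-cl : {A : Set} {cl cl′ : ClosureOp A} → (∀ X → cl X ⊆ cl′ X) → (∀ X → cl′ X ⊆ cl X) →
            ∀ {X d} → HasDim cl X d → HasDim cl′ X d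
HasDim-cl f g (b , Xb , ind , span) = b , Xb , (λ i c → ind i (g _ c)) , λ Xa → f _ (span Xa)

module Pregeometry (em : ExcludedMiddle 0ℓ) {A : Set} {cl : ClosureOp A} (pre : IsPregeometry cl) where
  open IsPregeometry pre public

  cl-least : ∀ {X Y} → X ⊆ cl Y → cl X ⊆ cl Y
  cl-least {Y = Y} X⊆ c = idempotent Y (monotone X⊆ c)

  Rest : ∀ {d} → (Fin d → A) → Fin d → Pred A 0ℓ
  Rest v i x = ∃[ j ] j ≢ i × v j ≡ x

  -- Independence in the contraction by `X`. Tuples are functions on `Fin d`, so that deleting an
  -- entry is composition with `punchIn`.
  IndependentOver : Pred A 0ℓ → ∀ {d} → (Fin d → A) → Set
  IndependentOver X v = ∀ i → ¬ cl (X ∪ Rest v i) (v i)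

  independentOver-punchIn : ∀ {X d} (v : Fin (suc d) → A) i → IndependentOver X v →
                            IndependentOver (X ∪ ｛ v i ｝) (v ∘ punchIn i)
  independentOver-punchIn {X} v i ind j c = ind (punchIn i j) (monotone sub c)
    where
      sub : (X ∪ ｛ v i ｝) ∪ Rest (v ∘ punchIn i) j ⊆ X ∪ Rest v (punchIn i j)
      sub (inj₁ (inj₁ Xx))       = inj₁ Xx
      sub (inj₁ (inj₂ refl))     = inj₂ (i , (λ eq → Finₚ.punchInᵢ≢i i j (sym eq)) , refl)
      sub (inj₂ (k , k≢j , refl)) = inj₂ (punchIn i k , (λ eq → k≢j (Finₚ.punchIn-injective i k j eq)) , refl)

  -- Steinitz: trade an element of the spanning tuple for one of the v i, which is moved to X.
  steinitz : ∀ X {e} (b : Vec A e) {d} (v : Fin d → A) →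
             IndependentOver X v → (∀ i → cl (X ∪ (_∈ b)) (v i)) → d ≤ e
  steinitz X b {zero} v ind span = z≤n
  steinitz X [] {suc d} v ind span =
    contradiction (monotone (λ { (inj₁ Xx) → inj₁ Xx }) (span zero)) (ind zero)
  steinitz X {suc e} (b₀ ∷ b) {suc d} v ind span
    with em {P = ∃[ i ] ¬ cl (X ∪ (_∈ b)) (v i)}
  ... | no ¬ex = ℕₚ.m≤n⇒m≤1+n (steinitz X b v ind (λ i → decidable-stable em (λ n → ¬ex (i , n))))
  ... | yes (i , vi∉) = s≤s (steinitz (X ∪ ｛ v i ｝) b (v ∘ punchIn i) (independentOver-punchIn v i ind)
          (λ j → cl-least sub (span (punchIn i j))))
    where
      b₀∈ : cl ((X ∪ (_∈ b)) ∪ ｛ v i ｝) b₀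
      b₀∈ = exchange (X ∪ (_∈ b)) (monotone (λ { (inj₁ Xx) → inj₁ (inj₁ Xx)
                                               ; (inj₂ (here refl)) → inj₂ refl
                                               ; (inj₂ (there x∈)) → inj₁ (inj₂ x∈) }) (span i)) vi∉
      sub : X ∪ (_∈ (b₀ ∷ b)) ⊆ cl ((X ∪ ｛ v i ｝) ∪ (_∈ b))
      sub (inj₁ Xx)           = extensive _ (inj₁ (inj₁ Xx))
      sub (inj₂ (here refl))  = monotone (λ { (inj₁ (inj₁ Xx)) → inj₁ (inj₁ Xx)
                                            ; (inj₁ (inj₂ x∈)) → inj₂ x∈
                                            ; (inj₂ refl) → inj₁ (inj₂ refl) }) b₀∈
      sub (inj₂ (there x∈))   = extensive _ (inj₂ x∈)

  independent-≤ : ∀ {d e} (v : Vec A d) (b : Vec A e) → Independent cl v → (_∈ v) ⊆ cl (_∈ b) → d ≤ e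
  independent-≤ v b ind span = steinitz (λ _ → ⊥) b (lookup v)
    (λ i c → ind i (monotone (λ { (inj₂ r) → r }) c))
    (λ i → monotone inj₂ (span (∈ₚ.∈-lookup i v)))

  dim-mono : ∀ {X Y d e} → HasDim cl X d → HasDim cl Y e → X ⊆ cl Y → d ≤ e
  dim-mono (v , Xv , ind , _) (b , _ , _ , span) X⊆Y =
    independent-≤ v b ind (λ x∈ → cl-least span (X⊆Y (All⇒⊆ Xv x∈)))

  dim-unique : ∀ {X d e} → HasDim cl X d → HasDim cl X e → d ≡ e
  dim-unique h h′ = ℕₚ.≤-antisym (dim-mono h h′ (extensive _)) (dim-mono h′ h (extensive _))

  independent-∷ : ∀ {d} {v : Vec A d} {x} → Independent cl v → ¬ cl (_∈ v) x → Independent cl (x ∷ v)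
  independent-∷ {v = v} {x} ind x∉ zero c = x∉ (monotone sub c)
    where
      sub : Rest (lookup (x ∷ v)) zero ⊆ (_∈ v)
      sub (zero  , 0≢0 , _)    = contradiction refl 0≢0
      sub (suc j , _   , refl) = ∈ₚ.∈-lookup j v
  independent-∷ {v = v} {x} ind x∉ (suc i) c = x∉ (monotone sub′ (exchange (Rest (lookup v) i) (monotone sub c) (ind i)))
    where
      sub : Rest (lookup (x ∷ v)) (suc i) ⊆ Rest (lookup v) i ∪ ｛ x ｝
      sub (zero  , _    , refl) = inj₂ refl
      sub (suc j , j≢i  , refl) = inj₁ (j , (λ eq → j≢i (cong suc eq)) , refl)
      sub′ : Rest (lookup v) i ∪ ｛ lookup v i ｝ ⊆ (_∈ v)
      sub′ (inj₁ (j , _ , refl)) = ∈ₚ.∈-lookup j v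
      sub′ (inj₂ refl)           = ∈ₚ.∈-lookup i v

  -- An independent tuple inside the closure of `b` has length at most `e`; under `e < d + fuel` the
  -- greedy search therefore never runs out of fuel.
  extend-to-basis : ∀ {X e} (b : Vec A e) → X ⊆ cl (_∈ b) → ∀ fuel {d} (v : Vec A d) → e < d + fuel →
                    All X v → Independent cl v → DimAtMost cl X e
  extend-to-basis {X} {e} b span fuel {d} v lt Xv ind with em {P = ∃[ x ] X x × ¬ cl (_∈ v) x}
  ... | no ¬ex = d , (v , Xv , ind , λ {x} Xx → decidable-stable em (λ n → ¬ex (x , Xx , n)))
               , independent-≤ v b ind (λ x∈ → span (All⇒⊆ Xv x∈))
  ... | yes (x , Xx , x∉) with fuel
  ...   | zero  = contradiction (independent-≤ v b ind (λ y∈ → span (All⇒⊆ Xv y∈)))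
                    (ℕₚ.<⇒≱ (subst (e <_) (ℕₚ.+-identityʳ d) lt))
  ...   | suc f = extend-to-basis b span f (x ∷ v) (subst (e <_) (ℕₚ.+-suc d f) lt) (Xx ∷ Xv) (independent-∷ ind x∉)

  dimAtMost : ∀ {X e} (b : Vec A e) → X ⊆ cl (_∈ b) → DimAtMost cl X e
  dimAtMost {e = e} b span = extend-to-basis b span (suc e) [] ℕₚ.≤-refl [] λ ()

  -- A point outside the span would lengthen `v` to an independent tuple with more entries than a
  -- basis of `X`.
  spans-of-dim : ∀ {X d} → HasDim cl X d → (v : Vec A d) → All X v → Independent cl v → X ⊆ cl (_∈ v)
  spans-of-dim {X} {d} (b , Xb , _ , span) v Xv ind {x} Xx = decidable-stable em λ x∉ →
    contradiction (independent-≤ (x ∷ v) b (independent-∷ ind x∉)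
      (λ { (here refl) → span Xx ; (there y∈) → span (All⇒⊆ Xv y∈) })) (ℕₚ.<⇒≱ ℕₚ.≤-refl)

  HasDim-closure : ∀ {X d} → HasDim cl X d → HasDim cl (cl X) d
  HasDim-closure (b , Xb , ind , span) = b , All.map (extensive _) Xb , ind , cl-least span

module _ {A D : Set} {ι : A → D} where

  image-mono : ∀ {X Y : Pred A 0ℓ} → X ⊆ Y → image ι X ⊆ image ι Y
  image-mono X⊆Y (x , Xx , eq) = x , X⊆Y Xx , eq

  pullback-vec : ∀ {X m} {ys : Vec D m} → All (image ι X) ys → Σ[ xs ∈ Vec A m ] All X xs × Vec.map ι xs ≡ ys
  pullback-vec []                          = [] , [] , refl
  pullback-vec ((x , Xx , refl) ∷ h) with xs , Xxs , refl ← pullback-vec h = x ∷ xs , Xx ∷ Xxs , refl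

  ∈-map⇒image : ∀ {m} (xs : Vec A m) → (_∈ Vec.map ι xs) ⊆ image ι (_∈ xs)
  ∈-map⇒image (x ∷ xs) (here refl) = x , here refl , refl
  ∈-map⇒image (x ∷ xs) (there y∈) with x′ , x′∈ , eq ← ∈-map⇒image xs y∈ = x′ , there x′∈ , eq

  image⇒∈-map : ∀ {m} (xs : Vec A m) → image ι (_∈ xs) ⊆ (_∈ Vec.map ι xs)
  image⇒∈-map xs (x , x∈ , refl) = ∈ₚ.∈-map⁺ ι x∈

-- Says that `clA` is the restriction of `clD` along `ι`. Both isomorphisms and inclusions of closed
-- substructures are of this kind, so one transfer of dimension serves for both.
record ClosureEmbedding {A D : Set} (clA : ClosureOp A) (clD : ClosureOp D) (ι : A → D) : Set₁ where
  field
    fwd : ∀ {X a} → clA X a → clD (image ι X) (ι a)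
    bwd : ∀ {X a} → clD (image ι X) (ι a) → clA X a

module _ {A D : Set} {clA : ClosureOp A} {clD : ClosureOp D} {ι : A → D}
         (emb : ClosureEmbedding clA clD ι) (pre : IsPregeometry clD) where
  open ClosureEmbedding emb
  private module D = IsPregeometry pre

  restricted-pregeometry : IsPregeometry clA
  restricted-pregeometry = record
    { extensive  = λ X {a} Xa → bwd (D.extensive _ (a , Xa , refl))
    ; monotone   = λ X⊆Y c → bwd (D.monotone (image-mono X⊆Y) (fwd c))
    ; idempotent = λ X c → bwd (D.idempotent _ (D.monotone (λ { (x , cx , refl) → fwd cx }) (fwd c)))
    ; exchange   = λ X {a} {b} c ¬c → bwd (D.monotone
        (λ { (inj₁ (x , Xx , eq)) → x , inj₁ Xx , eq ; (inj₂ refl) → b , inj₂ refl , refl })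
        (D.exchange (image ι X) (D.monotone
          (λ { (x , inj₁ Xx , eq) → inj₁ (x , Xx , eq) ; (x , inj₂ refl , eq) → inj₂ eq }) (fwd c))
          (λ c′ → ¬c (bwd c′))))
    ; finitary   = λ X c → case D.finitary _ (fwd c) of λ (m , ys , h , c′) →
        case pullback-vec h of λ { (xs , Xxs , refl) →
          m , xs , Xxs , bwd (D.monotone (∈-map⇒image xs) c′) }
    }

  private
    rest-fwd : ∀ {d} (b : Vec A d) i →
      image ι (λ x → ∃[ j ] j ≢ i × lookup b j ≡ x) ⊆ (λ y → ∃[ j ] j ≢ i × lookup (Vec.map ι b) j ≡ y)
    rest-fwd b i (_ , (j , j≢i , refl) , refl) = j , j≢i , Vecₚ.lookup-map j ι b

    rest-bwd : ∀ {d} (b : Vec A d) i →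
      (λ y → ∃[ j ] j ≢ i × lookup (Vec.map ι b) j ≡ y) ⊆ image ι (λ x → ∃[ j ] j ≢ i × lookup b j ≡ x)
    rest-bwd b i (j , j≢i , refl) = lookup b j , (j , j≢i , refl) , sym (Vecₚ.lookup-map j ι b)

  push-HasDim : ∀ {X d} → HasDim clA X d → HasDim clD (image ι X) d
  push-HasDim {X} (b , Xb , ind , span) =
      Vec.map ι b
    , Allₚ.map⁺ (All.map (λ {x} Xx → x , Xx , refl) Xb)
    , (λ i c → ind i (bwd (D.monotone (rest-bwd b i) (subst (clD _) (Vecₚ.lookup-map i ι b) c))))
    , λ { (x , Xx , refl) → D.monotone (image⇒∈-map b) (fwd (span Xx)) }

  pull-HasDim : ∀ {X d} → HasDim clD (image ι X) d → HasDim clA X d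
  pull-HasDim {X} (b , Xb , ind , span) with xs , Xxs , refl ← pullback-vec Xb =
      xs , Xxs
    , (λ i c → ind i (subst (clD _) (sym (Vecₚ.lookup-map i ι xs)) (D.monotone (rest-fwd xs i) (fwd c))))
    , λ {x} Xx → bwd (D.monotone (∈-map⇒image xs) (span (x , Xx , refl)))

toWitness : {P : Set} (d : Dec P) → T (does d) → P
toWitness (yes p) _ = p

fromWitness : {P : Set} (d : Dec P) → P → T (does d)
fromWitness (yes _) _ = tt
fromWitness (no ¬p) p = ¬p p

-- Isomorphisms, satisfaction and the closure defined by formulas

module _ {V : Vocabulary} where
  open Vocabulary V

  ≐⇒Iso : {A : Set} {M N : Structure V A} → M ≐ N → Iso M N
  ≐⇒Iso {M = M} {N} (funs , rels) = record
    { bijection = mk↔ₛ′ id id (λ _ → refl) (λ _ → refl)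
    ; fun-pres  = λ f xs → trans (funs f xs (All.universal (λ _ → tt) xs)) (cong (fun N f) (sym (Vecₚ.map-id xs)))
    ; rel-pres  = λ R xs → trans (rels R xs (All.universal (λ _ → tt) xs)) (cong (rel N R) (sym (Vecₚ.map-id xs)))
    }

  iso-refl : {A : Set} {M : Structure V A} → Iso M M
  iso-refl = ≐⇒Iso ((λ _ _ _ → refl) , λ _ _ _ → refl)

  module _ {A B : Set} {M : Structure V A} {N : Structure V B} (h : Iso M N) where
    open Iso h
    from : B → A
    from = Inverse.from bijection

    to-from : ∀ b → to (from b) ≡ b
    to-from = Inverse.strictlyInverseˡ bijection

    from-to : ∀ a → from (to a) ≡ a
    from-to = Inverse.strictlyInverseʳ bijection

    to-injective : ∀ {a a′} → to a ≡ to a′ → a ≡ a′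
    to-injective {a} {a′} eq = trans (sym (from-to a)) (trans (cong from eq) (from-to a′))

    map-to-from : ∀ {m} (ys : Vec B m) → Vec.map to (Vec.map from ys) ≡ ys
    map-to-from ys = trans (sym (Vecₚ.map-∘ to from ys)) (trans (Vecₚ.map-cong to-from ys) (Vecₚ.map-id ys))

    iso-sym : Iso N M
    iso-sym = record
      { bijection = mk↔ₛ′ from to from-to to-from
      ; fun-pres  = λ f ys → to-injective (trans (to-from _)
          (sym (trans (fun-pres f (Vec.map from ys)) (cong (fun N f) (map-to-from ys)))))
      ; rel-pres  = λ R ys → sym (trans (rel-pres R (Vec.map from ys)) (cong (rel N R) (map-to-from ys)))
      }

    evalTerm-iso  : ∀ {n} (ρ : Vec A n) t → to (evalTerm M ρ t) ≡ evalTerm N (Vec.map to ρ) t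
    evalTerms-iso : ∀ {n m} (ρ : Vec A n) (ts : Vec (Term V n) m) →
                    Vec.map to (evalTerms M ρ ts) ≡ evalTerms N (Vec.map to ρ) ts
    evalTerm-iso ρ (var i)    = sym (Vecₚ.lookup-map i to ρ)
    evalTerm-iso ρ (app f ts) = trans (fun-pres f _) (cong (fun N f) (evalTerms-iso ρ ts))
    evalTerms-iso ρ []       = refl
    evalTerms-iso ρ (t ∷ ts) = cong₂ _∷_ (evalTerm-iso ρ t) (evalTerms-iso ρ ts)

    ⊨-iso  : ∀ {n} (ρ : Vec A n) φ → _⊨_ M ρ φ → _⊨_ N (Vec.map to ρ) φ
    ⊨-iso⁻ : ∀ {n} (ρ : Vec A n) φ → _⊨_ N (Vec.map to ρ) φ → _⊨_ M ρ φ
    ⊨-iso ρ (s ≈′ t) eq = trans (sym (evalTerm-iso ρ s)) (trans (cong to eq) (evalTerm-iso ρ t))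
    ⊨-iso ρ (atom R ts) r = subst T (trans (rel-pres R _) (cong (rel N R) (evalTerms-iso ρ ts))) r
    ⊨-iso ρ (φ ⇒′ ψ) f p = ⊨-iso ρ ψ (f (⊨-iso⁻ ρ φ p))
    ⊨-iso ρ (∀′ φ) f b = subst (λ c → _⊨_ N (c ∷ Vec.map to ρ) φ) (to-from b) (⊨-iso (from b ∷ ρ) φ (f (from b)))
    ⊨-iso⁻ ρ (s ≈′ t) eq = to-injective (trans (evalTerm-iso ρ s) (trans eq (sym (evalTerm-iso ρ t))))
    ⊨-iso⁻ ρ (atom R ts) r = subst T (sym (trans (rel-pres R _) (cong (rel N R) (evalTerms-iso ρ ts)))) r
    ⊨-iso⁻ ρ (φ ⇒′ ψ) f p = ⊨-iso⁻ ρ ψ (f (⊨-iso ρ φ p))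
    ⊨-iso⁻ ρ (∀′ φ) f a = ⊨-iso⁻ (a ∷ ρ) φ (f (to a))

  iso-trans : {A B C : Set} {M : Structure V A} {N : Structure V B} {O : Structure V C} →
              Iso M N → Iso N O → Iso M O
  iso-trans {O = O} h k = record
    { bijection = mk↔ₛ′ (Iso.to k ∘ Iso.to h) (from h ∘ from k)
        (λ c → trans (cong (Iso.to k) (to-from h (from k c))) (to-from k c))
        (λ a → trans (cong (from h) (from-to k (Iso.to h a))) (from-to h a))
    ; fun-pres  = λ f xs → trans (cong (Iso.to k) (Iso.fun-pres h f xs))
        (trans (Iso.fun-pres k f _) (cong (fun O f) (sym (Vecₚ.map-∘ (Iso.to k) (Iso.to h) xs))))
    ; rel-pres  = λ R xs → trans (Iso.rel-pres h R xs)
        (trans (Iso.rel-pres k R _) (cong (rel O R) (sym (Vecₚ.map-∘ (Iso.to k) (Iso.to h) xs))))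
    }

  module _ (C : Class V) where
    open InClass C

    cl-mono : {A : Set} (M : Structure V A) → ∀ {X Y} → X ⊆ Y → cl M X ⊆ cl M Y
    cl-mono M X⊆Y (m , xs , Xxs , sat) = m , xs , All.map X⊆Y Xxs , sat

    cl-iso : {A B : Set} {M : Structure V A} {N : Structure V B} (h : Iso M N) →
             ClosureEmbedding (cl M) (cl N) (Iso.to h)
    cl-iso {M = M} {N} h = record
      { fwd = λ { {X} {a} (m , xs , Xxs , sat) → m , Vec.map (Iso.to h) xs
                , Allₚ.map⁺ (All.map (λ {x} Xx → x , Xx , refl) Xxs)
                , subst (λ v → _⊨_ N v (Class.θ C m)) (Vecₚ.map-∷ʳ (Iso.to h) a xs) (⊨-iso h (xs ∷ʳ a) (Class.θ C m) sat) }
      ; bwd = λ { {X} {a} (m , ys , Yys , sat) → case pullback-vec Yys of λ { (xs , Xxs , refl) →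
                  m , xs , Xxs , ⊨-iso⁻ h (xs ∷ʳ a) (Class.θ C m)
                    (subst (λ v → _⊨_ N v (Class.θ C m)) (sym (Vecₚ.map-∷ʳ (Iso.to h) a xs)) sat) } }
      }

embedding-trans : {A B D : Set} {clA : ClosureOp A} {clB : ClosureOp B} {clD : ClosureOp D} {f : A → B} {g : B → D} →
  (∀ {X Y} → X ⊆ Y → clD X ⊆ clD Y) →
  ClosureEmbedding clA clB f → ClosureEmbedding clB clD g → ClosureEmbedding clA clD (g ∘ f)
embedding-trans mono F G = record
  { fwd = λ c → mono (λ { (_ , (x , Xx , refl) , refl) → x , Xx , refl }) (ClosureEmbedding.fwd G (ClosureEmbedding.fwd F c))
  ; bwd = λ c → ClosureEmbedding.bwd F (ClosureEmbedding.bwd G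
            (mono (λ { (x , Xx , refl) → _ , (x , Xx , refl) , refl }) c))
  }

module Lift (V₀ : Vocabulary) (r : ℕ) (arity : Fin r → ℕ) where
  open Extend V₀ r arity

  reduct-iso : {A B : Set} {M : Structure V A} {N : Structure V B} → Iso M N → Iso (reduct M) (reduct N)
  reduct-iso h = record { bijection = Iso.bijection h ; fun-pres = Iso.fun-pres h ; rel-pres = λ R → Iso.rel-pres h (inj₁ R) }

  expand-iso : {A B : Set} {M : Structure V₀ A} {N : Structure V B} (h : Iso M (reduct N)) (E : Expansion A) →
               (∀ R xs → E R xs ≡ rel N (inj₂ R) (Vec.map (Iso.to h) xs)) → Iso (expand M E) N
  expand-iso h E eq = record
    { bijection = Iso.bijection h ; fun-pres = Iso.fun-pres h
    ; rel-pres = λ { (inj₁ R) xs → Iso.rel-pres h R xs ; (inj₂ R) xs → eq R xs } }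

  module _ {A : Set} (M : Structure V A) where

    evalTerm-lift  : ∀ {n} (ρ : Vec A n) t → evalTerm M ρ (liftTerm t) ≡ evalTerm (reduct M) ρ t
    evalTerms-lift : ∀ {n m} (ρ : Vec A n) (ts : Vec (Term V₀ n) m) →
                     evalTerms M ρ (liftTerms ts) ≡ evalTerms (reduct M) ρ ts
    evalTerm-lift ρ (var i)    = refl
    evalTerm-lift ρ (app f ts) = cong (fun M f) (evalTerms-lift ρ ts)
    evalTerms-lift ρ []       = refl
    evalTerms-lift ρ (t ∷ ts) = cong₂ _∷_ (evalTerm-lift ρ t) (evalTerms-lift ρ ts)

    ⊨-lift  : ∀ {n} (ρ : Vec A n) φ → _⊨_ M ρ (liftFormula φ) → _⊨_ (reduct M) ρ φ
    ⊨-lift⁻ : ∀ {n} (ρ : Vec A n) φ → _⊨_ (reduct M) ρ φ → _⊨_ M ρ (liftFormula φ)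
    ⊨-lift ρ (s ≈′ t) eq = trans (sym (evalTerm-lift ρ s)) (trans eq (evalTerm-lift ρ t))
    ⊨-lift ρ (atom R ts) r = subst (λ v → T (rel M (inj₁ R) v)) (evalTerms-lift ρ ts) r
    ⊨-lift ρ (φ ⇒′ ψ) f p = ⊨-lift ρ ψ (f (⊨-lift⁻ ρ φ p))
    ⊨-lift ρ (∀′ φ) f a = ⊨-lift (a ∷ ρ) φ (f a)
    ⊨-lift⁻ ρ (s ≈′ t) eq = trans (evalTerm-lift ρ s) (trans eq (sym (evalTerm-lift ρ t)))
    ⊨-lift⁻ ρ (atom R ts) r = subst (λ v → T (rel M (inj₁ R) v)) (sym (evalTerms-lift ρ ts)) r
    ⊨-lift⁻ ρ (φ ⇒′ ψ) f p = ⊨-lift⁻ ρ ψ (f (⊨-lift ρ φ p))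
    ⊨-lift⁻ ρ (∀′ φ) f a = ⊨-lift⁻ (a ∷ ρ) φ (f a)

-- The pregeometry of a represented structure and of its closed substructures

module Closure (em : ExcludedMiddle 0ℓ) (𝐒 : Setting) where
  open Setting 𝐒
  open Lift V₀ r arity public
  module V₀ = Vocabulary V₀

  by-cases : {A : Set} (P : Set) → (P → A) → (¬ P → A) → A
  by-cases P f g = case em {P = P} of λ { (yes p) → f p ; (no ¬p) → g ¬p }

  module Pre (n : ℕ) = Pregeometry em (pregeometry n)

  clG⇒cl : ∀ {n} X → clG n X ⊆ InG.cl (𝓖 n) X
  clG⇒cl {n} X c with m , xs , Xxs , c′ ← Pre.finitary n X c = m , xs , Xxs , Equivalence.to (definable n m xs _) c′

  cl⇒clG : ∀ {n} X → InG.cl (𝓖 n) X ⊆ clG n X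
  cl⇒clG {n} X (m , xs , Xxs , sat) = Pre.monotone n (All⇒⊆ Xxs) (Equivalence.from (definable n m xs _) sat)

  clK⇒clG : {A : Set} (M : Structure V A) → ∀ X → InK.cl M X ⊆ InG.cl (reduct M) X
  clK⇒clG M X {a} (m , xs , Xxs , sat) = m , xs , Xxs , ⊨-lift M (xs ∷ʳ a) (θ m) sat

  clG⇒clK : {A : Set} (M : Structure V A) → ∀ X → InG.cl (reduct M) X ⊆ InK.cl M X
  clG⇒clK M X {a} (m , xs , Xxs , sat) = m , xs , Xxs , ⊨-lift⁻ M (xs ∷ʳ a) (θ m) sat

  up : {A : Set} (M : Structure V A) → InG.ClosedSub (reduct M) → InK.ClosedSub M
  up M S = record { mem = InClass.ClosedSub.mem S ; closed = λ c → InClass.ClosedSub.closed S (clK⇒clG M _ c)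
                  ; fun-closed = InClass.ClosedSub.fun-closed S }

  down : {A : Set} (M : Structure V A) → InK.ClosedSub M → InG.ClosedSub (reduct M)
  down M S = record { mem = InClass.ClosedSub.mem S ; closed = λ c → InClass.ClosedSub.closed S (clG⇒clK M _ c)
                    ; fun-closed = InClass.ClosedSub.fun-closed S }

  represented-resp : {A B : Set} {M : Structure V A} {N : Structure V B} → Iso M N → InK.Represented N → InK.Represented M
  represented-resp h (i , k) = i , iso-trans h k

  reduct-represented : {A : Set} {M : Structure V A} → InK.Represented M → InG.Represented (reduct M)
  reduct-represented ((n , _) , h) = n , reduct-iso h

  𝓖-represented : ∀ n → InG.Represented (𝓖 n)
  𝓖-represented n = n , iso-refl

  some-𝓚 : ∀ n → ∃[ E ] E ∈ₗ 𝓚 n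
  some-𝓚 n with 𝓚 n | 𝓚-nonempty n
  ... | []    | ne = contradiction refl ne
  ... | E ∷ _ | _  = E , here refl

  module _ {A : Set} {M : Structure V₀ A} (rep : InG.Represented M) where

    rep-embedding : ClosureEmbedding (InG.cl M) (clG (proj₁ rep)) (Iso.to (proj₂ rep))
    rep-embedding = embedding-trans (Pre.monotone _) (cl-iso Gclass (proj₂ rep)) record
      { fwd = λ {X} c → Pre.monotone _ (λ {x} Xx → x , Xx , refl) (cl⇒clG X c)
      ; bwd = λ {X} c → clG⇒cl X (Pre.monotone _ (λ { (x , Xx , refl) → Xx }) c) }

    pregeometry₀ : IsPregeometry (InG.cl M)
    pregeometry₀ = restricted-pregeometry rep-embedding (pregeometry _)

    -- The property is assumed for the `𝓖 n` alone, so `X` is carried there by the isomorphism and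
    -- the value is carried back.
    fun-closed₀ : ∀ X → Closed (InG.cl M) X → ∀ f xs → All X xs → X (fun M f xs)
    fun-closed₀ X X-closed f xs Xxs = case in-image of λ { (x , Xx , eq) →
        subst X (to-injective h (trans eq (sym (fun-pres f xs)))) Xx }
      where
        n = proj₁ rep
        h = proj₂ rep
        open Iso h
        in-image : image to X (fun (𝓖 n) f (Vec.map to xs))
        in-image = fun-closed n (image to X)
          (λ {y} c → from h y , X-closed (ClosureEmbedding.bwd rep-embedding (subst (clG n _) (sym (to-from h y)) c)) , to-from h y)
          f (Vec.map to xs) (Allₚ.map⁺ (All.map (λ {x} Xx → x , Xx , refl) Xxs))

    closedSub : (X : Pred A 0ℓ) → Closed (InG.cl M) X → InG.ClosedSub M
    closedSub X X-closed = record
      { mem        = λ a → does (em {P = X a})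
      ; closed     = λ c → fromWitness em (X-closed (cl-mono Gclass M (toWitness em) c))
      ; fun-closed = λ f xs → fromWitness em (fun-closed₀ X X-closed f (Vec.map proj₁ xs)
                       (Allₚ.map⁺ (All.universal (λ x → toWitness em (proj₂ x)) xs)))
      }

    closure : Pred A 0ℓ → InG.ClosedSub M
    closure X = closedSub (InG.cl M X) (IsPregeometry.idempotent pregeometry₀ X)

    -- The setting compares the closure of a closed substructure with the ambient one for
    -- represented `V`-structures. The `V₀`-structure `M` is therefore expanded by the new relations
    -- of some member of `𝓚`, which the formulas `θ m` do not see.
    sub-embedding : (S : InG.ClosedSub M) → ClosureEmbedding (InG.cl (M InG.↾ S)) (InG.cl M) proj₁
    sub-embedding S = record
      { fwd = λ {X} {a} → λ { (m , xs , Xxs , sat) →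
          cl-mono Gclass M (λ y∈ → image-mono (All⇒⊆ Xxs) (∈-map⇒image xs y∈))
            (clK⇒clG M⁺ _ (Equivalence.to (closedSub-cl M⁺ rep⁺ S⁺ xs a)
              (clG⇒clK (M⁺ InK.↾ S⁺) _ (m , xs , ⊆⇒All xs id , sat)))) }
      ; bwd = λ {X} {a} → λ { (m , ys , Yys , sat) → case pullback-vec Yys of λ { (xs , Xxs , refl) →
          cl-mono Gclass (M InG.↾ S) (All⇒⊆ Xxs)
            (clK⇒clG (M⁺ InK.↾ S⁺) _ (Equivalence.from (closedSub-cl M⁺ rep⁺ S⁺ xs a)
              (clG⇒clK M⁺ _ (m , Vec.map proj₁ xs , ⊆⇒All _ id , sat)))) } }
      }
      where
        E = proj₁ (some-𝓚 (proj₁ rep))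
        h = proj₂ rep
        M⁺ : Structure V A
        M⁺ = expand M (λ R xs → E R (Vec.map (Iso.to h) xs))
        rep⁺ : InK.Represented M⁺
        rep⁺ = (proj₁ rep , some-𝓚 (proj₁ rep)) , expand-iso h _ (λ _ _ → refl)
        S⁺ = up M⁺ S

    private
      from-El : (S : InG.ClosedSub M) → image proj₁ (U {A = InG.El S}) ⊆ InG.⟦ S ⟧
      from-El S ((_ , p) , _ , refl) = p
      to-El : (S : InG.ClosedSub M) → InG.⟦ S ⟧ ⊆ image proj₁ (U {A = InG.El S})
      to-El S {x} p = (x , p) , tt , refl

    HasDim-sub⁺ : (S : InG.ClosedSub M) → ∀ {d} → HasDim (InG.cl (M InG.↾ S)) U d → HasDim (InG.cl M) InG.⟦ S ⟧ d
    HasDim-sub⁺ S h = HasDim-resp {cl = InG.cl M} (from-El S) (to-El S) (push-HasDim (sub-embedding S) pregeometry₀ h)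

    HasDim-sub⁻ : (S : InG.ClosedSub M) → ∀ {d} → HasDim (InG.cl M) InG.⟦ S ⟧ d → HasDim (InG.cl (M InG.↾ S)) U d
    HasDim-sub⁻ S h = pull-HasDim (sub-embedding S) pregeometry₀ (HasDim-resp {cl = InG.cl M} (to-El S) (from-El S) h)

  HasDim-iso : {A B : Set} {M : Structure V₀ A} {N : Structure V₀ B} (repM : InG.Represented M) (repN : InG.Represented N)
    (S : InG.ClosedSub M) (S′ : InG.ClosedSub N) → Iso (M InG.↾ S) (N InG.↾ S′) →
    ∀ {d} → HasDim (InG.cl M) InG.⟦ S ⟧ d → HasDim (InG.cl N) InG.⟦ S′ ⟧ d
  HasDim-iso {N = N} repM repN S S′ h dS = HasDim-sub⁺ repN S′
    (HasDim-resp {cl = InG.cl (N InG.↾ S′)} (λ _ → tt) (λ {y} _ → from h y , tt , to-from h y)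
      (push-HasDim (cl-iso Gclass h) (restricted-pregeometry (sub-embedding repN S′) (pregeometry₀ repN))
        (HasDim-sub⁻ repM S dS)))

tuples : {A : Set} → List A → ∀ m → List (Vec A m)
tuples ys zero    = [] ∷ []
tuples ys (suc m) = cartesianProductWith _∷_ ys (tuples ys m)

∈-tuples : {A : Set} {ys : List A} {m : ℕ} {xs : Vec A m} → All (_∈ₗ ys) xs → xs ∈ₗ tuples ys m
∈-tuples []          = here refl
∈-tuples (x∈ ∷ xs∈) = ∈ₗ.∈-cartesianProductWith⁺ _∷_ x∈ (∈-tuples xs∈)

∈-tuples-allFin : ∀ {s m} (xs : Vec (Fin s) m) → xs ∈ₗ tuples (allFin s) m
∈-tuples-allFin xs = ∈-tuples (All.universal ∈ₗ.∈-allFin xs)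

length-cartesianProductWith : {A B C : Set} (f : A → B → C) (xs : List A) (ys : List B) →
                              length (cartesianProductWith f xs ys) ≡ length xs * length ys
length-cartesianProductWith f []       ys = refl
length-cartesianProductWith f (x ∷ xs) ys = trans (Listₚ.length-++ (map (f x) ys))
  (cong₂ _+_ (Listₚ.length-map (f x) ys) (length-cartesianProductWith f xs ys))

length-tuples : {A : Set} (ys : List A) (m : ℕ) → length (tuples ys m) ≡ length ys ^ m
length-tuples ys zero    = refl
length-tuples ys (suc m) = trans (length-cartesianProductWith _∷_ ys (tuples ys m))
                                 (cong (length ys *_) (length-tuples ys m))

module _ {A : Set} {mem : A → Bool} where

  liftEl : ∀ {m} (xs : Vec A m) → All (T ∘ mem) xs → Vec (Σ[ a ∈ A ] T (mem a)) m
  liftEl []       []       = []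
  liftEl (x ∷ xs) (p ∷ ps) = (x , p) ∷ liftEl xs ps

  map-liftEl : ∀ {m} (xs : Vec A m) (ps : All (T ∘ mem) xs) → Vec.map proj₁ (liftEl xs ps) ≡ xs
  map-liftEl []       []       = refl
  map-liftEl (x ∷ xs) (p ∷ ps) = cong (x ∷_) (map-liftEl xs ps)

  El-≡ : {a b : Σ[ a ∈ A ] T (mem a)} → proj₁ a ≡ proj₁ b → a ≡ b
  El-≡ {_ , p} {_ , q} refl = cong (_ ,_) (T-irrelevant p q)

  liftEl-map : ∀ {m} (ys : Vec (Σ[ a ∈ A ] T (mem a)) m) ps → liftEl (Vec.map proj₁ ys) ps ≡ ys
  liftEl-map []       []       = refl
  liftEl-map (y ∷ ys) (p ∷ ps) = cong₂ _∷_ (El-≡ refl) (liftEl-map ys ps)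

  all-El : ∀ {m} (ys : Vec (Σ[ a ∈ A ] T (mem a)) m) → All (T ∘ mem) (Vec.map proj₁ ys)
  all-El ys = Allₚ.map⁺ (All.universal proj₂ ys)

-- Overwriting the new relations on a closed set

module Substitution (em : ExcludedMiddle 0ℓ) (𝐒 : Setting) where
  open Setting 𝐒
  open Closure em 𝐒 public
  open Measure em 𝐒 using (Exp)

  CS : ℕ → Set
  CS n = InG.ClosedSub (𝓖 n)

  ∣_∣ₛ : ∀ {n} → CS n → Pred (Fin (size n)) 0ℓ
  ∣ W ∣ₛ = InG.⟦ W ⟧

  Struct : ∀ {n} → Exp n → Structure V (Fin (size n))
  Struct {n} E = expand (𝓖 n) E

  strOn : ∀ {n} (W : CS n) → Exp n → Structure V (InG.El W)
  strOn W F = Struct F InK.↾ up (Struct F) W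

  𝓚-represented : ∀ {n} {E : Exp n} → E ∈ₗ 𝓚 n → InK.Represented (Struct E)
  𝓚-represented {n} {E} E∈ = (n , E , E∈) , iso-refl

  DimTo : ∀ {n m} → ℕ → Vec (Fin (size n)) m → Set
  DimTo {n} d xs = DimAtMost (clG n) (_∈ xs) d

  AgreeTo : ∀ {n} → Pred (Fin (size n)) 0ℓ → ℕ → Exp n → Exp n → Set
  AgreeTo X d E F = ∀ R xs → All X xs → DimTo d xs → E R xs ≡ F R xs

  closed-clG : ∀ {n} (W : CS n) → Closed (clG n) ∣ W ∣ₛ
  closed-clG W c = InClass.ClosedSub.closed W (clG⇒cl _ c)

  ≐-sym : {A : Set} {M N : Structure V₀ A} → M ≐ N → N ≐ M
  ≐-sym (f , r) = (λ g xs p → sym (f g xs p)) , λ R xs p → sym (r R xs p)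

  ≐-cl : {A : Set} {M N : Structure V₀ A} → M ≐ N → ∀ X → InG.cl M X ⊆ InG.cl N X
  ≐-cl {N = N} eq X c = cl-mono Gclass N (λ { (x , Xx , refl) → Xx })
    (ClosureEmbedding.fwd (cl-iso Gclass (≐⇒Iso eq)) c)

  abstract
    closure-CS : ∀ n X → Σ[ U′ ∈ CS n ] clG n X ⊆ ∣ U′ ∣ₛ × ∣ U′ ∣ₛ ⊆ clG n X
    closure-CS n X = closure (𝓖-represented n) X , (λ c → fromWitness em (clG⇒cl X c)) , λ p → cl⇒clG X (toWitness em p)

  HasDim-𝓖 : ∀ {n X d} → HasDim (clG n) X d → HasDim (InG.cl (𝓖 n)) X d
  HasDim-𝓖 = HasDim-cl clG⇒cl cl⇒clG

  HasDim-𝓖⁻ : ∀ {n X d} → HasDim (InG.cl (𝓖 n)) X d → HasDim (clG n) X d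
  HasDim-𝓖⁻ = HasDim-cl cl⇒clG clG⇒cl

  HasDim-K : {A : Set} (M : Structure V A) → ∀ {X d} → HasDim (InG.cl (reduct M)) X d → HasDim (InK.cl M) X d
  HasDim-K M = HasDim-cl (clG⇒clK M) (clK⇒clG M)

  HasDim-K⁻ : {A : Set} (M : Structure V A) → ∀ {X d} → HasDim (InK.cl M) X d → HasDim (InG.cl (reduct M)) X d
  HasDim-K⁻ M = HasDim-cl (clK⇒clG M) (clG⇒clK M)

  -- `U′` is also a closed set of the structure on `W`, because closure there is the restriction of
  -- `clG n`; the standing assumption then applies, and restricting twice is restricting once.
  represented-⊆ : ∀ {n} {W U′ : CS n} {F : Exp n} → ∣ U′ ∣ₛ ⊆ ∣ W ∣ₛ →
                  InK.Represented (strOn W F) → InK.Represented (strOn U′ F)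
  represented-⊆ {n} {W} {U′} {F} U⊆W rep = represented-resp iso (closedSub-represented (strOn W F) rep S)
    where
      mem = InClass.ClosedSub.mem U′
      S : InK.ClosedSub (strOn W F)
      S = record
        { mem        = mem ∘ proj₁
        ; closed     = λ {x} c → closed-clG U′ (Pre.monotone n (λ { (y , p , refl) → p })
            (cl⇒clG _ (ClosureEmbedding.fwd (sub-embedding (𝓖-represented n) W) (clK⇒clG (strOn W F) _ c))))
        ; fun-closed = λ f xs → subst (λ v → T (mem (fun (𝓖 n) f v)))
            (shape xs)
            (InClass.ClosedSub.fun-closed U′ f (Vec.map (λ x → proj₁ (proj₁ x) , proj₂ x) xs))
        }
        where
          shape : ∀ {m} (xs : Vec (Σ[ a ∈ InG.El W ] T (mem (proj₁ a))) m) →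
            Vec.map proj₁ (Vec.map (λ x → proj₁ (proj₁ x) , proj₂ x) xs) ≡ Vec.map proj₁ (Vec.map proj₁ xs)
          shape []       = refl
          shape (x ∷ xs) = cong (proj₁ (proj₁ x) ∷_) (shape xs)
      g : InG.El U′ → InK.El S
      g (x , p) = (x , U⊆W p) , p
      map-g : ∀ {m} (xs : Vec (InG.El U′) m) → Vec.map proj₁ xs ≡ Vec.map proj₁ (Vec.map proj₁ (Vec.map g xs))
      map-g []       = refl
      map-g (x ∷ xs) = cong (proj₁ x ∷_) (map-g xs)
      iso : Iso (strOn U′ F) (strOn W F InK.↾ S)
      iso = record
        { bijection = mk↔ₛ′ g (λ x → proj₁ (proj₁ x) , proj₂ x) (λ x → El-≡ (El-≡ refl)) (λ _ → refl)
        ; fun-pres  = λ f xs → El-≡ (El-≡ (cong (fun (𝓖 n) f) (map-g xs)))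
        ; rel-pres  = λ R xs → cong (rel (Struct F) R) (map-g xs)
        }

  module _ {k : ℕ} (accepts : AcceptsSubstitutions k) where

    -- Replacing `strOn U′ M` by `strOn U′ F` is admissible since a closed subset of dimension below
    -- `suc d` contains only tuples of dimension at most `d`, where `M` and `F` agree. The accepted
    -- structure has reduct `𝓖 n`, so `𝓚-full` places it in `𝓚 n`.
    substitute-one : ∀ {n d} {M F : Exp n} (U′ : CS n) → InK.Represented (Struct M) → InK.Represented (strOn U′ F) →
      HasDim (clG n) ∣ U′ ∣ₛ (suc d) → suc d ≤ k → AgreeTo ∣ U′ ∣ₛ d M F →
      ∃[ N ] N ∈ₗ 𝓚 n × (∀ R xs → All ∣ U′ ∣ₛ xs → N R xs ≡ F R xs)
                      × (∀ R xs → DimTo (suc d) xs → ¬ All ∣ U′ ∣ₛ xs → N R xs ≡ M R xs)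
    substitute-one {n} {d} {M} {F} U′ repM repF dimU 1+d≤k agr =
      case accepts 𝓐 𝓐′ repA repF (suc d , HasDim-K 𝓐 dimA , 1+d≤k) (suc d , HasDim-K 𝓐′ dimA , 1+d≤k) agree
             (Struct M) repM proj₁ (proj₁-embedding M) img-closed of λ { (N , repN , redN , embN , other) →
        Accepted.result N repN redN embN other }
      where
        𝓐  = strOn U′ M
        𝓐′ = strOn U′ F
        repG = 𝓖-represented n
        repA : InK.Represented 𝓐
        repA = closedSub-represented (Struct M) repM (up (Struct M) U′)

        dimA : HasDim (InG.cl (𝓖 n InG.↾ U′)) U (suc d)
        dimA = HasDim-sub⁻ repG U′ (HasDim-𝓖 dimU)

        agree-sub : (S : InK.ClosedSub 𝓐) → Dim<Dim (InK.cl 𝓐) InK.⟦ S ⟧ U → AgreeOn InK.⟦ S ⟧ 𝓐 𝓐′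
        agree-sub S (d′ , e′ , (b , Sb , ind , span) , dimU′ , d′<e′) =
          (λ _ _ _ → refl) , λ { (inj₁ R) xs _ → refl
                              ; (inj₂ R) xs Sxs → agr R (Vec.map proj₁ xs) (all-El xs) (small xs Sxs) }
          where
            d′≤d : d′ ≤ d
            d′≤d = ℕₚ.≤-pred (subst (d′ <_)
              (Pregeometry.dim-unique em (restricted-pregeometry (sub-embedding repG U′) (pregeometry₀ repG)) (HasDim-K⁻ 𝓐 dimU′) dimA) d′<e′)
            small : ∀ {m} (xs : Vec (InG.El U′) m) → All InK.⟦ S ⟧ xs → DimTo d (Vec.map proj₁ xs)
            small xs Sxs = DimAtMost-mono {cl = clG n} d′≤d (Pre.dimAtMost n (Vec.map proj₁ b)
              λ x∈ → case ∈-map⇒image xs x∈ of λ { (y , y∈ , refl) →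
                Pre.monotone n (image⇒∈-map b) (cl⇒clG _ (ClosureEmbedding.fwd (sub-embedding repG U′)
                  (clK⇒clG 𝓐 _ (span (All⇒⊆ Sxs y∈))))) })

        img : Pred (Fin (size n)) 0ℓ
        img x = ∃[ a ] proj₁ {B = T ∘ InClass.ClosedSub.mem U′} a ≡ x

        img⊆ : img ⊆ ∣ U′ ∣ₛ
        img⊆ ((_ , p) , refl) = p

        proj₁-embedding : ∀ G → IsEmbedding (strOn U′ G) (Struct G) proj₁
        proj₁-embedding G = record { injective = El-≡ ; fun-pres = λ _ _ → refl ; rel-pres = λ _ _ → refl }

        img-closed : Closed (InK.cl (Struct M)) img
        img-closed {x} c = (x , closed-clG U′ (cl⇒clG _ (cl-mono Gclass (𝓖 n) img⊆ (clK⇒clG (Struct M) _ c)))) , refl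

        agree : Agree 𝓐 𝓐′
        agree = ((λ _ _ _ → refl) , λ _ _ _ → refl) , agree-sub

        module Accepted (N : Structure V (Fin (size n))) (repN : InK.Represented N) (redN : reduct N ≐ reduct (Struct M))
          (embN : IsEmbedding 𝓐′ N proj₁)
          (other : ∀ (S : InK.ClosedSub N) → Dim≤Dim (InK.cl N) InK.⟦ S ⟧ img →
                   ¬ (∀ x → InK.⟦ S ⟧ x ⇔ img x) → AgreeOn InK.⟦ S ⟧ N (Struct M)) where

          full : Σ[ E ∈ Exp n ] E ∈ₗ 𝓚 n × (λ R xs → rel N (inj₂ R) xs) ≋ E
          full = 𝓚-full n (λ R xs → rel N (inj₂ R) xs)
            (represented-resp (expand-iso (≐⇒Iso (≐-sym redN)) _
              (λ R xs → cong (rel N (inj₂ R)) (sym (Vecₚ.map-id xs)))) repN)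

          HasDim-N : ∀ {X e} → HasDim (clG n) X e → HasDim (InK.cl N) X e
          HasDim-N h = HasDim-K N (HasDim-cl (≐-cl (≐-sym redN)) (≐-cl redN) (HasDim-𝓖 h))

          inside : ∀ R xs → All ∣ U′ ∣ₛ xs → rel N (inj₂ R) xs ≡ F R xs
          inside R xs ps = trans (cong (rel N (inj₂ R)) (sym (map-liftEl xs ps)))
            (trans (sym (IsEmbedding.rel-pres embN (inj₂ R) (liftEl xs ps))) (cong (F R) (map-liftEl xs ps)))

          -- The closure of `xs` has dimension at most `suc d` and is not `U′`, as some entry of
          -- `xs` lies outside `U′`. Acceptance leaves such closed sets untouched.
          outside : ∀ R xs → DimTo (suc d) xs → ¬ All ∣ U′ ∣ₛ xs → rel N (inj₂ R) xs ≡ M R xs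
          outside R xs (e , h , e≤) ¬U = proj₂ (other S
            (e , suc d , HasDim-resp {cl = InK.cl N} (fromWitness em) (toWitness em)
                           (HasDim-K N (Pregeometry.HasDim-closure em (pregeometry₀ rep₀) (HasDim-K⁻ N (HasDim-N h))))
               , HasDim-N (HasDim-resp {cl = clG n} (λ {x} p → (x , p) , refl) img⊆ dimU) , e≤)
            (λ eq → ¬U (⊆⇒All xs (λ x∈ → img⊆ (Equivalence.to (eq _) (xs⊆S x∈))))))
            (inj₂ R) xs (⊆⇒All xs xs⊆S)
            where
              rep₀ : InG.Represented (reduct N)
              rep₀ = reduct-represented repN
              S = up N (closure rep₀ (_∈ xs))
              xs⊆S : (_∈ xs) ⊆ InK.⟦ S ⟧
              xs⊆S x∈ = fromWitness em (IsPregeometry.extensive (pregeometry₀ rep₀) _ x∈)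

          result : ∃[ E ] E ∈ₗ 𝓚 n × (∀ R xs → All ∣ U′ ∣ₛ xs → E R xs ≡ F R xs)
                                   × (∀ R xs → DimTo (suc d) xs → ¬ All ∣ U′ ∣ₛ xs → E R xs ≡ M R xs)
          result with E , E∈ , eq ← full =
            E , E∈ , (λ R xs ps → trans (sym (eq R xs)) (inside R xs ps))
                   , (λ R xs dm ¬p → trans (sym (eq R xs)) (outside R xs dm ¬p))

    module _ {n d w : ℕ} (W : CS n) (F : Exp n) (repF : InK.Represented (strOn W F))
             (dimW : HasDim (clG n) ∣ W ∣ₛ w) (w≤k : w ≤ k) where

      private
        Covered : List (Vec (Fin (size n)) (suc d)) → ∀ {m} → Vec (Fin (size n)) m → Set
        Covered bs xs = ∃[ b ] b ∈ₗ bs × All ∣ W ∣ₛ b × Independent (clG n) b × All (clG n (_∈ b)) xs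

        AgreeOutside : Exp n → Exp n → Set
        AgreeOutside M N = ∀ R xs → DimTo (suc d) xs → ¬ All ∣ W ∣ₛ xs → N R xs ≡ M R xs

        -- The invariant of the iteration over `bs`: on `W`, the values of `F` are reached for
        -- tuples of dimension at most `d` and for those spanned by an independent tuple already
        -- processed.
        AgreeCovered : List (Vec (Fin (size n)) (suc d)) → Exp n → Set
        AgreeCovered bs N = ∀ R xs → All ∣ W ∣ₛ xs → DimTo (suc d) xs → DimTo d xs ⊎ Covered bs xs → N R xs ≡ F R xs

        -- Tuples not inside `U′` keep their values, so nothing gained before is lost; inside `U′`
        -- the values are now those of `F`, whatever had been done there earlier.
        cover : ∀ {M N : Exp n} {b bs} (U′ : CS n) → ∣ U′ ∣ₛ ⊆ ∣ W ∣ₛ → clG n (_∈ b) ⊆ ∣ U′ ∣ₛ →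
          HasDim (clG n) ∣ U′ ∣ₛ (suc d) → N ∈ₗ 𝓚 n → AgreeCovered bs N → AgreeOutside M N →
          ∃[ N′ ] N′ ∈ₗ 𝓚 n × AgreeCovered (b ∷ bs) N′ × AgreeOutside M N′
        cover {M} {N} {b} {bs} U′ U′⊆W cl⊆U′ dimU′ N∈ cov out =
          case substitute-one {F = F} U′ (𝓚-represented N∈) (represented-⊆ {W = W} {U′ = U′} {F = F} U′⊆W repF) dimU′
                (ℕₚ.≤-trans (Pre.dim-mono n dimU′ dimW (λ p → Pre.extensive n _ (U′⊆W p))) w≤k)
                (λ R xs Uxs dm → cov R xs (All.map U′⊆W Uxs) (DimAtMost-mono {cl = clG n} (ℕₚ.n≤1+n d) dm) (inj₁ dm))
          of λ { (N′ , N′∈ , ins , outs) → N′ , N′∈ , covers N′ ins outs , λ R xs dm ¬W →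
            trans (outs R xs dm (λ Uxs → ¬W (All.map U′⊆W Uxs))) (out R xs dm ¬W) }
          where
            covers : ∀ N′ → (∀ R xs → All ∣ U′ ∣ₛ xs → N′ R xs ≡ F R xs) →
                     (∀ R xs → DimTo (suc d) xs → ¬ All ∣ U′ ∣ₛ xs → N′ R xs ≡ N R xs) → AgreeCovered (b ∷ bs) N′
            covers N′ ins outs R xs Wxs dm c with em {P = All ∣ U′ ∣ₛ xs}
            ... | yes Uxs = ins R xs Uxs
            ... | no ¬Uxs = trans (outs R xs dm ¬Uxs) (cov R xs Wxs dm (case c of λ
                  { (inj₁ dm′) → inj₁ dm′
                  ; (inj₂ (_ , here refl , _ , _ , h)) → contradiction (All.map cl⊆U′ h) ¬Uxs
                  ; (inj₂ (b′ , there b′∈ , r)) → inj₂ (b′ , b′∈ , r) }))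

        substitute-many : ∀ {M : Exp n} → M ∈ₗ 𝓚 n → AgreeTo ∣ W ∣ₛ d M F → ∀ bs →
          ∃[ N ] N ∈ₗ 𝓚 n × AgreeCovered bs N × AgreeOutside M N
        substitute-many M∈ agr [] = _ , M∈
          , (λ { R xs Wxs _ (inj₁ dm) → agr R xs Wxs dm ; R xs Wxs _ (inj₂ (_ , () , _)) }) , λ _ _ _ _ → refl
        substitute-many M∈ agr (b ∷ bs) with N , N∈ , cov , out ← substitute-many M∈ agr bs
          with em {P = All ∣ W ∣ₛ b × Independent (clG n) b}
        ... | no ¬p = N , N∈
            , (λ { R xs Wxs dm (inj₁ dm′) → cov R xs Wxs dm (inj₁ dm′)
                 ; R xs Wxs dm (inj₂ (_ , here refl , Wb , ind , _)) → contradiction (Wb , ind) ¬p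
                 ; R xs Wxs dm (inj₂ (b′ , there b′∈ , r)) → cov R xs Wxs dm (inj₂ (b′ , b′∈ , r)) })
            , out
        ... | yes (Wb , ind) with U′ , cl⊆U′ , U′⊆cl ← closure-CS n (_∈ b) =
          cover U′ (λ p → closed-clG W (Pre.monotone n (All⇒⊆ Wb) (U′⊆cl p))) cl⊆U′
            (HasDim-resp {cl = clG n} cl⊆U′ U′⊆cl (Pre.HasDim-closure n (b , ⊆⇒All b id , ind , Pre.extensive n _)))
            N∈ cov out

      -- Agreement up to `d` permits overwriting closed sets of dimension `suc d`, and `W` may be
      -- larger. All such subsets of `W` are therefore treated in turn, found as closures of
      -- independent tuples. If `W` has smaller dimension there are none, and `M` itself serves.
      substitute : ∀ {M : Exp n} → M ∈ₗ 𝓚 n → AgreeTo ∣ W ∣ₛ d M F →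
        ∃[ N ] N ∈ₗ 𝓚 n × AgreeTo ∣ W ∣ₛ (suc d) N F × AgreeOutside M N
      substitute M∈ agr with N , N∈ , cov , out ← substitute-many M∈ agr (tuples (allFin (size n)) (suc d)) =
        N , N∈ , (λ R xs Wxs dm → cov R xs Wxs dm (split xs Wxs dm)) , out
        where
          split : ∀ {m} (xs : Vec (Fin (size n)) m) → All ∣ W ∣ₛ xs → DimTo (suc d) xs →
                  DimTo d xs ⊎ Covered (tuples (allFin (size n)) (suc d)) xs
          split xs Wxs (e , h , e≤1+d) with ℕₚ.m≤n⇒m<n∨m≡n e≤1+d
          ... | inj₁ (s≤s e≤d) = inj₁ (e , h , e≤d)
          ... | inj₂ refl with b , xsb , ind , span ← h =
            inj₂ (b , ∈-tuples-allFin b , All.map (All⇒⊆ Wxs) xsb , ind , ⊆⇒All xs span)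

AllPairs-with : {A : Set} {P : Pred A 0ℓ} {R : A → A → Set} {xs : List A} → Allₗ P xs → AllPairs R xs →
                AllPairs (λ x y → P x × P y × R x y) xs
AllPairs-with []ₗ         []          = []
AllPairs-with (p ∷ₗ ps) (rs ∷ rss) = Allₗ.zipWith (λ (q , r) → p , q , r) (ps , rs) ∷ AllPairs-with ps rss

deduplicate-distinct : {A : Set} {R : A → A → Set} (R? : ∀ x y → Dec (R x y)) (xs : List A) →
                       AllPairs (λ x y → ¬ R x y) (deduplicate R? xs)
deduplicate-distinct R? []       = []
deduplicate-distinct R? (x ∷ xs) = Allₗₚ.all-filter (λ y → ¬? (R? x y)) (deduplicate R? xs) ∷ AllPairsₚ.filter⁺ (λ y → ¬? (R? x y)) (deduplicate-distinct R? xs)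

length≢0 : {A : Set} {x : A} {xs : List A} → x ∈ₗ xs → length xs ≢ 0
length≢0 {xs = _ ∷ _} _ ()

-- The dimension conditional measure as an iterated average over fibres

module Expectation (em : ExcludedMiddle 0ℓ) (𝐒 : Setting) where
  open Setting 𝐒
  open Substitution em 𝐒 public
  open Measure em 𝐒 public

  infix 4 _≈[_]_
  -- Equivalent to `(E ↾dim d) ≋ (F ↾dim d)`, but free of the Boolean conjunction that truncation
  -- introduces.
  _≈[_]_ : ∀ {n} → Exp n → ℕ → Exp n → Set
  E ≈[ d ] F = ∀ R xs → DimTo d xs → E R xs ≡ F R xs

  ≈-sym : ∀ {n d} {E F : Exp n} → E ≈[ d ] F → F ≈[ d ] E
  ≈-sym eq R xs dm = sym (eq R xs dm)

  ≈-trans : ∀ {n d} {E F G : Exp n} → E ≈[ d ] F → F ≈[ d ] G → E ≈[ d ] G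
  ≈-trans p q R xs dm = trans (p R xs dm) (q R xs dm)

  DimTo-suc : ∀ {n d m} {xs : Vec (Fin (size n)) m} → DimTo d xs → DimTo (suc d) xs
  DimTo-suc {n} {d} = DimAtMost-mono {cl = clG n} (ℕₚ.n≤1+n d)

  ≈-pred : ∀ {n d} {E F : Exp n} → E ≈[ suc d ] F → E ≈[ d ] F
  ≈-pred p R xs dm = p R xs (DimTo-suc dm)

  ↾dim-≈ : ∀ {n} d (E : Exp n) → (E ↾dim d) ≈[ d ] E
  ↾dim-≈ {n} d E R xs dm with em {P = DimAtMost (clG n) (_∈ xs) d}
  ... | yes _ = ∧-identityʳ _
  ... | no ¬dm = contradiction dm ¬dm

  ≈⇒≋ : ∀ {n d} {E F : Exp n} → E ≈[ d ] F → (E ↾dim d) ≋ (F ↾dim d)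
  ≈⇒≋ {n} {d} {E} {F} eq R xs with em {P = DimAtMost (clG n) (_∈ xs) d}
  ... | yes dm = cong (_∧ true) (eq R xs dm)
  ... | no _   = trans (∧-zeroʳ _) (sym (∧-zeroʳ _))

  ≋⇒≈ : ∀ {n d} {E F : Exp n} → (E ↾dim d) ≋ (F ↾dim d) → E ≈[ d ] F
  ≋⇒≈ {d = d} {E} {F} eq = ≈-trans (≈-sym (↾dim-≈ d E)) (≈-trans (λ R xs _ → eq R xs) (↾dim-≈ d F))

  AgreeTo-resp : ∀ {n X d} {E E′ F : Exp n} → E ≈[ d ] E′ → AgreeTo X d E F → AgreeTo X d E′ F
  AgreeTo-resp eq agr R xs Xxs dm = trans (sym (eq R xs dm)) (agr R xs Xxs dm)

  AgreeTo-pred : ∀ {n X d} {E F : Exp n} → AgreeTo X (suc d) E F → AgreeTo X d E F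
  AgreeTo-pred agr R xs Xxs dm = agr R xs Xxs (DimTo-suc dm)

  ∈-𝓚↾⁻ : ∀ {n d} {M : Exp n} → M ∈ₗ 𝓚↾ n d → ∃[ E ] E ∈ₗ 𝓚 n × M ≡ E ↾dim d
  ∈-𝓚↾⁻ {n} {d} M∈ = ∈ₗ.∈-map⁻ (_↾dim d) (∈ₗ.∈-deduplicate⁻ _≋?_ (map (_↾dim d) (𝓚 n)) M∈)

  ∈-deduplicate-≋ : ∀ {n} {E : Exp n} {Es} → E ∈ₗ Es → ∃[ M ] M ∈ₗ deduplicate _≋?_ Es × M ≋ E
  ∈-deduplicate-≋ {E = E} E∈ with M , M∈ , eq ← find
        (Anyₗₚ.deduplicate⁺ _≋?_ {P = _≋ E} (λ p q R xs → trans (p R xs) (q R xs)) (Anyₗ.map (λ { refl R xs → refl }) E∈))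
    = M , M∈ , eq

  ∈-𝓚↾⁺ : ∀ {n} d {E : Exp n} → E ∈ₗ 𝓚 n → ∃[ M ] M ∈ₗ 𝓚↾ n d × M ≈[ d ] E
  ∈-𝓚↾⁺ d E∈ with M , M∈ , eq ← ∈-deduplicate-≋ (∈ₗ.∈-map⁺ (_↾dim d) E∈) =
    M , M∈ , ≈-trans (λ R xs _ → eq R xs) (↾dim-≈ d _)

  𝓚↾-distinct : ∀ n d → AllPairs (λ M N → ¬ M ≈[ d ] N) (𝓚↾ n d)
  𝓚↾-distinct n d = AllPairs.map (λ { ((E , _ , refl) , (F , _ , refl) , ≉) eq →
      ≉ (≈⇒≋ (≈-trans (≈-sym (↾dim-≈ d E)) (≈-trans eq (↾dim-≈ d F)))) })
    (AllPairs-with (Allₗ.tabulate ∈-𝓚↾⁻) (deduplicate-distinct _≋?_ (map (_↾dim d) (𝓚 n))))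

  Fiber : ∀ n d → Exp n → List (Exp n)
  Fiber n d M = filter (λ E′ → (E′ ↾dim d) ≋? (M ↾dim d)) (𝓚↾ n (suc d))

  ∈-Fiber⁻ : ∀ {n d M E} → E ∈ₗ Fiber n d M → E ∈ₗ 𝓚↾ n (suc d) × E ≈[ d ] M
  ∈-Fiber⁻ {n} {d} {M} E∈ with E∈′ , eq ← ∈ₗ.∈-filter⁻ (λ E′ → (E′ ↾dim d) ≋? (M ↾dim d)) {xs = 𝓚↾ n (suc d)} E∈ = E∈′ , ≋⇒≈ eq

  ∈-Fiber⁺ : ∀ {n d M E} → E ∈ₗ 𝓚↾ n (suc d) → E ≈[ d ] M → E ∈ₗ Fiber n d M
  ∈-Fiber⁺ E∈ eq = ∈ₗ.∈-filter⁺ _ E∈ (≈⇒≋ eq)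

  Fiber-resp : ∀ {n d} {M N : Exp n} → M ≈[ d ] N → Fiber n d M ≡ Fiber n d N
  Fiber-resp {n} {d} eq = Listₚ.filter-≐ _ _
    ((λ p → ≈⇒≋ (≈-trans (≋⇒≈ p) eq)) , λ p → ≈⇒≋ (≈-trans (≋⇒≈ p) (≈-sym eq))) (𝓚↾ n (suc d))

  Fiber-nonempty : ∀ {n d M} → M ∈ₗ 𝓚↾ n d → length (Fiber n d M) ≢ 0
  Fiber-nonempty {n} {d} M∈ with E , E∈ , refl ← ∈-𝓚↾⁻ M∈ with N , N∈ , eq ← ∈-𝓚↾⁺ (suc d) E∈ =
    length≢0 (∈-Fiber⁺ N∈ (≈-trans (≈-pred eq) (≈-sym (↾dim-≈ d E))))

  ℙ-resp : ∀ {n} d {E F : Exp n} → E ≈[ d ] F → ℙ n d E ≡ ℙ n d F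
  ℙ-resp zero    eq = refl
  ℙ-resp {n} (suc d) {E} {F} eq = cong₂ (λ p L → p ℚ.* recip (length L))
    (ℙ-resp d (≈-trans (↾dim-≈ d E) (≈-trans (≈-pred eq) (≈-sym (↾dim-≈ d F)))))
    (Fiber-resp (≈-pred eq))

  ℙ-≥0 : ∀ n d E → 0ℚ ℚ.≤ ℙ n d E
  ℙ-≥0 n zero    E = recip-≥0 (length (𝓚↾ n 0))
  ℙ-≥0 n (suc d) E = *-≥0 (ℙ-≥0 n d _) (recip-≥0 (length (Fiber n d E)))

  𝔼 : ∀ n d → (Exp n → ℚ) → ℚ
  𝔼 n d f = ∑ (λ M → ℙ n d M ℚ.* f M) (𝓚↾ n d)

  𝔼-mono : ∀ {n d f g} → (∀ M → M ∈ₗ 𝓚↾ n d → f M ℚ.≤ g M) → 𝔼 n d f ℚ.≤ 𝔼 n d g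
  𝔼-mono {n} {d} le = ∑-mono (𝓚↾ n d) (λ M M∈ → *-monoʳ-≤ (ℙ-≥0 n d M) (le M M∈))

  -- Every `N` lies in exactly one fibre, that of its truncation. The indicator of `match` inserts
  -- the sum over `𝓚↾ n d`, and the two sums are exchanged.
  ∑-fibers : ∀ n d (h : Exp n → ℚ) → ∑ h (𝓚↾ n (suc d)) ≡ ∑ (λ M → ∑ h (Fiber n d M)) (𝓚↾ n d)
  ∑-fibers n d h = begin
    ∑ h L                                               ≡⟨ ∑-cong L one ⟨
    ∑ (λ N → ∑ (λ M → ⟦ match N M ⟧? ℚ.* h N) L′) L     ≡⟨ ∑-swap (λ N M → ⟦ match N M ⟧? ℚ.* h N) L L′ ⟩
    ∑ (λ M → ∑ (λ N → ⟦ match N M ⟧? ℚ.* h N) L) L′     ≡⟨ ∑-cong L′ (λ M _ → sym (∑-filter (λ N → match N M) h L)) ⟩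
    ∑ (λ M → ∑ h (Fiber n d M)) L′                      ∎
    where
      open ≡-Reasoning
      L  = 𝓚↾ n (suc d)
      L′ = 𝓚↾ n d
      match : (N M : Exp n) → Dec ((N ↾dim d) ≋ (M ↾dim d))
      match N M = (N ↾dim d) ≋? (M ↾dim d)
      one : ∀ N → N ∈ₗ L → ∑ (λ M → ⟦ match N M ⟧? ℚ.* h N) L′ ≡ h N
      one N N∈ = ∑-one-hot (match N) (h N) L′ ex
        (AllPairs.map (λ ≉ p q → ≉ (≈-trans (≈-sym (≋⇒≈ p)) (≋⇒≈ q))) (𝓚↾-distinct n d))
        where
          ex : ∃[ M ] M ∈ₗ L′ × (N ↾dim d) ≋ (M ↾dim d)
          ex with E , E∈ , refl ← ∈-𝓚↾⁻ N∈ with M , M∈ , eq ← ∈-𝓚↾⁺ d E∈ =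
            M , M∈ , ≈⇒≋ (≈-trans (≈-pred (↾dim-≈ (suc d) E)) (≈-sym eq))

  -- The tower property: `ℙ n (suc d)` spreads the mass `ℙ n d M` uniformly over the fibre of `M`.
  𝔼-suc : ∀ n d f → 𝔼 n (suc d) f ≡ 𝔼 n d (λ M → recip (length (Fiber n d M)) ℚ.* ∑ f (Fiber n d M))
  𝔼-suc n d f = trans (∑-fibers n d _) (∑-cong (𝓚↾ n d) λ M _ → begin
    ∑ (λ N → ℙ n (suc d) N ℚ.* f N) (Fiber n d M)
      ≡⟨ ∑-cong (Fiber n d M) (λ N N∈ → cong (ℚ._* f N) (ℙ-fiber M N (proj₂ (∈-Fiber⁻ {M = M} N∈)))) ⟩
    ∑ (λ N → ℙ n d M ℚ.* recip (length (Fiber n d M)) ℚ.* f N) (Fiber n d M)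
      ≡⟨ ∑-*ˡ (ℙ n d M ℚ.* recip (length (Fiber n d M))) f (Fiber n d M) ⟩
    ℙ n d M ℚ.* recip (length (Fiber n d M)) ℚ.* ∑ f (Fiber n d M)
      ≡⟨ ℚₚ.*-assoc (ℙ n d M) _ _ ⟩
    ℙ n d M ℚ.* (recip (length (Fiber n d M)) ℚ.* ∑ f (Fiber n d M)) ∎)
    where
      open ≡-Reasoning
      ℙ-fiber : ∀ M N → N ≈[ d ] M → ℙ n (suc d) N ≡ ℙ n d M ℚ.* recip (length (Fiber n d M))
      ℙ-fiber M N eq = cong₂ (λ p L → p ℚ.* recip (length L)) (ℙ-resp d (≈-trans (↾dim-≈ d N) eq)) (Fiber-resp eq)

  -- Reduces an estimate of expectations to a weighted count in each fibre.
  𝔼-suc-≤ : ∀ {n d f g} → (∀ M → M ∈ₗ 𝓚↾ n d → ∑ f (Fiber n d M) ℚ.≤ fromℕ (length (Fiber n d M)) ℚ.* g M) →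
            𝔼 n (suc d) f ℚ.≤ 𝔼 n d g
  𝔼-suc-≤ {n} {d} {f} {g} le = subst (ℚ._≤ 𝔼 n d g) (sym (𝔼-suc n d f)) (𝔼-mono λ M M∈ → begin
    recip (length (Fiber n d M)) ℚ.* ∑ f (Fiber n d M)                        ≤⟨ *-monoʳ-≤ (recip-≥0 (length (Fiber n d M))) (le M M∈) ⟩
    recip (length (Fiber n d M)) ℚ.* (fromℕ (length (Fiber n d M)) ℚ.* g M)   ≡⟨ ℚₚ.*-assoc (recip (length (Fiber n d M))) (fromℕ (length (Fiber n d M))) (g M) ⟨
    recip (length (Fiber n d M)) ℚ.* fromℕ (length (Fiber n d M)) ℚ.* g M     ≡⟨ cong (ℚ._* g M) (recip-* _ (Fiber-nonempty M∈)) ⟩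
    1ℚ ℚ.* g M                                                                ≡⟨ ℚₚ.*-identityˡ (g M) ⟩
    g M                                                                       ∎)
    where open ℚₚ.≤-Reasoning

  𝔼-total : ∀ n d → 𝔼 n d (λ _ → 1ℚ) ≡ 1ℚ
  𝔼-total n zero = trans (∑-cong (𝓚↾ n 0) (λ M _ → ℚₚ.*-identityʳ (recip (length (𝓚↾ n 0)))))
    (trans (∑-const (recip (length (𝓚↾ n 0))) (𝓚↾ n 0)) (trans (ℚₚ.*-comm (fromℕ (length (𝓚↾ n 0))) (recip (length (𝓚↾ n 0))))
      (recip-* _ (length≢0 (proj₁ (proj₂ (∈-𝓚↾⁺ 0 (proj₂ (some-𝓚 n)))))))))
  𝔼-total n (suc d) = trans (𝔼-suc n d _) (trans (∑-cong (𝓚↾ n d) (λ M M∈ → cong (ℙ n d M ℚ.*_)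
    (trans (cong (recip (length (Fiber n d M)) ℚ.*_) (trans (∑-const 1ℚ (Fiber n d M)) (ℚₚ.*-identityʳ _)))
      (recip-* _ (Fiber-nonempty M∈))))) (𝔼-total n d))

  arity≤ρ : ∀ R → arity R ≤ ρ
  arity≤ρ = bound arity
    where
      bound : ∀ {m} (f : Fin m → ℕ) i → f i ≤ VecF.foldr _⊔_ 0 f
      bound f zero    = ℕₚ.m≤m⊔n (f zero) _
      bound f (suc i) = ℕₚ.≤-trans (bound (f ∘ suc) i) (ℕₚ.m≤n⊔m (f zero) _)

  dimTo-ρ : ∀ {n} R (xs : Vec (Fin (size n)) (arity R)) → DimTo ρ xs
  dimTo-ρ {n} R xs = DimAtMost-mono {cl = clG n} (arity≤ρ R) (Pre.dimAtMost n xs (Pre.extensive n _))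

  -- δ is supported on 𝓚 n while 𝔼 n ρ ranges over 𝓚↾ n ρ; the two lists agree up to _≋_.
  ∑-δ : ∀ n (f : Exp n → ℚ) → (∀ M → 0ℚ ℚ.≤ f M) → (∀ {M N} → M ≋ N → f M ≡ f N) →
        ∑ (λ E → δ n E ℚ.* f E) (deduplicate _≋?_ (𝓚 n)) ≡ 𝔼 n ρ f
  ∑-δ n f f≥0 resp = ℚₚ.≤-antisym
    (∑-injection _≋_ D (𝓚↾ n ρ) w≥0
      (λ E E∈ → case ∈-𝓚↾⁺ ρ (∈ₗ.∈-deduplicate⁻ _≋?_ (𝓚 n) E∈) of λ { (M , M∈ , eq) →
        let eq′ = λ R xs → sym (eq R xs (dimTo-ρ R xs)) in
        M , M∈ , eq′ , ℚₚ.≤-reflexive (w-resp eq′) })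
      (AllPairs.map (λ ≉ M p q → ≉ (λ R xs → trans (p R xs) (sym (q R xs)))) (deduplicate-distinct _≋?_ (𝓚 n))))
    (∑-injection _≋_ (𝓚↾ n ρ) D w≥0
      (λ M M∈ → case ∈-𝓚↾⁻ M∈ of λ { (E , E∈ , refl) → case ∈-deduplicate-≋ E∈ of λ { (E′ , E′∈ , eq) →
        let eq′ = λ R xs → trans (↾dim-≈ ρ E R xs (dimTo-ρ R xs)) (sym (eq R xs)) in
        E′ , E′∈ , eq′ , ℚₚ.≤-reflexive (w-resp eq′) } })
      (AllPairs.map (λ ≉ E p q → ≉ (λ R xs _ → trans (p R xs) (sym (q R xs)))) (𝓚↾-distinct n ρ)))
    where
      D = deduplicate _≋?_ (𝓚 n)
      w : Exp n → ℚ
      w M = ℙ n ρ M ℚ.* f M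
      w≥0 : ∀ M → 0ℚ ℚ.≤ w M
      w≥0 M = *-≥0 (ℙ-≥0 n ρ M) (f≥0 M)
      w-resp : ∀ {M N} → M ≋ N → w M ≡ w N
      w-resp eq = cong₂ ℚ._*_ (ℙ-resp ρ (λ R xs _ → eq R xs)) (resp eq)

-- The probability that all copies in a group fail

module Decay (em : ExcludedMiddle 0ℓ) (𝐒 : Setting) where
  open Setting 𝐒
  open Expectation em 𝐒 public

  -- A copy `W` with the relations it ought to carry. `F` is an expansion of the whole of `𝓖 n`, so
  -- that it can be compared directly with members of `𝓚 n`.
  record Target (n : ℕ) : Set where
    constructor target
    field
      W : CS n
      F : Exp n
  open Target public

  Alive : ∀ {n} → ℕ → Target n → Exp n → Set
  Alive d t M = AgreeTo ∣ W t ∣ₛ d M (F t)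

  module _ {k : ℕ} (accepts : AcceptsSubstitutions k) {n : ℕ} (C : ℕ) (C≢0 : C ≢ 0)
           (A′ : Pred (Fin (size n)) 0ℓ) (A′-closed : Closed (clG n) A′) (B : Exp n) where

    -- `C` enters through `tables`, a list that meets every pattern of new relations on `W t`: a
    -- structure changed only on `W t` is recovered from the result together with one entry of this
    -- list.
    record IsTarget (t : Target n) : Set where
      field
        {dim}       : ℕ
        hasDim      : HasDim (clG n) ∣ W t ∣ₛ dim
        dim≤k       : dim ≤ k
        represented : InK.Represented (strOn (W t) (F t))
        A′⊆W        : A′ ⊆ ∣ W t ∣ₛ
        agree       : ∀ R xs → All A′ xs → F t R xs ≡ B R xs
        tables      : List (Exp n)
        few-tables  : length tables ≤ C
        tabulated   : ∀ (E : Exp n) → ∃[ e ] e ∈ₗ tables × (∀ R xs → All ∣ W t ∣ₛ xs → E R xs ≡ e R xs)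

    Disjoint : Target n → Target n → Set
    Disjoint t t′ = ∀ {x} → ∣ W t ∣ₛ x → ∣ W t′ ∣ₛ x → A′ x

    abstract
      base? : ∀ d (M : Exp n) → Dec (AgreeTo A′ d M B)
      base? d M = em

      alive? : ∀ d (t : Target n) (M : Exp n) → Dec (Alive d t M)
      alive? d t M = em

    -- For `p = 1` this is the indicator that the target is lost. It is affine in the indicator of
    -- being alive, which lets a product of such factors be expanded in one target at a time.
    factor : ℕ → ℚ → Exp n → Target n → ℚ
    factor d p M t = 1ℚ ℚ.- p ℚ.* ⟦ alive? d t M ⟧?

    -- Bounds the conditional probability, given M up to dimension d, that every target is eventually lost:
    -- a target which is still alive survives to the end with probability at least p.
    survival : ℕ → ℚ → List (Target n) → Exp n → ℚ
    survival d p ts M = ⟦ base? d M ⟧? ℚ.* ∏ (factor d p M) ts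

    factor-≥0 : ∀ {d p} {M : Exp n} {t : Target n} → 0ℚ ℚ.≤ p → p ℚ.≤ 1ℚ → 0ℚ ℚ.≤ factor d p M t
    factor-≥0 {d} {p} {M} {t} 0≤p p≤1 = p≤q⇒0≤q-p (subst (p ℚ.* ⟦ alive? d t M ⟧? ℚ.≤_) (ℚₚ.*-identityʳ 1ℚ)
      (*-mono-≤ 0≤p 0≤1 p≤1 (⟦⟧?-≤1 (alive? d t M))))

    factor-alive : ∀ {d p} {M : Exp n} {t : Target n} → Alive d t M → factor d p M t ≡ 1ℚ ℚ.- p
    factor-alive {d} {p} {M} {t} a = cong (λ x → 1ℚ ℚ.- x) (trans (cong (p ℚ.*_) (⟦⟧?-yes (alive? d t M) a)) (ℚₚ.*-identityʳ p))

    factor-dead : ∀ {d p} {M : Exp n} {t : Target n} → ¬ Alive d t M → factor d p M t ≡ 1ℚ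
    factor-dead {d} {p} {M} {t} a = cong (λ x → 1ℚ ℚ.- x) (trans (cong (p ℚ.*_) (⟦⟧?-no (alive? d t M) a)) (ℚₚ.*-zeroʳ p))

    survival-≥0 : ∀ {d p ts} → 0ℚ ℚ.≤ p → p ℚ.≤ 1ℚ → ∀ M → 0ℚ ℚ.≤ survival d p ts M
    survival-≥0 {d} {p} {ts} 0≤p p≤1 M = *-≥0 (⟦⟧?-≥0 (base? d M)) (∏-≥0 ts (λ t → factor-≥0 {d} {p} {M} {t} 0≤p p≤1))

    survival-resp : ∀ {d p ts} {M N : Exp n} → M ≈[ d ] N → survival d p ts M ≡ survival d p ts N
    survival-resp {d} {p} {ts} {M} {N} eq = cong₂ ℚ._*_
      (⟦⟧?-cong (base? d M) (base? d N) (AgreeTo-resp eq) (AgreeTo-resp (≈-sym eq)))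
      (∏-cong ts (λ t _ → cong (λ x → 1ℚ ℚ.- p ℚ.* x)
        (⟦⟧?-cong (alive? d t M) (alive? d t N) (AgreeTo-resp eq) (AgreeTo-resp (≈-sym eq)))))

    survival-base-no : ∀ {d p ts} {M : Exp n} → ¬ AgreeTo A′ d M B → survival d p ts M ≡ 0ℚ
    survival-base-no {d} {p} {ts} {M} ¬b = trans (cong (ℚ._* ∏ (factor d p M) ts) (⟦⟧?-no (base? d M) ¬b)) (ℚₚ.*-zeroˡ (∏ (factor d p M) ts))

    -- A target alive at level `d` is alive at level `suc d` on at least a (weighted) fraction `1/C`
    -- of the fibre. A chance `p′` from level `suc d` onwards thus becomes `p = p′/C` from level `d`
    -- onwards.
    module FiberStep {d : ℕ} {M′ : Exp n} (base : AgreeTo A′ d M′ B)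
             {p p′ : ℚ} (0≤p′ : 0ℚ ℚ.≤ p′) (p′≤1 : p′ ℚ.≤ 1ℚ) (0≤p : 0ℚ ℚ.≤ p) (Cp : p ℚ.* fromℕ C ≡ p′) where
      Fib = Fiber n d M′
      S : List (Target n) → ℚ
      S ts = ∑ (survival (suc d) p′ ts) Fib

      survival-∷ : ∀ t ts M → survival (suc d) p′ (t ∷ ts) M ≡
        survival (suc d) p′ ts M ℚ.+ (ℚ.- p′) ℚ.* (⟦ alive? (suc d) t M ⟧? ℚ.* survival (suc d) p′ ts M)
      survival-∷ t ts M = expand-factor ⟦ base? (suc d) M ⟧? p′ ⟦ alive? (suc d) t M ⟧? (∏ (factor (suc d) p′ M) ts)

      survivors : Target n → List (Target n) → ℚ
      survivors t ts = ∑ (λ M → ⟦ alive? (suc d) t M ⟧? ℚ.* survival (suc d) p′ ts M) Fib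

      S-∷ : ∀ t ts → S (t ∷ ts) ≡ S ts ℚ.- p′ ℚ.* survivors t ts
      S-∷ t ts = trans (∑-cong Fib (λ M _ → survival-∷ t ts M))
        (trans (∑-+ (survival (suc d) p′ ts) _ Fib)
        (cong (S ts ℚ.+_) (trans (∑-*ˡ (ℚ.- p′) (λ M → ⟦ alive? (suc d) t M ⟧? ℚ.* survival (suc d) p′ ts M) Fib)
          (sym (ℚₚ.neg-distribˡ-* p′ (survivors t ts))))))

      survivors-≥0 : ∀ t ts → 0ℚ ℚ.≤ survivors t ts
      survivors-≥0 t ts = ∑-≥0 Fib (λ M → *-≥0 (⟦⟧?-≥0 (alive? (suc d) t M)) (survival-≥0 {ts = ts} 0≤p′ p′≤1 M))

      -- Substitution on W t makes t survive, and M is recovered from the result and its own table on W t.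
      S≤survivors : ∀ {t ts} → IsTarget t → Allₗ (Disjoint t) ts → Allₗ IsTarget ts → Alive d t M′ →
                    S ts ℚ.≤ fromℕ C ℚ.* survivors t ts
      S≤survivors {t} {ts} it disj its alive = begin
        S ts
          ≤⟨ ∑-injection Rel Fib (cartesianProduct Fib tables) g≥0 total
               (AllPairs.map (λ { ≉ (N , e) (o₁ , t₁) (o₂ , t₂) → ≉ (recover o₁ t₁ o₂ t₂) }) (AllPairsₚ.filter⁺ _ (𝓚↾-distinct n (suc d)))) ⟩
        ∑ g (cartesianProduct Fib tables)
          ≡⟨ ∑-cartesianProduct g Fib tables ⟩
        ∑ (λ N → ∑ (λ e → g (N , e)) tables) Fib
          ≡⟨ ∑-cong Fib (λ N _ → ∑-const (g₁ N) tables) ⟩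
        ∑ (λ N → fromℕ (length tables) ℚ.* g₁ N) Fib
          ≡⟨ ∑-*ˡ (fromℕ (length tables)) g₁ Fib ⟩
        fromℕ (length tables) ℚ.* survivors t ts
          ≤⟨ *-monoˡ-≤ (survivors-≥0 t ts) (fromℕ-mono few-tables) ⟩
        fromℕ C ℚ.* survivors t ts ∎
        where
          open ℚₚ.≤-Reasoning
          open IsTarget it
          g₁ : Exp n → ℚ
          g₁ N = ⟦ alive? (suc d) t N ⟧? ℚ.* survival (suc d) p′ ts N
          g : Exp n × Exp n → ℚ
          g (N , _) = g₁ N
          g≥0 : ∀ y → 0ℚ ℚ.≤ g y
          g≥0 (N , _) = *-≥0 (⟦⟧?-≥0 (alive? (suc d) t N)) (survival-≥0 {ts = ts} 0≤p′ p′≤1 N)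
          Outside : Exp n → Exp n → Set
          Outside M N = ∀ R xs → DimTo (suc d) xs → ¬ All ∣ W t ∣ₛ xs → N R xs ≡ M R xs
          Rel : Exp n → Exp n × Exp n → Set
          Rel M (N , e) = Outside M N × (∀ R xs → All ∣ W t ∣ₛ xs → M R xs ≡ e R xs)
          recover : ∀ {M₁ M₂ N e : Exp n} → Outside M₁ N → (∀ R xs → All ∣ W t ∣ₛ xs → M₁ R xs ≡ e R xs) →
                    Outside M₂ N → (∀ R xs → All ∣ W t ∣ₛ xs → M₂ R xs ≡ e R xs) → M₁ ≈[ suc d ] M₂
          recover o₁ t₁ o₂ t₂ R xs dm with em {P = All ∣ W t ∣ₛ xs}
          ... | yes Wxs = trans (t₁ R xs Wxs) (sym (t₂ R xs Wxs))
          ... | no ¬Wxs = trans (sym (o₁ R xs dm ¬Wxs)) (o₂ R xs dm ¬Wxs)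

          -- The change from `M` to `N` concerns tuples inside `W t` only. Those that also lie in
          -- another `W t′` lie in `A′`, where `M` and `N` both carry `B`; hence no other target
          -- notices it.
          survival-eq : ∀ {M N : Exp n} → Outside M N → Alive (suc d) t N → AgreeTo A′ (suc d) M B →
                        survival (suc d) p′ ts M ≡ survival (suc d) p′ ts N
          survival-eq {M} {N} out aN bM = cong₂ ℚ._*_
            (trans (⟦⟧?-yes (base? (suc d) M) bM) (sym (⟦⟧?-yes (base? (suc d) N) bN)))
            (∏-cong ts (λ t′ t′∈ → cong (λ x → 1ℚ ℚ.- p′ ℚ.* x)
              (⟦⟧?-cong (alive? (suc d) t′ M) (alive? (suc d) t′ N)
                (λ a R xs Wxs dm → trans (same {t′} (Allₗ.lookup disj t′∈) R xs Wxs dm) (a R xs Wxs dm))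
                (λ a R xs Wxs dm → trans (sym (same {t′} (Allₗ.lookup disj t′∈) R xs Wxs dm)) (a R xs Wxs dm)))))
            where
              bN : AgreeTo A′ (suc d) N B
              bN R xs Axs dm = trans (aN R xs (All.map A′⊆W Axs) dm) (agree R xs Axs)
              same : ∀ {t′} → Disjoint t t′ → ∀ R xs → All ∣ W t′ ∣ₛ xs → DimTo (suc d) xs → N R xs ≡ M R xs
              same dj R xs W′xs dm with em {P = All ∣ W t ∣ₛ xs}
              ... | no ¬Wxs = out R xs dm ¬Wxs
              ... | yes Wxs = trans (bN R xs Axs dm) (sym (bM R xs Axs dm))
                where
                  Axs : All A′ xs
                  Axs = ⊆⇒All xs (λ x∈ → dj (All⇒⊆ Wxs x∈) (All⇒⊆ W′xs x∈))

          Partner : Exp n → Set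
          Partner M = ∃[ y ] y ∈ₗ cartesianProduct Fib tables × Rel M y × survival (suc d) p′ ts M ℚ.≤ g y

          partner : ∀ {E N₀ N e : Exp n} → (E ↾dim suc d) ≈[ d ] M′ → Alive (suc d) t N₀ → Outside E N₀ →
                    N ∈ₗ 𝓚↾ n (suc d) → N ≈[ suc d ] N₀ → e ∈ₗ tables →
                    (∀ R xs → All ∣ W t ∣ₛ xs → (E ↾dim suc d) R xs ≡ e R xs) → Partner (E ↾dim suc d)
          partner {E} {N₀} {N} {e} M≈ ins out N∈ N≈ e∈ tab =
            (N , e) , ∈ₗ.∈-cartesianProduct⁺ (∈-Fiber⁺ N∈ N≈M′) e∈ , (outside , tab) , bound
            where
              M₁ = E ↾dim suc d
              aliveN : Alive (suc d) t N
              aliveN = AgreeTo-resp (≈-sym N≈) ins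
              outside : Outside M₁ N
              outside R xs dm ¬W = trans (N≈ R xs dm) (trans (out R xs dm ¬W) (sym (↾dim-≈ (suc d) E R xs dm)))
              -- The substituted structure stays in the fibre: inside `W t` both sides equal `F t`
              -- up to dimension `d`, and elsewhere nothing has changed.
              N≈M′ : N ≈[ d ] M′
              N≈M′ R xs dm = by-cases (All ∣ W t ∣ₛ xs)
                (λ Wxs → trans (aliveN R xs Wxs (DimTo-suc dm)) (sym (alive R xs Wxs dm)))
                (λ ¬Wxs → trans (outside R xs (DimTo-suc dm) ¬Wxs) (M≈ R xs dm))
              -- If `M₁` disagrees with `B` on `A′`, its weight is `0` and any partner will do.
              bound : survival (suc d) p′ ts M₁ ℚ.≤ g₁ N
              bound = by-cases (AgreeTo A′ (suc d) M₁ B)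
                (λ b → ℚₚ.≤-reflexive (trans (survival-eq outside aliveN b)
                      (trans (sym (ℚₚ.*-identityˡ (survival (suc d) p′ ts N)))
                        (cong (ℚ._* survival (suc d) p′ ts N) (sym (⟦⟧?-yes (alive? (suc d) t N) aliveN))))))
                (λ ¬b → subst (ℚ._≤ g₁ N) (sym (survival-base-no {p = p′} {ts = ts} ¬b)) (g≥0 (N , e)))

          total : ∀ M → M ∈ₗ Fib → Partner M
          total M M∈ = case ∈-Fiber⁻ {M = M′} M∈ of λ { (M∈′ , M≈) → case ∈-𝓚↾⁻ M∈′ of λ { (E , E∈ , refl) →
            case substitute accepts (W t) (F t) represented hasDim dim≤k E∈
                   (AgreeTo-resp (≈-trans (≈-sym M≈) (≈-pred (↾dim-≈ (suc d) E))) alive) of λ { (N₀ , N₀∈ , ins , out) →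
            case ∈-𝓚↾⁺ (suc d) N₀∈ of λ { (N , N∈ , N≈) → case tabulated (E ↾dim suc d) of λ { (e , e∈ , tab) →
              partner M≈ ins out N∈ N≈ e∈ tab } } } } }

      -- Induction on the targets. If `t` is alive in `M′`, the structures in which it survives
      -- carry at least `S ts / C` of the weight of the others, so subtracting `p′` times their
      -- weight leaves at most `(1 - p) S ts`. If `t` is dead, its factor on the right is `1` and
      -- the subtracted term is dropped.
      S-bound : ∀ ts → Allₗ IsTarget ts → AllPairs Disjoint ts →
                S ts ℚ.≤ fromℕ (length Fib) ℚ.* ∏ (factor d p M′) ts
      S-bound [] _ _ = ∑-bound Fib (λ M _ → subst (ℚ._≤ 1ℚ) (sym (ℚₚ.*-identityʳ _)) (⟦⟧?-≤1 (base? (suc d) M)))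
      S-bound (t ∷ ts) (it ∷ₗ its) (dj ∷ djs) = by-cases (Alive d t M′) survives dies
        where
        open ℚₚ.≤-Reasoning
        dies : ¬ Alive d t M′ → S (t ∷ ts) ℚ.≤ fromℕ (length Fib) ℚ.* ∏ (factor d p M′) (t ∷ ts)
        dies ¬a = begin
          S (t ∷ ts)                                                  ≡⟨ S-∷ t ts ⟩
          S ts ℚ.- p′ ℚ.* survivors t ts                              ≤⟨ p-q≤p (*-≥0 0≤p′ (survivors-≥0 t ts)) ⟩
          S ts                                                        ≤⟨ S-bound ts its djs ⟩
          fromℕ (length Fib) ℚ.* ∏ (factor d p M′) ts                 ≡⟨ cong (fromℕ (length Fib) ℚ.*_) (sym (trans
          (cong (ℚ._* ∏ (factor d p M′) ts) (factor-dead {p = p} {M = M′} {t = t} ¬a)) (ℚₚ.*-identityˡ (∏ (factor d p M′) ts)))) ⟩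
          fromℕ (length Fib) ℚ.* ∏ (factor d p M′) (t ∷ ts)           ∎
        survives : Alive d t M′ → S (t ∷ ts) ℚ.≤ fromℕ (length Fib) ℚ.* ∏ (factor d p M′) (t ∷ ts)
        survives a = begin
          S (t ∷ ts)                                                  ≡⟨ S-∷ t ts ⟩
          S ts ℚ.- p′ ℚ.* survivors t ts                              ≤⟨ ℚₚ.+-monoʳ-≤ (S ts) (ℚₚ.neg-antimono-≤ pS≤) ⟩
          S ts ℚ.- p ℚ.* S ts                                         ≡⟨ factor-out (S ts) p ⟩
          (1ℚ ℚ.- p) ℚ.* S ts                                         ≤⟨ *-monoʳ-≤ 0≤1-p (S-bound ts its djs) ⟩
          (1ℚ ℚ.- p) ℚ.* (fromℕ (length Fib) ℚ.* ∏ (factor d p M′) ts) ≡⟨ *-swapˡ (1ℚ ℚ.- p) (fromℕ (length Fib)) (∏ (factor d p M′) ts) ⟩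
          fromℕ (length Fib) ℚ.* ((1ℚ ℚ.- p) ℚ.* ∏ (factor d p M′) ts) ≡⟨ cong (λ x → fromℕ (length Fib) ℚ.* (x ℚ.* ∏ (factor d p M′) ts))
                                                                         (sym (factor-alive {p = p} {M = M′} {t = t} a)) ⟩
          fromℕ (length Fib) ℚ.* ∏ (factor d p M′) (t ∷ ts)           ∎
          where
          1≤C : 1 ≤ C
          1≤C = ℕₚ.n≢0⇒n>0 C≢0
          0≤1-p : 0ℚ ℚ.≤ 1ℚ ℚ.- p
          0≤1-p = p≤q⇒0≤q-p (ℚₚ.≤-trans (subst₂ ℚ._≤_ (ℚₚ.*-identityʳ p) Cp (*-monoʳ-≤ 0≤p (fromℕ-mono 1≤C))) p′≤1)
          pS≤ : p ℚ.* S ts ℚ.≤ p′ ℚ.* survivors t ts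
          pS≤ = begin
            p ℚ.* S ts                                ≤⟨ *-monoʳ-≤ 0≤p (S≤survivors it dj its a) ⟩
            p ℚ.* (fromℕ C ℚ.* survivors t ts)        ≡⟨ ℚₚ.*-assoc p (fromℕ C) (survivors t ts) ⟨
            p ℚ.* fromℕ C ℚ.* survivors t ts          ≡⟨ cong (ℚ._* survivors t ts) Cp ⟩
            p′ ℚ.* survivors t ts                     ∎

    -- If `M` disagrees with `B` on `A′`, so does every member of its fibre, and both sides vanish.
    fiber-bound : ∀ {d p p′} → 0ℚ ℚ.≤ p′ → p′ ℚ.≤ 1ℚ → 0ℚ ℚ.≤ p → p ℚ.* fromℕ C ≡ p′ →
      ∀ ts → Allₗ IsTarget ts → AllPairs Disjoint ts → ∀ M →
      ∑ (survival (suc d) p′ ts) (Fiber n d M) ℚ.≤ fromℕ (length (Fiber n d M)) ℚ.* survival d p ts M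
    fiber-bound {d} {p} {p′} 0≤p′ p′≤1 0≤p Cp ts its djs M = by-cases (AgreeTo A′ d M B)
      (λ b → subst (λ x → ∑ (survival (suc d) p′ ts) (Fiber n d M) ℚ.≤ fromℕ (length (Fiber n d M)) ℚ.* x)
            (sym (trans (cong (ℚ._* ∏ (factor d p M) ts) (⟦⟧?-yes (base? d M) b)) (ℚₚ.*-identityˡ (∏ (factor d p M) ts))))
            (FiberStep.S-bound b 0≤p′ p′≤1 0≤p Cp ts its djs))
      (λ ¬b → ℚₚ.≤-reflexive (trans
            (trans (∑-cong (Fiber n d M) (λ N N∈ → survival-base-no {p = p′} {ts = ts} (λ a → ¬b
              (AgreeTo-resp (proj₂ (∈-Fiber⁻ {M = M} N∈)) (AgreeTo-pred a))))) (∑-0 (Fiber n d M)))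
            (sym (trans (cong (fromℕ (length (Fiber n d M)) ℚ.*_) (survival-base-no {p = p} {ts = ts} ¬b)) (ℚₚ.*-zeroʳ (fromℕ (length (Fiber n d M))))))))

    𝔼-descend : ∀ ts → Allₗ IsTarget ts → AllPairs Disjoint ts → ∀ d {p} → 0ℚ ℚ.≤ p → p ℚ.≤ 1ℚ →
                𝔼 n d (survival d p ts) ℚ.≤ 𝔼 n 0 (survival 0 (p ℚ.* recip C ^ℚ d) ts)
    𝔼-descend ts its djs zero {p} 0≤p p≤1 = ℚₚ.≤-reflexive (cong (λ q → 𝔼 n 0 (survival 0 q ts)) (sym (ℚₚ.*-identityʳ p)))
    𝔼-descend ts its djs (suc d) {p} 0≤p p≤1 = ℚₚ.≤-trans
      (𝔼-suc-≤ {d = d} {g = survival d (p ℚ.* recip C) ts} (λ M _ → fiber-bound 0≤p p≤1 0≤pC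
        (trans (ℚₚ.*-assoc p (recip C) (fromℕ C)) (trans (cong (p ℚ.*_) (recip-* C C≢0)) (ℚₚ.*-identityʳ p))) ts its djs M))
      (subst (λ q → 𝔼 n d (survival d (p ℚ.* recip C) ts) ℚ.≤ 𝔼 n 0 (survival 0 q ts))
        (ℚₚ.*-assoc p (recip C) (recip C ^ℚ d))
        (𝔼-descend ts its djs d 0≤pC (subst (p ℚ.* recip C ℚ.≤_) (ℚₚ.*-identityʳ 1ℚ) (*-mono-≤ 0≤p 0≤1 p≤1 (recip-≤1 C≢0)))))
      where
        0≤pC : 0ℚ ℚ.≤ p ℚ.* recip C
        0≤pC = *-≥0 0≤p (recip-≥0 C)

    q : ℚ
    q = recip C ^ℚ ρ

    q≤1 : q ℚ.≤ 1ℚ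
    q≤1 = subst (q ℚ.≤_) (1^ℚ ρ) (^ℚ-mono ρ (recip-≥0 C) (recip-≤1 C≢0))

    q≥0 : 0ℚ ℚ.≤ q
    q≥0 = ^ℚ-≥0 ρ (recip-≥0 C)

    -- Tuples of dimension 0 lie in A′, so every target is alive at level 0.
    survival-0 : ∀ {p} → 0ℚ ℚ.≤ p → p ℚ.≤ 1ℚ → ∀ ts → Allₗ IsTarget ts → ∀ M → survival 0 p ts M ℚ.≤ (1ℚ ℚ.- p) ^ℚ length ts
    survival-0 {p} 0≤p p≤1 ts its M = by-cases (AgreeTo A′ 0 M B) yes-case
      (λ ¬b → subst (ℚ._≤ (1ℚ ℚ.- p) ^ℚ length ts) (sym (survival-base-no {p = p} {ts = ts} ¬b)) (^ℚ-≥0 (length ts) (p≤q⇒0≤q-p p≤1)))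
      where
      yes-case : AgreeTo A′ 0 M B → survival 0 p ts M ℚ.≤ (1ℚ ℚ.- p) ^ℚ length ts
      yes-case b = ℚₚ.≤-reflexive (trans (cong (ℚ._* ∏ (factor 0 p M) ts) (⟦⟧?-yes (base? 0 M) b)) (trans (ℚₚ.*-identityˡ (∏ (factor 0 p M) ts))
            (trans (∏-cong {g = λ _ → 1ℚ ℚ.- p} ts (λ t t∈ → factor-alive {p = p} {M = M} {t = t} (alive t∈))) (∏-const (1ℚ ℚ.- p) ts))))
        where
        dim0 : ∀ {m} {xs : Vec (Fin (size n)) m} → DimTo 0 xs → All A′ xs
        dim0 {xs = xs} (0 , ([] , _ , _ , span) , z≤n) = ⊆⇒All xs (λ x∈ → A′-closed (Pre.monotone n (λ ()) (span x∈)))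
        alive : ∀ {t} → t ∈ₗ ts → Alive 0 t M
        alive t∈ R xs _ dm = trans (b R xs (dim0 dm) dm) (sym (IsTarget.agree (Allₗ.lookup its t∈) R xs (dim0 dm)))

    -- At level `ρ` every tuple is decided, and with `p = 1` the weight is the indicator that `A′`
    -- carries `B` and all targets are lost. The descent to level `0` turns `1` into `q`, one factor
    -- `1/C` per level.
    𝔼-decay : ∀ ts → Allₗ IsTarget ts → AllPairs Disjoint ts →
              𝔼 n ρ (survival ρ 1ℚ ts) ℚ.≤ (1ℚ ℚ.- q) ^ℚ length ts
    𝔼-decay ts its djs = begin
      𝔼 n ρ (survival ρ 1ℚ ts)                          ≤⟨ 𝔼-descend ts its djs ρ 0≤1 ℚₚ.≤-refl ⟩
      𝔼 n 0 (survival 0 (1ℚ ℚ.* q) ts)                  ≡⟨ cong (λ x → 𝔼 n 0 (survival 0 x ts)) (ℚₚ.*-identityˡ q) ⟩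
      𝔼 n 0 (survival 0 q ts)                           ≤⟨ 𝔼-mono {d = 0} (λ M _ → survival-0 q≥0 q≤1 ts its M) ⟩
      𝔼 n 0 (λ _ → (1ℚ ℚ.- q) ^ℚ length ts)             ≡⟨ const ⟩
      (1ℚ ℚ.- q) ^ℚ length ts                           ∎
      where
        open ℚₚ.≤-Reasoning
        c = (1ℚ ℚ.- q) ^ℚ length ts
        const : 𝔼 n 0 (λ _ → c) ≡ c
        const = trans (∑-cong (𝓚↾ n 0) (λ M _ → trans (cong (ℙ n 0 M ℚ.*_) (sym (ℚₚ.*-identityʳ c)))
                  (trans (sym (ℚₚ.*-assoc (ℙ n 0 M) c 1ℚ)) (trans (cong (ℚ._* 1ℚ) (ℚₚ.*-comm (ℙ n 0 M) c)) (ℚₚ.*-assoc c (ℙ n 0 M) 1ℚ)))))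
                (trans (∑-*ˡ c _ (𝓚↾ n 0)) (trans (cong (c ℚ.*_) (𝔼-total n 0)) (ℚₚ.*-identityʳ c)))

-- Exponential decay against polynomial growth

module _ where
  open ℚ-Solver.+-*-Solver

  private
    shrink : ∀ p x → (1ℚ ℚ.- p) ℚ.* (1ℚ ℚ.+ (1ℚ ℚ.+ x) ℚ.* p) ℚ.+ (1ℚ ℚ.+ x) ℚ.* (p ℚ.* p) ≡ 1ℚ ℚ.+ x ℚ.* p
    shrink = solve 2 (λ p x → (con 1ℚ :- p) :* (con 1ℚ :+ (con 1ℚ :+ x) :* p) :+ (con 1ℚ :+ x) :* (p :* p) := con 1ℚ :+ x :* p) refl

    grow : ∀ p x → (1ℚ ℚ.- p) ℚ.* (1ℚ ℚ.- x ℚ.* p) ≡ (1ℚ ℚ.- (1ℚ ℚ.+ x) ℚ.* p) ℚ.+ x ℚ.* (p ℚ.* p)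
    grow = solve 2 (λ p x → (con 1ℚ :- p) :* (con 1ℚ :- x :* p) := (con 1ℚ :- (con 1ℚ :+ x) :* p) :+ x :* (p :* p)) refl

    rotate : ∀ a b c → (a ℚ.* b) ℚ.* c ≡ b ℚ.* (a ℚ.* c)
    rotate = solve 3 (λ a b c → (a :* b) :* c := b :* (a :* c)) refl

  module _ {p : ℚ} (0≤p : 0ℚ ℚ.≤ p) (p≤1 : p ℚ.≤ 1ℚ) where

    0≤1-p : 0ℚ ℚ.≤ 1ℚ ℚ.- p
    0≤1-p = p≤q⇒0≤q-p p≤1

    -- Multiplication by `1 - p` takes `1 + (m + 1) p` below `1 + m p`; by `shrink` the difference
    -- is `(m + 1) p²`.
    [1-p]^m*[1+mp]≤1 : ∀ m → (1ℚ ℚ.- p) ^ℚ m ℚ.* (1ℚ ℚ.+ fromℕ m ℚ.* p) ℚ.≤ 1ℚ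
    [1-p]^m*[1+mp]≤1 zero = ℚₚ.≤-reflexive (trans (ℚₚ.*-identityˡ _) (trans (cong (1ℚ ℚ.+_) (ℚₚ.*-zeroˡ p)) (ℚₚ.+-identityʳ 1ℚ)))
    [1-p]^m*[1+mp]≤1 (suc m) = begin
      (1ℚ ℚ.- p) ℚ.* y ℚ.* (1ℚ ℚ.+ fromℕ (suc m) ℚ.* p)        ≡⟨ rotate (1ℚ ℚ.- p) y (1ℚ ℚ.+ fromℕ (suc m) ℚ.* p) ⟩
      y ℚ.* ((1ℚ ℚ.- p) ℚ.* (1ℚ ℚ.+ fromℕ (suc m) ℚ.* p))      ≡⟨ cong (λ z → y ℚ.* ((1ℚ ℚ.- p) ℚ.* (1ℚ ℚ.+ z ℚ.* p))) (fromℕ-+ 1 m) ⟩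
      y ℚ.* ((1ℚ ℚ.- p) ℚ.* (1ℚ ℚ.+ (1ℚ ℚ.+ fromℕ m) ℚ.* p))   ≤⟨ *-monoʳ-≤ (^ℚ-≥0 m 0≤1-p) (subst ((1ℚ ℚ.- p) ℚ.* (1ℚ ℚ.+ (1ℚ ℚ.+ fromℕ m) ℚ.* p) ℚ.≤_)
                                                                     (shrink p (fromℕ m)) (p≤p+q (*-≥0 (+-≥0 0≤1 (fromℕ-≥0 m)) (*-≥0 0≤p 0≤p)))) ⟩
      y ℚ.* (1ℚ ℚ.+ fromℕ m ℚ.* p)                             ≤⟨ [1-p]^m*[1+mp]≤1 m ⟩
      1ℚ                                                       ∎
      where
        open ℚₚ.≤-Reasoning
        y = (1ℚ ℚ.- p) ^ℚ m

    m*p*[1-p]^m≤1 : ∀ m → fromℕ m ℚ.* (1ℚ ℚ.- p) ^ℚ m ℚ.* p ℚ.≤ 1ℚ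
    m*p*[1-p]^m≤1 m = ℚₚ.≤-trans
      (subst (ℚ._≤ y ℚ.* (1ℚ ℚ.+ fromℕ m ℚ.* p)) (sym (rotate (fromℕ m) y p)) (*-monoʳ-≤ (^ℚ-≥0 m 0≤1-p) (p≤q+p 0≤1)))
      ([1-p]^m*[1+mp]≤1 m)
      where y = (1ℚ ℚ.- p) ^ℚ m

    bernoulli : ∀ D → 1ℚ ℚ.- fromℕ D ℚ.* p ℚ.≤ (1ℚ ℚ.- p) ^ℚ D
    bernoulli zero = ℚₚ.≤-reflexive (trans (cong (λ x → 1ℚ ℚ.- x) (ℚₚ.*-zeroˡ p)) (ℚₚ.+-identityʳ 1ℚ))
    bernoulli (suc D) = begin
      1ℚ ℚ.- fromℕ (suc D) ℚ.* p                                          ≡⟨ cong (λ x → 1ℚ ℚ.- x ℚ.* p) (fromℕ-+ 1 D) ⟩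
      1ℚ ℚ.- (1ℚ ℚ.+ fromℕ D) ℚ.* p                                       ≤⟨ p≤p+q (*-≥0 (fromℕ-≥0 D) (*-≥0 0≤p 0≤p)) ⟩
      (1ℚ ℚ.- (1ℚ ℚ.+ fromℕ D) ℚ.* p) ℚ.+ fromℕ D ℚ.* (p ℚ.* p)           ≡⟨ sym (grow p (fromℕ D)) ⟩
      (1ℚ ℚ.- p) ℚ.* (1ℚ ℚ.- fromℕ D ℚ.* p)                               ≤⟨ *-monoʳ-≤ 0≤1-p (bernoulli D) ⟩
      (1ℚ ℚ.- p) ^ℚ suc D                                                 ∎
      where open ℚₚ.≤-Reasoning

  -- With p = q / D, Bernoulli gives 1 - q ≤ (1 - p)^D, so m^D (1 - q)^m is at most the D-th power of m (1 - p)^m ≤ 1 / p.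
  polynomial-decay : ∀ {p q} D → 0ℚ ℚ.≤ p → p ℚ.≤ 1ℚ → fromℕ D ℚ.* p ≡ q → q ℚ.≤ 1ℚ →
                     ∀ m → fromℕ m ^ℚ D ℚ.* (1ℚ ℚ.- q) ^ℚ m ℚ.* p ^ℚ D ℚ.≤ 1ℚ
  polynomial-decay {p} {q} D 0≤p p≤1 Dp≡q q≤1 m = begin
    fromℕ m ^ℚ D ℚ.* (1ℚ ℚ.- q) ^ℚ m ℚ.* p ^ℚ D
      ≤⟨ *-monoˡ-≤ (^ℚ-≥0 D 0≤p) (*-monoʳ-≤ (^ℚ-≥0 D (fromℕ-≥0 m)) (^ℚ-mono m (p≤q⇒0≤q-p q≤1)
           (subst (λ x → 1ℚ ℚ.- x ℚ.≤ (1ℚ ℚ.- p) ^ℚ D) Dp≡q (bernoulli 0≤p p≤1 D)))) ⟩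
    fromℕ m ^ℚ D ℚ.* ((1ℚ ℚ.- p) ^ℚ D) ^ℚ m ℚ.* p ^ℚ D
      ≡⟨ cong (λ x → fromℕ m ^ℚ D ℚ.* x ℚ.* p ^ℚ D) (^ℚ-swap (1ℚ ℚ.- p) D m) ⟩
    fromℕ m ^ℚ D ℚ.* ((1ℚ ℚ.- p) ^ℚ m) ^ℚ D ℚ.* p ^ℚ D
      ≡⟨ cong (ℚ._* p ^ℚ D) (sym (^ℚ-distrib-* (fromℕ m) ((1ℚ ℚ.- p) ^ℚ m) D)) ⟩
    (fromℕ m ℚ.* (1ℚ ℚ.- p) ^ℚ m) ^ℚ D ℚ.* p ^ℚ D
      ≡⟨ sym (^ℚ-distrib-* (fromℕ m ℚ.* (1ℚ ℚ.- p) ^ℚ m) p D) ⟩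
    (fromℕ m ℚ.* (1ℚ ℚ.- p) ^ℚ m ℚ.* p) ^ℚ D
      ≤⟨ ^ℚ-mono D (*-≥0 (*-≥0 (fromℕ-≥0 m) (^ℚ-≥0 m (0≤1-p 0≤p p≤1))) 0≤p) (m*p*[1-p]^m≤1 0≤p p≤1 m) ⟩
    1ℚ ^ℚ D
      ≡⟨ 1^ℚ D ⟩
    1ℚ ∎
    where open ℚₚ.≤-Reasoning

  numerator-denominator : ∀ a d .(c : Coprime (suc a) (suc d)) → mkℚ ℤ.+[1+ a ] d c ℚ.* fromℕ (suc d) ≡ fromℕ (suc a)
  numerator-denominator a d c = ℚₚ.toℚᵘ-injective
    (ℚᵘₚ.≃-trans (ℚₚ.toℚᵘ-homo-* (mkℚ ℤ.+[1+ a ] d c) (fromℕ (suc d)))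
    (ℚᵘₚ.≃-trans (ℚᵘₚ.*-congˡ {mkℚᵘ ℤ.+[1+ a ] d} (ℚₚ.toℚᵘ-fromℚᵘ (mkℚᵘ (ℤ.+ suc d) 0)))
    (ℚᵘₚ.≃-trans (ℚᵘ.*≡* (trans (ℤₚ.*-identityʳ (ℤ.+ suc a ℤ.* ℤ.+ suc d))
                    (cong (λ m → ℤ.+ suc a ℤ.* ℤ.+ m) (sym (ℕₚ.*-identityʳ (suc d))))))
     (ℚᵘₚ.≃-sym (ℚₚ.toℚᵘ-fromℚᵘ (mkℚᵘ (ℤ.+ suc a) 0))))))

  archimedean : ∀ ε → 0ℚ ℚ.< ε → ∃[ N ] 1ℚ ℚ.≤ ε ℚ.* fromℕ N
  archimedean (mkℚ ℤ.+[1+ a ] d c) _ =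
    suc d , subst (1ℚ ℚ.≤_) (sym (numerator-denominator a d c)) (fromℕ-mono {1} {suc a} (s≤s z≤n))
  archimedean (mkℚ (ℤ.+ 0) d c) (ℚ.*<* (ℤ.+<+ ()))
  archimedean (mkℚ ℤ.-[1+ a ] d c) (ℚ.*<* ())

  ceiling : ∀ x → ∃[ c ] x ℚ.≤ fromℕ c
  ceiling x@(mkℚ ℤ.+[1+ a ] d c) = suc a , (begin
    x                                     ≡⟨ sym (ℚₚ.*-identityʳ x) ⟩
    x ℚ.* 1ℚ                              ≤⟨ *-monoʳ-≤ (ℚₚ.nonNegative⁻¹ x) (fromℕ-mono {1} {suc d} (s≤s z≤n)) ⟩
    x ℚ.* fromℕ (suc d)                   ≡⟨ numerator-denominator a d c ⟩
    fromℕ (suc a)                         ∎)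
    where open ℚₚ.≤-Reasoning
  ceiling x@(mkℚ (ℤ.+ 0) d c)      = 0 , ℚₚ.nonPositive⁻¹ x
  ceiling x@(mkℚ ℤ.-[1+ a ] d c) = 0 , ℚₚ.<⇒≤ (ℚₚ.negative⁻¹ x)

  -- The hypothesis is applied with one power of `m` to spare: `c m^D (1 - q)^m` is at most
  -- `c K / m`, which drops below `ε` for large `m`.
  tail-vanishes : ∀ {q} → (∀ D → ∃[ K ] ∀ m → fromℕ m ^ℚ suc D ℚ.* (1ℚ ℚ.- q) ^ℚ m ℚ.≤ fromℕ K) →
    ∀ c D ε → 0ℚ ℚ.< ε → ∃[ N ] ∀ m → N ≤ m → fromℕ (c * m ^ D) ℚ.* (1ℚ ℚ.- q) ^ℚ m ℚ.< ε
  tail-vanishes {q} bounded c D ε 0<ε with K , le ← bounded D with den , 1≤εden ← archimedean ε 0<ε =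
    -- `den` is at least `1/ε`; the `suc` supplies the strict inequality.
    den * suc (c * K) , λ m N≤m → ℚₚ.≰⇒> λ ε≤X → ℚₚ.<-irrefl refl (begin-strict
      fromℕ (c * K)                                       <⟨ fromℕ-mono-< {c * K} {suc (c * K)} ℕₚ.≤-refl ⟩
      fromℕ (suc (c * K))                                 ≡⟨ sym (ℚₚ.*-identityˡ _) ⟩
      1ℚ ℚ.* fromℕ (suc (c * K))                          ≤⟨ *-monoˡ-≤ (fromℕ-≥0 (suc (c * K))) 1≤εden ⟩
      ε ℚ.* fromℕ den ℚ.* fromℕ (suc (c * K))             ≡⟨ ℚₚ.*-assoc ε (fromℕ den) (fromℕ (suc (c * K))) ⟩
      ε ℚ.* (fromℕ den ℚ.* fromℕ (suc (c * K)))           ≡⟨ cong (ε ℚ.*_) (sym (fromℕ-* den (suc (c * K)))) ⟩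
      ε ℚ.* fromℕ (den * suc (c * K))                     ≤⟨ *-mono-≤ (ℚₚ.<⇒≤ 0<ε) (fromℕ-≥0 m) ε≤X (fromℕ-mono N≤m) ⟩
      fromℕ (c * m ^ D) ℚ.* x m ℚ.* fromℕ m               ≡⟨ cong (λ z → z ℚ.* x m ℚ.* fromℕ m) (trans (fromℕ-* c (m ^ D)) (cong (fromℕ c ℚ.*_) (fromℕ-^ m D))) ⟩
      fromℕ c ℚ.* fromℕ m ^ℚ D ℚ.* x m ℚ.* fromℕ m        ≡⟨ regroup (fromℕ c) (fromℕ m ^ℚ D) (x m) (fromℕ m) ⟩
      fromℕ c ℚ.* (fromℕ m ^ℚ suc D ℚ.* x m)              ≤⟨ *-monoʳ-≤ (fromℕ-≥0 c) (le m) ⟩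
      fromℕ c ℚ.* fromℕ K                                 ≡⟨ sym (fromℕ-* c K) ⟩
      fromℕ (c * K)                                       ∎)
    where
      open ℚₚ.≤-Reasoning
      x : ℕ → ℚ
      x m = (1ℚ ℚ.- q) ^ℚ m
      regroup : ∀ a b y z → a ℚ.* b ℚ.* y ℚ.* z ≡ a ℚ.* (z ℚ.* b ℚ.* y)
      regroup = solve 4 (λ a b y z → a :* b :* y :* z := a :* (z :* b :* y)) refl

  -- Coefficients are rounded up to natural numbers, and for `1 ≤ m` the lower powers are absorbed
  -- into the highest one.
  polynomial-bound : ∀ P → ∃[ c ] ∃[ D ] ∀ m → 1 ≤ m → evalPoly P (fromℕ m) ℚ.≤ fromℕ (c * m ^ D)
  polynomial-bound [] = 0 , 0 , λ _ _ → ℚₚ.≤-refl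
  polynomial-bound (c₀ ∷ P) with c , D , le ← polynomial-bound P with c₁ , c₀≤ ← ceiling c₀ =
    c₁ + c , suc D , λ m 1≤m → begin
      c₀ ℚ.+ fromℕ m ℚ.* evalPoly P (fromℕ m)          ≤⟨ ℚₚ.+-mono-≤ c₀≤ (*-monoʳ-≤ (fromℕ-≥0 m) (le m 1≤m)) ⟩
      fromℕ c₁ ℚ.+ fromℕ m ℚ.* fromℕ (c * m ^ D)       ≡⟨ cong (fromℕ c₁ ℚ.+_) (sym (fromℕ-* m (c * m ^ D))) ⟩
      fromℕ c₁ ℚ.+ fromℕ (m * (c * m ^ D))             ≡⟨ sym (fromℕ-+ c₁ (m * (c * m ^ D))) ⟩
      fromℕ (c₁ + m * (c * m ^ D))                     ≤⟨ fromℕ-mono (step m 1≤m) ⟩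
      fromℕ ((c₁ + c) * m ^ suc D)                     ∎
    where
      open ℚₚ.≤-Reasoning
      step : ∀ m → 1 ≤ m → c₁ + m * (c * m ^ D) ≤ (c₁ + c) * m ^ suc D
      step m 1≤m = subst (c₁ + m * (c * m ^ D) ≤_) (sym (ℕₚ.*-distribʳ-+ (m ^ suc D) c₁ c))
        (ℕₚ.+-mono-≤ (subst (_≤ c₁ * m ^ suc D) (ℕₚ.*-identityʳ c₁)
                        (ℕₚ.*-monoʳ-≤ c₁ (subst (_≤ m ^ suc D) (ℕₚ.^-zeroˡ (suc D)) (ℕₚ.^-monoˡ-≤ (suc D) 1≤m))))
                     (ℕₚ.≤-reflexive (trans (sym (ℕₚ.*-assoc m c (m ^ D))) (trans (cong (_* m ^ D) (ℕₚ.*-comm m c)) (ℕₚ.*-assoc c m (m ^ D))))))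

  monomial : ℕ → ℕ → List ℚ
  monomial c D = replicate D 0ℚ ++ fromℕ c ∷ []

  eval-monomial : ∀ c D m → evalPoly (monomial c D) (fromℕ m) ≡ fromℕ (c * m ^ D)
  eval-monomial c zero m = trans (cong (fromℕ c ℚ.+_) (ℚₚ.*-zeroʳ (fromℕ m)))
    (trans (ℚₚ.+-identityʳ (fromℕ c)) (cong fromℕ (sym (ℕₚ.*-identityʳ c))))
  eval-monomial c (suc D) m = trans (ℚₚ.+-identityˡ _) (trans (cong (fromℕ m ℚ.*_) (eval-monomial c D m))
    (trans (sym (fromℕ-* m (c * m ^ D))) (cong fromℕ
      (trans (sym (ℕₚ.*-assoc m c (m ^ D))) (trans (cong (_* m ^ D) (ℕₚ.*-comm m c)) (ℕₚ.*-assoc c m (m ^ D)))))))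

sqrt : ∀ l → ∃[ μ ] μ * μ ≤ l × l < suc μ * suc μ
sqrt zero = 0 , z≤n , s≤s z≤n
sqrt (suc l) with sqrt l
... | μ , lo , hi with suc μ * suc μ ℕ.≤? suc l
...   | yes le = suc μ , le , ℕₚ.<-≤-trans (s≤s hi) (ℕₚ.*-mono-< (ℕₚ.n<1+n (suc μ)) (ℕₚ.n<1+n (suc μ)))
...   | no ¬le = μ , ℕₚ.m≤n⇒m≤1+n lo , ℕₚ.≰⇒> ¬le

sqrt-unbounded : ∀ {f : ℕ → ℕ} → TendsToInfinity f → TendsToInfinity (λ n → proj₁ (sqrt (f n)))
sqrt-unbounded {f} f→∞ c with N , le ← f→∞ (c * c) = N , λ n N≤n → ℕₚ.≮⇒≥ λ μ<c →
  ℕₚ.<⇒≱ (proj₂ (proj₂ (sqrt (f n)))) (ℕₚ.≤-trans (ℕₚ.*-mono-≤ μ<c μ<c) (le n N≤n))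

length-concatMap-≤ : {A B : Set} (f : A → List B) (c : ℕ) (xs : List A) → (∀ x → length (f x) ≤ c) →
                     length (concatMap f xs) ≤ length xs * c
length-concatMap-≤ f c []       le = z≤n
length-concatMap-≤ f c (x ∷ xs) le = subst (_≤ c + length xs * c) (sym (Listₚ.length-++ (f x)))
  (ℕₚ.+-mono-≤ (le x) (length-concatMap-≤ f c xs le))

∈-concatMap : {A B : Set} (f : A → List B) {xs : List A} {x : A} {y : B} → x ∈ₗ xs → y ∈ₗ f x → y ∈ₗ concatMap f xs
∈-concatMap f x∈ y∈ = ∈ₗ.∈-concatMap⁺ f (Anyₗ.map (λ { refl → y∈ }) x∈)

-- Tables of the new relations on a small set

cellCount : {r : ℕ} → (Fin r → ℕ) → ℕ → List (Fin r) → ℕ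
cellCount arity u []       = 0
cellCount arity u (R ∷ Rs) = u ^ arity R + cellCount arity u Rs

tableBound : {r : ℕ} → (Fin r → ℕ) → ℕ → ℕ
tableBound arity u = 2 ^ cellCount arity u (allFin _)

module Tables (em : ExcludedMiddle 0ℓ) {r : ℕ} (arity : Fin r → ℕ) (A : Set) where

  private
    Exp : Set
    Exp = (R : Fin r) → Vec A (arity R) → Bool

  Cell : Set
  Cell = Σ[ R ∈ Fin r ] Vec A (arity R)

  row : List A → (R : Fin r) → List Cell
  row ys R = map (R ,_) (tuples ys (arity R))

  cells : List A → List (Fin r) → List Cell
  cells ys []       = []
  cells ys (R ∷ Rs) = row ys R ++ cells ys Rs

  ∈-cells : ∀ {ys Rs R xs} → R ∈ₗ Rs → All (_∈ₗ ys) xs → (R , xs) ∈ₗ cells ys Rs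
  ∈-cells (here refl) xs∈ = ∈ₗ.∈-++⁺ˡ (∈ₗ.∈-map⁺ _ (∈-tuples xs∈))
  ∈-cells {ys} {R′ ∷ _} (there R∈) xs∈ = ∈ₗ.∈-++⁺ʳ (row ys R′) (∈-cells R∈ xs∈)

  length-cells : ∀ {ys u} → length ys ≤ u → ∀ Rs → length (cells ys Rs) ≤ cellCount arity u Rs
  length-cells le []       = z≤n
  length-cells {ys} {u} le (R ∷ Rs) = subst (_≤ cellCount arity u (R ∷ Rs)) (sym (Listₚ.length-++ (row ys R)))
    (ℕₚ.+-mono-≤ (subst (_≤ u ^ arity R) (sym (trans (Listₚ.length-map {B = Cell} (R ,_) (tuples ys (arity R))) (length-tuples ys (arity R))))
                   (ℕₚ.^-monoˡ-≤ (arity R) le)) (length-cells {ys} le Rs))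

  private
    set : Cell → Bool → Exp → Exp
    set c b e R xs = if does (em {P = c ≡ (R , xs)}) then b else e R xs

    -- A cell listed twice does no harm: the outer setting overrides the inner one, and a given
    -- expansion prescribes the same value both times.
    tablesOn : List Cell → List Exp
    tablesOn []       = (λ _ _ → false) ∷ []
    tablesOn (c ∷ cs) = cartesianProductWith (set c) (true ∷ false ∷ []) (tablesOn cs)

    length-tablesOn : ∀ cs → length (tablesOn cs) ≡ 2 ^ length cs
    length-tablesOn []       = refl
    length-tablesOn (c ∷ cs) = trans (length-cartesianProductWith (set c) (true ∷ false ∷ []) (tablesOn cs))
                                     (cong (2 *_) (length-tablesOn cs))

    ∈-bools : ∀ b → b ∈ₗ (true ∷ false ∷ [])
    ∈-bools true  = here refl
    ∈-bools false = there (here refl)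

    tabulatedOn : ∀ (E : Exp) cs → ∃[ e ] e ∈ₗ tablesOn cs × (∀ R xs → (R , xs) ∈ₗ cs → E R xs ≡ e R xs)
    tabulatedOn E [] = _ , here refl , λ _ _ ()
    tabulatedOn E (c@(R₀ , xs₀) ∷ cs) with e , e∈ , eq ← tabulatedOn E cs =
      set c (E R₀ xs₀) e , ∈ₗ.∈-cartesianProductWith⁺ (set c) (∈-bools _) e∈ , agree
      where
        agree : ∀ R xs → (R , xs) ∈ₗ (c ∷ cs) → E R xs ≡ set c (E R₀ xs₀) e R xs
        agree R xs c∈ with em {P = c ≡ (R , xs)}
        ... | yes refl = refl
        ... | no ne with c∈
        ...   | here refl = contradiction refl ne
        ...   | there c∈′ = eq R xs c∈′

  tables : List A → List Exp
  tables ys = tablesOn (cells ys (allFin r))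

  length-tables : ∀ {ys u} → length ys ≤ u → length (tables ys) ≤ tableBound arity u
  length-tables {ys} {u} le = subst (_≤ tableBound arity u) (sym (length-tablesOn (cells ys (allFin r))))
    (ℕₚ.^-monoʳ-≤ 2 (length-cells {ys} le (allFin r)))

  tabulated : ∀ ys (E : Exp) → ∃[ e ] e ∈ₗ tables ys × (∀ R xs → All (_∈ₗ ys) xs → E R xs ≡ e R xs)
  tabulated ys E with e , e∈ , eq ← tabulatedOn E (cells ys (allFin r)) =
    e , e∈ , λ R xs xs∈ → eq R xs (∈-cells (∈ₗ.∈-allFin R) xs∈)

-- A single extension problem in `𝓖 n` and its failure probability

module Events (em : ExcludedMiddle 0ℓ) (𝐒 : Setting) where
  open Setting 𝐒
  open Decay em 𝐒 public

  extendExp : ∀ {n} (W : CS n) → Expansion (InG.El W) → Exp n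
  extendExp W E R xs with All.all? (λ x → T? (InClass.ClosedSub.mem W x)) xs
  ... | yes ps = E R (liftEl xs ps)
  ... | no  _  = false

  extendExp-El : ∀ {n} (W : CS n) (E : Expansion (InG.El W)) R ys → extendExp W E R (Vec.map proj₁ ys) ≡ E R ys
  extendExp-El W E R ys with All.all? (λ x → T? (InClass.ClosedSub.mem W x)) (Vec.map proj₁ ys)
  ... | yes ps = cong (E R) (liftEl-map ys ps)
  ... | no ¬ps = contradiction (all-El ys) ¬ps

  strOn-iso : ∀ {n} (W : CS n) (F : Exp n) {B : Set} {N : Structure V B} (τ : Iso (𝓖 n InG.↾ W) (reduct N)) →
              (∀ R ys → F R (Vec.map proj₁ ys) ≡ rel N (inj₂ R) (Vec.map (Iso.to τ) ys)) → Iso (strOn W F) N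
  strOn-iso W F τ eq = record
    { bijection = Iso.bijection τ ; fun-pres = Iso.fun-pres τ
    ; rel-pres = λ { (inj₁ R) ys → Iso.rel-pres τ R ys ; (inj₂ R) ys → eq R ys } }

  restrict-cong : {A : Set} {M N : Structure V A} (S : InK.ClosedSub M) (S′ : InK.ClosedSub N) →
                  InK.⟦ S ⟧ ⊆ InK.⟦ S′ ⟧ → InK.⟦ S′ ⟧ ⊆ InK.⟦ S ⟧ → AgreeOn InK.⟦ S ⟧ M N → Iso (M InK.↾ S) (N InK.↾ S′)
  restrict-cong {M = M} {N} S S′ f g (funs , rels) = record
    { bijection = mk↔ₛ′ h (λ (x , p) → x , g p) (λ _ → El-≡ refl) (λ _ → El-≡ refl)
    ; fun-pres = λ φ xs → El-≡ (trans (funs φ _ (all-El xs)) (cong (fun N φ) (map-h xs)))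
    ; rel-pres = λ R xs → trans (rels R _ (all-El xs)) (cong (rel N R) (map-h xs)) }
    where
      h : InK.El S → InK.El S′
      h (x , p) = x , f p
      map-h : ∀ {m} (xs : Vec (InK.El S) m) → Vec.map proj₁ xs ≡ Vec.map proj₁ (Vec.map h xs)
      map-h []       = refl
      map-h (x ∷ xs) = cong (proj₁ x ∷_) (map-h xs)

  prob? : ∀ {n} → Pred (Exp n) 0ℓ → Exp n → ℚ
  prob? Q E = ⟦ em {P = Q E} ⟧?

  Pr : ∀ n → Pred (Exp n) 0ℓ → ℚ
  Pr n Q = ∑ (λ E → δ n E ℚ.* prob? Q E) (deduplicate _≋?_ (𝓚 n))

  -- The multiplicity clause of polynomial `k`-saturation at one structure `𝓖 n`, with `l` in the
  -- role of its lower bound.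
  Saturated : ℕ → ℕ → ℕ → Set₁
  Saturated k n l = ∀ (p : InG.ClosedPair) → let open InG.ClosedPair p in
    ∀ d → HasDim (InG.cl N) InG.⟦ A ⟧ d → HasDim (InG.cl N) InG.⟦ B ⟧ (suc d) →
    suc d ≤ k → InG.MultiplicityAtLeast p (𝓖 n) l

  module Counting {k : ℕ} (accepts : AcceptsSubstitutions k) (ub : UniformlyBounded) where

    private
      u = proj₁ ub

    -- The bounding function `u` may fail to be monotone; its maximum up to `k` yields one table
    -- count for all dimensions in question.
    maxUpTo : (ℕ → ℕ) → ℕ → ℕ
    maxUpTo f zero    = f 0
    maxUpTo f (suc m) = f (suc m) ⊔ maxUpTo f m

    ≤-maxUpTo : ∀ f {d m} → d ≤ m → f d ≤ maxUpTo f m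
    ≤-maxUpTo f {d} {zero}  z≤n = ℕₚ.≤-refl
    ≤-maxUpTo f {d} {suc m} d≤ with ℕₚ.m≤n⇒m<n∨m≡n d≤
    ... | inj₁ (s≤s d≤m) = ℕₚ.≤-trans (≤-maxUpTo f d≤m) (ℕₚ.m≤n⊔m (f (suc m)) _)
    ... | inj₂ refl      = ℕₚ.m≤m⊔n (f (suc m)) _

    tableCount : ℕ
    tableCount = tableBound arity (maxUpTo u k)

    tableCount≢0 : tableCount ≢ 0
    tableCount≢0 = ℕₚ.>⇒≢ (ℕₚ.m^n>0 2 (cellCount arity (maxUpTo u k) (allFin r)))

    record TablesOn {n : ℕ} (X : Pred (Fin (size n)) 0ℓ) : Set where
      field
        list      : List (Exp n)
        few       : length list ≤ tableCount
        tabulated : ∀ (E : Exp n) → ∃[ e ] e ∈ₗ list × (∀ R xs → All X xs → E R xs ≡ e R xs)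

    tablesOn : ∀ {n} {X : Pred (Fin (size n)) 0ℓ} {w} → HasDim (clG n) X w → w ≤ k → TablesOn X
    tablesOn {n} {X} {w} h w≤k with ys , len , cl⊆ys ← proj₂ ub n X w h = record
      { list      = Tables.tables em arity (Fin (size n)) ys
      ; few       = Tables.length-tables em arity (Fin (size n)) (ℕₚ.≤-trans len (≤-maxUpTo u w≤k))
      ; tabulated = λ E → case Tables.tabulated em arity (Fin (size n)) ys E of λ { (e , e∈ , eq) →
          e , e∈ , λ R xs Xxs → eq R xs (All.map (λ Xx → cl⊆ys (Pre.extensive n X Xx)) Xxs) } }

    -- An extension problem by one dimension posed inside `𝓖 n`: the extension lives on `B₁`, with
    -- its new relations read off from `T₁`.
    record Situation (n : ℕ) (A′ B₁ : CS n) (T₁ : Exp n) : Set where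
      field
        {dim}       : ℕ
        A′⊆B₁       : ∣ A′ ∣ₛ ⊆ ∣ B₁ ∣ₛ
        dimA′       : HasDim (clG n) ∣ A′ ∣ₛ dim
        dimB₁       : HasDim (clG n) ∣ B₁ ∣ₛ (suc dim)
        dim<k       : suc dim ≤ k
        represented : InK.Represented (strOn B₁ T₁)

    Copies : ∀ n → ℕ → (A′ B₁ : CS n) (T₁ M : Exp n) → Set
    Copies n μ A′ B₁ T₁ M =
      Σ[ Cs ∈ (Fin μ → CS n) ] Σ[ f ∈ (∀ j → Iso (strOn (Cs j) M) (strOn B₁ T₁)) ]
        (∀ j → ∣ A′ ∣ₛ ⊆ ∣ Cs j ∣ₛ)
      × (∀ j x → ∣ A′ ∣ₛ x → (x∈C : ∣ Cs j ∣ₛ x) → proj₁ (Iso.to (f j) (x , x∈C)) ≡ x)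
      × (∀ i j → i ≢ j → ∀ x → ∣ Cs i ∣ₛ x → ∣ Cs j ∣ₛ x → ∣ A′ ∣ₛ x)

    -- `Situation` is part of the event, so a triple that poses no genuine extension problem has
    -- probability `0` and the union bound may range over all listed triples.
    Bad : ∀ n → ℕ → (A′ B₁ : CS n) (T₁ : Exp n) → Pred (Exp n) 0ℓ
    Bad n μ A′ B₁ T₁ M = Situation n A′ B₁ T₁ × (∀ R xs → All ∣ A′ ∣ₛ xs → M R xs ≡ T₁ R xs) × ¬ Copies n μ A′ B₁ T₁ M

    rate : ℚ
    rate = 1ℚ ℚ.- recip tableCount ^ℚ ρ

    module _ {n l μ : ℕ} (saturated : Saturated k n l) (μμ≤l : μ * μ ≤ l)
             {A′ B₁ : CS n} {T₁ : Exp n} (sit : Situation n A′ B₁ T₁) where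
      open Situation sit

      private
        pair : InG.ClosedPair
        pair = record { N = 𝓖 n ; represented = 𝓖-represented n ; A = A′ ; B = B₁
                      ; A⊂B = A′⊆B₁ , λ B₁⊆A′ → ℕₚ.<⇒≱ ℕₚ.≤-refl
                          (Pre.dim-mono n dimB₁ dimA′ (λ p → Pre.extensive n _ (B₁⊆A′ p))) }

        -- Taking the identity of `A′` as the given isomorphism makes every copy correspond to `B₁`
        -- by a map that fixes `A′` pointwise.
        copies = saturated pair dim (HasDim-𝓖 dimA′) (HasDim-𝓖 dimB₁) dim<k A′ iso-refl

        Ws : Fin l → CS n
        Ws = proj₁ copies

        τ : ∀ i → Iso (𝓖 n InG.↾ Ws i) (𝓖 n InG.↾ B₁)
        τ = proj₁ (proj₂ copies)

        A′⊆Ws : ∀ i → ∣ A′ ∣ₛ ⊆ ∣ Ws i ∣ₛ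
        A′⊆Ws = proj₁ (proj₂ (proj₂ copies))

        τ-fixes : ∀ i x → ∣ A′ ∣ₛ x → (x∈W : ∣ Ws i ∣ₛ x) → proj₁ (Iso.to (τ i) (x , x∈W)) ≡ x
        τ-fixes i x x∈A′ x∈W = proj₁ (proj₂ (proj₂ (proj₂ copies))) i x x∈A′ x∈W

        Ws-disjoint : ∀ i j → i ≢ j → ∀ x → ∣ Ws i ∣ₛ x → ∣ Ws j ∣ₛ x → ∣ A′ ∣ₛ x
        Ws-disjoint = proj₂ (proj₂ (proj₂ (proj₂ copies)))

        F₁ : ∀ i → Expansion (InG.El (Ws i))
        F₁ i R ys = T₁ R (Vec.map proj₁ (Vec.map (Iso.to (τ i)) ys))

        target-of : Fin l → Target n
        target-of i = target (Ws i) (extendExp (Ws i) (F₁ i))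

        map-τ-fixes : ∀ i {m} (xs : Vec (Fin (size n)) m) (ps : All ∣ Ws i ∣ₛ xs) → All ∣ A′ ∣ₛ xs →
                      Vec.map proj₁ (Vec.map (Iso.to (τ i)) (liftEl xs ps)) ≡ xs
        map-τ-fixes i []       []       []       = refl
        map-τ-fixes i (x ∷ xs) (p ∷ ps) (a ∷ as) = cong₂ _∷_ (τ-fixes i x a p) (map-τ-fixes i xs ps as)

        A′-closed : Closed (clG n) ∣ A′ ∣ₛ
        A′-closed = closed-clG A′

        isTarget : ∀ i → IsTarget accepts tableCount tableCount≢0 ∣ A′ ∣ₛ A′-closed T₁ (target-of i)
        isTarget i = record
          { hasDim      = dimW
          ; dim≤k       = dim<k
          ; represented = represented-resp (strOn-iso (Ws i) _ (τ i) (extendExp-El (Ws i) (F₁ i))) represented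
          ; A′⊆W        = A′⊆Ws i
          ; agree       = λ R xs as → let ps = All.map (A′⊆Ws i) as in
              trans (cong (extendExp (Ws i) (F₁ i) R) (sym (map-liftEl xs ps)))
              (trans (extendExp-El (Ws i) (F₁ i) R (liftEl xs ps)) (cong (T₁ R) (map-τ-fixes i xs ps as)))
          ; tables      = TablesOn.list (tablesOn dimW dim<k)
          ; few-tables  = TablesOn.few (tablesOn dimW dim<k)
          ; tabulated   = TablesOn.tabulated (tablesOn dimW dim<k)
          }
          where
            dimW : HasDim (clG n) ∣ Ws i ∣ₛ (suc dim)
            dimW = HasDim-𝓖⁻ (HasDim-iso (𝓖-represented n) (𝓖-represented n) B₁ (Ws i) (iso-sym (τ i)) (HasDim-𝓖 dimB₁))

        -- Copy `i` of group `j`. Injectivity in `i` makes the members of a group disjoint over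
        -- `A′`; injectivity in `j` does the same for representatives of different groups.
        index : Fin μ → Fin μ → Fin l
        index j i = Fin.inject≤ (Fin.combine j i) μμ≤l

        index-injectiveˡ : ∀ {j i j′ i′} → index j i ≡ index j′ i′ → j ≡ j′
        index-injectiveˡ {j} {i} {j′} {i′} eq = Finₚ.combine-injectiveˡ j i j′ i′ (Finₚ.inject≤-injective μμ≤l μμ≤l _ _ eq)

        index-injectiveʳ : ∀ {j i j′ i′} → index j i ≡ index j′ i′ → i ≡ i′
        index-injectiveʳ {j} {i} {j′} {i′} eq = Finₚ.combine-injectiveʳ j i j′ i′ (Finₚ.inject≤-injective μμ≤l μμ≤l _ _ eq)

        group : Fin μ → List (Target n)
        group j = List.tabulate (λ i → target-of (index j i))

        lost : Fin μ → Exp n → ℚ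
        lost j = survival accepts tableCount tableCount≢0 ∣ A′ ∣ₛ A′-closed T₁ ρ 1ℚ (group j)

        lost-≥0 : ∀ j E → 0ℚ ℚ.≤ lost j E
        lost-≥0 j = survival-≥0 accepts tableCount tableCount≢0 ∣ A′ ∣ₛ A′-closed T₁ {ts = group j} 0≤1 ℚₚ.≤-refl

        lost-decay : ∀ j → 𝔼 n ρ (lost j) ℚ.≤ rate ^ℚ μ
        lost-decay j = subst (λ m → 𝔼 n ρ (lost j) ℚ.≤ rate ^ℚ m) (Listₚ.length-tabulate (λ i → target-of (index j i)))
          (𝔼-decay accepts tableCount tableCount≢0 ∣ A′ ∣ₛ A′-closed T₁ (group j)
            (Allₗₚ.tabulate⁺ (λ i → isTarget (index j i)))
            (AllPairsₚ.tabulate⁺ (λ i≢i′ {x} → Ws-disjoint _ _ (λ eq → i≢i′ (index-injectiveʳ eq)) x)))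

        alive⇒copies : ∀ {E} → (∀ j → ∃[ i ] Alive ρ (target-of (index j i)) E) → Copies n μ A′ B₁ T₁ E
        alive⇒copies {E} alive = (λ j → Ws (idx j))
          , (λ j → strOn-iso (Ws (idx j)) E (τ (idx j)) λ R ys →
              trans (proj₂ (alive j) R _ (all-El ys) (dimTo-ρ R _)) (extendExp-El (Ws (idx j)) (F₁ (idx j)) R ys))
          , (λ j → A′⊆Ws (idx j)) , (λ j → τ-fixes (idx j))
          , λ i j i≢j → Ws-disjoint (idx i) (idx j) (λ eq → i≢j (index-injectiveˡ eq))
          where
            idx : Fin μ → Fin l
            idx j = index j (proj₁ (alive j))

        bad⇒lost : ∀ {E} → Bad n μ A′ B₁ T₁ E → ∃[ j ] lost j E ≡ 1ℚ
        bad⇒lost {E} (_ , agree , ¬copies) = by-cases (∃[ j ] ∀ i → ¬ Alive ρ (target-of (index j i)) E)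
          (λ (j , dead) → j , trans
            (cong₂ ℚ._*_ (⟦⟧?-yes (base? accepts tableCount tableCount≢0 ∣ A′ ∣ₛ A′-closed T₁ ρ E) (λ R xs as _ → agree R xs as))
              (trans (∏-cong {g = λ _ → 1ℚ} (group j) (λ t t∈ → case ∈ₗ.∈-tabulate⁻ t∈ of λ { (i , refl) →
                  factor-dead accepts tableCount tableCount≢0 ∣ A′ ∣ₛ A′-closed T₁ {p = 1ℚ} {M = E} {t = target-of (index j i)} (dead i) }))
                (trans (∏-const 1ℚ (group j)) (1^ℚ (length (group j))))))
            (ℚₚ.*-identityʳ 1ℚ))
          (λ ¬lost → contradiction (alive⇒copies λ j → decidable-stable em λ ¬alive →
            ¬lost (j , λ i a → ¬alive (i , a))) ¬copies)

      -- A bad structure has some group with `lost j E` equal to `1`, so its indicator is at most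
      -- the sum of these weights over the `μ` groups, each of expectation at most `rate ^ℚ μ`.
      Pr-Bad-situation : Pr n (Bad n μ A′ B₁ T₁) ℚ.≤ fromℕ μ ℚ.* rate ^ℚ μ
      Pr-Bad-situation = begin
        Pr n (Bad n μ A′ B₁ T₁)                                   ≤⟨ ∑-mono D (λ E _ → *-monoʳ-≤ (ℙ-≥0 n ρ E) (bad≤ E)) ⟩
        ∑ (λ E → δ n E ℚ.* ∑ (λ j → lost j E) (allFin μ)) D        ≡⟨ ∑-cong D (λ E _ → sym (∑-*ˡ (δ n E) (λ j → lost j E) (allFin μ))) ⟩
        ∑ (λ E → ∑ (λ j → δ n E ℚ.* lost j E) (allFin μ)) D        ≡⟨ ∑-swap (λ E j → δ n E ℚ.* lost j E) D (allFin μ) ⟩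
        ∑ (λ j → ∑ (λ E → δ n E ℚ.* lost j E) D) (allFin μ)        ≡⟨ ∑-cong (allFin μ) (λ j _ → ∑-δ n (lost j) (lost-≥0 j) (lost-resp j)) ⟩
        ∑ (λ j → 𝔼 n ρ (lost j)) (allFin μ)                        ≤⟨ ∑-bound (allFin μ) (λ j _ → lost-decay j) ⟩
        fromℕ (length (allFin μ)) ℚ.* rate ^ℚ μ                    ≡⟨ cong (λ m → fromℕ m ℚ.* rate ^ℚ μ) (Listₚ.length-tabulate {n = μ} id) ⟩
        fromℕ μ ℚ.* rate ^ℚ μ                                      ∎
        where
          open ℚₚ.≤-Reasoning
          D = deduplicate _≋?_ (𝓚 n)
          lost-resp : ∀ j {M N} → M ≋ N → lost j M ≡ lost j N
          lost-resp j {M} {N} eq = survival-resp accepts tableCount tableCount≢0 ∣ A′ ∣ₛ A′-closed T₁ {p = 1ℚ} {ts = group j} {M} {N} (λ R xs _ → eq R xs)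
          bad≤ : ∀ E → prob? (Bad n μ A′ B₁ T₁) E ℚ.≤ ∑ (λ j → lost j E) (allFin μ)
          bad≤ E = by-cases (Bad n μ A′ B₁ T₁ E)
            (λ bad → case bad⇒lost {E} bad of λ { (j , eq) →
              ℚₚ.≤-trans (⟦⟧?-≤1 em) (subst (ℚ._≤ ∑ (λ j → lost j E) (allFin μ)) eq
                (term≤∑ {f = λ j → lost j E} (λ j → lost-≥0 j E) (∈ₗ.∈-allFin j))) })
            (λ ¬bad → subst (ℚ._≤ ∑ (λ j → lost j E) (allFin μ)) (sym (⟦⟧?-no em ¬bad)) (∑-≥0 (allFin μ) (λ j → lost-≥0 j E)))

    rate-≥0 : 0ℚ ℚ.≤ rate
    rate-≥0 = p≤q⇒0≤q-p (subst (recip tableCount ^ℚ ρ ℚ.≤_) (1^ℚ ρ) (^ℚ-mono ρ (recip-≥0 tableCount) (recip-≤1 tableCount≢0)))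

    Pr-Bad : ∀ {n l μ} → Saturated k n l → μ * μ ≤ l → ∀ A′ B₁ T₁ → Pr n (Bad n μ A′ B₁ T₁) ℚ.≤ fromℕ μ ℚ.* rate ^ℚ μ
    Pr-Bad {n} {l} {μ} sat μμ≤l A′ B₁ T₁ = by-cases (Situation n A′ B₁ T₁) (Pr-Bad-situation sat μμ≤l)
      (λ ¬sit → subst (ℚ._≤ fromℕ μ ℚ.* rate ^ℚ μ)
        (sym (trans (∑-cong D (λ E _ → trans (cong (δ n E ℚ.*_) (⟦⟧?-no em (λ bad → ¬sit (proj₁ bad)))) (ℚₚ.*-zeroʳ (δ n E)))) (∑-0 D)))
        (*-≥0 (fromℕ-≥0 μ) (^ℚ-≥0 μ rate-≥0)))
      where D = deduplicate _≋?_ (𝓚 n)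

-- The union bound over concrete extension problems

module Extension (em : ExcludedMiddle 0ℓ) (𝐒 : Setting) {k : ℕ} (accepts : Setting.AcceptsSubstitutions 𝐒 k)
                 (ub : Setting.UniformlyBounded 𝐒) where
  open Setting 𝐒
  open Events em 𝐒 public
  open Counting accepts ub public

  closureCS : ∀ n → Pred (Fin (size n)) 0ℓ → CS n
  closureCS n X = proj₁ (closure-CS n X)

  -- Empty unless `X` has dimension `w` and `w ≤ k`. The length is thus bounded for every `X`, and
  -- triples can be counted without asking whether the chosen points are independent.
  tableList : ∀ {n} → Pred (Fin (size n)) 0ℓ → ℕ → List (Exp n)
  tableList {n} X w with em {P = HasDim (clG n) X w × w ≤ k}
  ... | yes (h , w≤k) = TablesOn.list (tablesOn h w≤k)
  ... | no  _         = []

  length-tableList : ∀ {n} (X : Pred (Fin (size n)) 0ℓ) w → length (tableList X w) ≤ tableCount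
  length-tableList {n} X w with em {P = HasDim (clG n) X w × w ≤ k}
  ... | yes (h , w≤k) = TablesOn.few (tablesOn h w≤k)
  ... | no  _         = z≤n

  tableList-tabulated : ∀ {n} {X : Pred (Fin (size n)) 0ℓ} {w} → HasDim (clG n) X w → w ≤ k → ∀ (E : Exp n) →
                        ∃[ e ] e ∈ₗ tableList X w × (∀ R xs → All X xs → E R xs ≡ e R xs)
  tableList-tabulated {n} {X} {w} h w≤k with em {P = HasDim (clG n) X w × w ≤ k}
  ... | yes (h′ , w≤k′) = TablesOn.tabulated (tablesOn h′ w≤k′)
  ... | no ¬p           = contradiction (h , w≤k) ¬p

  Triple : ℕ → Set
  Triple n = CS n × CS n × Exp n

  triplesAt : ∀ n a → Vec (Fin (size n)) a → Fin (size n) → List (Triple n)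
  triplesAt n a as b = map (λ T₁ → closureCS n (_∈ as) , closureCS n (_∈ (b ∷ as)) , T₁)
                           (tableList ∣ closureCS n (_∈ (b ∷ as)) ∣ₛ (suc a))

  triplesOfDim : ∀ n → Fin k → List (Triple n)
  triplesOfDim n i = concatMap (λ as → concatMap (triplesAt n (Fin.toℕ i) as) (allFin (size n))) (tuples (allFin (size n)) (Fin.toℕ i))

  triples : ∀ n → List (Triple n)
  triples n = concatMap (triplesOfDim n) (allFin k)

  -- The base `suc (size n)` keeps the power monotone in the exponent even when the universe is
  -- empty, so that all dimensions below `k` obey one bound.
  length-triples : ∀ n → length (triples n) ≤ k * (suc (size n) ^ k * tableCount)
  length-triples n = subst (λ m → length (triples n) ≤ m * (suc s ^ k * tableCount)) (Listₚ.length-tabulate {n = k} id)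
    (length-concatMap-≤ (triplesOfDim n) (suc s ^ k * tableCount) (allFin k) λ i →
      ℕₚ.≤-trans (length-concatMap-≤ (λ as → concatMap (triplesAt n (Fin.toℕ i) as) (allFin s)) (s * tableCount) (tuples (allFin s) (Fin.toℕ i)) λ as →
        subst (λ m → length (concatMap (triplesAt n (Fin.toℕ i) as) (allFin s)) ≤ m * tableCount) (Listₚ.length-tabulate {n = s} id)
          (length-concatMap-≤ (triplesAt n (Fin.toℕ i) as) tableCount (allFin s) λ b →
            subst (_≤ tableCount) (sym (Listₚ.length-map _ (tableList ∣ closureCS n (_∈ (b ∷ as)) ∣ₛ (suc (Fin.toℕ i))))) (length-tableList _ (suc (Fin.toℕ i)))))
        (count (Fin.toℕ i) (Finₚ.toℕ<n i)))
    where
      s = size n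
      count : ∀ a → a < k → length (tuples (allFin s) a) * (s * tableCount) ≤ suc s ^ k * tableCount
      count a a<k = begin
        length (tuples (allFin s) a) * (s * tableCount)  ≡⟨ cong (_* (s * tableCount)) (trans (length-tuples (allFin s) a) (cong (_^ a) (Listₚ.length-tabulate {n = s} id))) ⟩
        s ^ a * (s * tableCount)                         ≡⟨ sym (ℕₚ.*-assoc (s ^ a) s tableCount) ⟩
        s ^ a * s * tableCount                           ≡⟨ cong (_* tableCount) (ℕₚ.*-comm (s ^ a) s) ⟩
        s ^ suc a * tableCount                           ≤⟨ ℕₚ.*-monoˡ-≤ tableCount (ℕₚ.≤-trans (ℕₚ.^-monoˡ-≤ (suc a) (ℕₚ.n≤1+n s)) (ℕₚ.^-monoʳ-≤ (suc s) a<k)) ⟩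
        suc s ^ k * tableCount                           ∎
        where open ℕₚ.≤-Reasoning

  BadAt : ∀ n → ℕ → Triple n → Pred (Exp n) 0ℓ
  BadAt n μ (A′ , B₁ , T₁) = Bad n μ A′ B₁ T₁

  SomeBad : ∀ n → ℕ → Pred (Exp n) 0ℓ
  SomeBad n μ M = ∃[ γ ] γ ∈ₗ triples n × BadAt n μ γ M

  Pr-SomeBad : ∀ {n l μ} → Saturated k n l → μ * μ ≤ l →
               Pr n (SomeBad n μ) ℚ.≤ fromℕ (length (triples n)) ℚ.* (fromℕ μ ℚ.* rate ^ℚ μ)
  Pr-SomeBad {n} {l} {μ} sat μμ≤l = begin
    Pr n (SomeBad n μ)                                                              ≤⟨ ∑-mono D (λ E _ → *-monoʳ-≤ (ℙ-≥0 n ρ E) (some≤ E)) ⟩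
    ∑ (λ E → δ n E ℚ.* ∑ (λ γ → prob? (BadAt n μ γ) E) (triples n)) D                ≡⟨ ∑-cong D (λ E _ → sym (∑-*ˡ (δ n E) (λ γ → prob? (BadAt n μ γ) E) (triples n))) ⟩
    ∑ (λ E → ∑ (λ γ → δ n E ℚ.* prob? (BadAt n μ γ) E) (triples n)) D                ≡⟨ ∑-swap (λ E γ → δ n E ℚ.* prob? (BadAt n μ γ) E) D (triples n) ⟩
    ∑ (λ γ → Pr n (BadAt n μ γ)) (triples n)                                        ≤⟨ ∑-bound (triples n) (λ (A′ , B₁ , T₁) _ → Pr-Bad sat μμ≤l A′ B₁ T₁) ⟩
    fromℕ (length (triples n)) ℚ.* (fromℕ μ ℚ.* rate ^ℚ μ)                           ∎
    where
      open ℚₚ.≤-Reasoning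
      D = deduplicate _≋?_ (𝓚 n)
      some≤ : ∀ E → prob? (SomeBad n μ) E ℚ.≤ ∑ (λ γ → prob? (BadAt n μ γ) E) (triples n)
      some≤ E = by-cases (SomeBad n μ E)
        (λ { (γ , γ∈ , bad) → ℚₚ.≤-trans (⟦⟧?-≤1 em) (subst (ℚ._≤ ∑ (λ γ → prob? (BadAt n μ γ) E) (triples n)) (⟦⟧?-yes em bad)
               (term≤∑ {f = λ γ → prob? (BadAt n μ γ) E} (λ γ → ⟦⟧?-≥0 em) γ∈)) })
        (λ ¬some → subst (ℚ._≤ ∑ (λ γ → prob? (BadAt n μ γ) E) (triples n)) (sym (⟦⟧?-no em ¬some)) (∑-≥0 (triples n) (λ γ → ⟦⟧?-≥0 em)))

  -- Closed sets are Boolean functions carrying proofs, so a listed triple matches a given one only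
  -- in membership and in the values on `B″`.
  record Listed {n : ℕ} (A′ B₁ : CS n) (T₀ : Exp n) : Set where
    field
      A″ B″  : CS n
      T″     : Exp n
      listed : (A″ , B″ , T″) ∈ₗ triples n
      A″⊆A′  : ∣ A″ ∣ₛ ⊆ ∣ A′ ∣ₛ
      A′⊆A″  : ∣ A′ ∣ₛ ⊆ ∣ A″ ∣ₛ
      B″⊆B₁  : ∣ B″ ∣ₛ ⊆ ∣ B₁ ∣ₛ
      B₁⊆B″  : ∣ B₁ ∣ₛ ⊆ ∣ B″ ∣ₛ
      agree  : ∀ R xs → All ∣ B″ ∣ₛ xs → T″ R xs ≡ T₀ R xs

  ∈-triples : ∀ {n a} → a < k → (as : Vec (Fin (size n)) a) (b : Fin (size n)) → ∀ {T₁} →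
    T₁ ∈ₗ tableList ∣ closureCS n (_∈ (b ∷ as)) ∣ₛ (suc a) → (closureCS n (_∈ as) , closureCS n (_∈ (b ∷ as)) , T₁) ∈ₗ triples n
  ∈-triples {n} {a} a<k as b {T₁} T∈ = ∈-concatMap (triplesOfDim n) (∈ₗ.∈-allFin (Fin.fromℕ< a<k))
    (at (Fin.toℕ (Fin.fromℕ< a<k)) (Finₚ.toℕ-fromℕ< a<k))
    where
      at : ∀ a′ → a′ ≡ a → (closureCS n (_∈ as) , closureCS n (_∈ (b ∷ as)) , T₁) ∈ₗ
           concatMap (λ as → concatMap (triplesAt n a′ as) (allFin (size n))) (tuples (allFin (size n)) a′)
      at _ refl = ∈-concatMap (λ as → concatMap (triplesAt n a as) (allFin (size n))) (∈-tuples-allFin as)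
        (∈-concatMap (triplesAt n a as) (∈ₗ.∈-allFin b) (∈ₗ.∈-map⁺ _ T∈))

  -- As the dimensions differ, some `b` in `B₁` lies outside `A′`. Together with a basis of `A′` it
  -- is an independent tuple of the length of a basis of `B₁`, hence spans `B₁`.
  listing′ : ∀ {n} {A′ B₁ : CS n} {T₀ : Exp n} → Situation n A′ B₁ T₀ → Listed A′ B₁ T₀
  listing′ {n} {A′} {B₁} {T₀} sit = by-cases (∃[ b ] ∣ B₁ ∣ₛ b × ¬ ∣ A′ ∣ₛ b) found
      (λ none → contradiction (Pre.dim-mono n dimB₁ dimA′ (λ {x} p → Pre.extensive n _ (decidable-stable em (λ ¬A → none (x , p , ¬A)))))
                              (ℕₚ.<⇒≱ ℕₚ.≤-refl))
    where
      open Situation sit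
      as = proj₁ dimA′
      A′as = proj₁ (proj₂ dimA′)
      ind = proj₁ (proj₂ (proj₂ dimA′))
      span = proj₂ (proj₂ (proj₂ dimA′))
      found : (∃[ b ] ∣ B₁ ∣ₛ b × ¬ ∣ A′ ∣ₛ b) → Listed A′ B₁ T₀
      found (b , b∈B₁ , b∉A′) = record
        { A″ = closureCS n (_∈ as) ; B″ = B″ ; T″ = proj₁ tab
        ; listed = ∈-triples dim<k as b (proj₁ (proj₂ tab))
        ; A″⊆A′ = λ p → closed-clG A′ (Pre.monotone n (All⇒⊆ A′as) (proj₂ (proj₂ (closure-CS n (_∈ as))) p))
        ; A′⊆A″ = λ p → proj₁ (proj₂ (closure-CS n (_∈ as))) (span p)
        ; B″⊆B₁ = B″⊆B₁
        ; B₁⊆B″ = B₁⊆B″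
        ; agree = λ R xs Bxs → sym (proj₂ (proj₂ tab) R xs Bxs)
        }
        where
          B″ = closureCS n (_∈ (b ∷ as))
          B″⊆B₁ : ∣ B″ ∣ₛ ⊆ ∣ B₁ ∣ₛ
          B″⊆B₁ p = closed-clG B₁ (Pre.monotone n (All⇒⊆ (b∈B₁ ∷ All.map A′⊆B₁ A′as)) (proj₂ (proj₂ (closure-CS n (_∈ (b ∷ as)))) p))
          B₁⊆B″ : ∣ B₁ ∣ₛ ⊆ ∣ B″ ∣ₛ
          B₁⊆B″ p = proj₁ (proj₂ (closure-CS n (_∈ (b ∷ as)))) (Pre.spans-of-dim n dimB₁ (b ∷ as) (b∈B₁ ∷ All.map A′⊆B₁ A′as)
            (Pre.independent-∷ n ind (λ c → b∉A′ (closed-clG A′ (Pre.monotone n (All⇒⊆ A′as) c)))) p)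
          tab = tableList-tabulated (HasDim-resp {cl = clG n} B₁⊆B″ B″⊆B₁ dimB₁) dim<k T₀

  abstract
    listing : ∀ {n} {A′ B₁ : CS n} {T₀ : Exp n} → Situation n A′ B₁ T₀ → Listed A′ B₁ T₀
    listing = listing′

-- From the absence of bad triples to multiplicities and extension axioms

module Saturation (em : ExcludedMiddle 0ℓ) (𝐒 : Setting) {k : ℕ} (accepts : Setting.AcceptsSubstitutions 𝐒 k)
                  (ub : Setting.UniformlyBounded 𝐒) where
  open Setting 𝐒
  open Extension em 𝐒 accepts ub public

  OneStep : ∀ {n} → ℕ → Exp n → Set₁
  OneStep μ M = ∀ (p : InK.ClosedPair) → let open InK.ClosedPair p in
    ∀ d → HasDim (InK.cl N) InK.⟦ A ⟧ d → HasDim (InK.cl N) InK.⟦ B ⟧ (suc d) →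
    suc d ≤ k → InK.MultiplicityAtLeast p (Struct M) μ

  module _ {n l μ : ℕ} {M : Exp n} (saturated : Saturated k n l) (1≤l : 1 ≤ l) (M∈ : M ∈ₗ 𝓚 n) (good : ¬ SomeBad n μ M)
           (p : InK.ClosedPair) where
    open InK.ClosedPair p
    private module K = InClass.ClosedSub

    private
      repN = reduct-represented represented

    -- The problem posed by `N` is moved into `𝓖 n`: saturation provides a copy `B₁` of `B` over
    -- `A′`, to which the relations of `N` are pulled back. The triple so obtained is listed, and as
    -- it is not bad, `M` contains the required copies of it. A single copy `i₀` in `𝓖 n` is enough
    -- to locate the triple.
    one-step-at : ∀ d → HasDim (InK.cl N) InK.⟦ A ⟧ d → HasDim (InK.cl N) InK.⟦ B ⟧ (suc d) →
                  suc d ≤ k → InK.MultiplicityAtLeast p (Struct M) μ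
    one-step-at d dimA dimB d<k A′K σ = from-copies (decidable-stable em (λ ¬copies → good
        ((A″ , B″ , T″) , listed , (situation″ , agree-A″ , ¬copies))))
      where
        A′ : CS n
        A′ = down (Struct M) A′K

        σ₀ : Iso (𝓖 n InG.↾ A′) (reduct N InG.↾ down N A)
        σ₀ = reduct-iso σ

        pair : InG.ClosedPair
        pair = record { N = reduct N ; represented = repN ; A = down N A ; B = down N B ; A⊂B = A⊂B }

        copy = saturated pair d (HasDim-K⁻ N dimA) (HasDim-K⁻ N dimB) d<k A′ σ₀
        i₀ = Fin.fromℕ< 1≤l

        B₁ : CS n
        B₁ = proj₁ copy i₀

        τ : Iso (𝓖 n InG.↾ B₁) (reduct (N InK.↾ B))
        τ = proj₁ (proj₂ copy) i₀

        A′⊆B₁ : ∣ A′ ∣ₛ ⊆ ∣ B₁ ∣ₛ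
        A′⊆B₁ = proj₁ (proj₂ (proj₂ copy)) i₀

        τ-extends : ∀ x (x∈A′ : ∣ A′ ∣ₛ x) (x∈B₁ : ∣ B₁ ∣ₛ x) →
                    proj₁ (Iso.to τ (x , x∈B₁)) ≡ proj₁ (Iso.to σ (x , x∈A′))
        τ-extends = proj₁ (proj₂ (proj₂ (proj₂ copy))) i₀

        T₀ : Exp n
        T₀ = extendExp B₁ (λ R ys → rel (N InK.↾ B) (inj₂ R) (Vec.map (Iso.to τ) ys))

        iso₀ : Iso (strOn B₁ T₀) (N InK.↾ B)
        iso₀ = strOn-iso B₁ T₀ τ (extendExp-El B₁ _)

        situation : Situation n A′ B₁ T₀
        situation = record
          { A′⊆B₁       = A′⊆B₁
          ; dimA′       = HasDim-𝓖⁻ (HasDim-iso repN (𝓖-represented n) (down N A) A′ (iso-sym σ₀) (HasDim-K⁻ N dimA))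
          ; dimB₁       = HasDim-𝓖⁻ (HasDim-iso repN (𝓖-represented n) (down N B) B₁ (iso-sym τ) (HasDim-K⁻ N dimB))
          ; dim<k       = d<k
          ; represented = represented-resp iso₀ (closedSub-represented N represented B)
          }

        open Listed (listing situation)

        T″-iso : Iso (strOn B″ T″) (strOn B₁ T₀)
        T″-iso = restrict-cong (up (Struct T″) B″) (up (Struct T₀) B₁) B″⊆B₁ B₁⊆B″
          ((λ _ _ _ → refl) , λ { (inj₁ R) xs _ → refl ; (inj₂ R) xs → agree R xs })

        situation″ : Situation n A″ B″ T″
        situation″ = record
          { A′⊆B₁       = λ a → B₁⊆B″ (A′⊆B₁ (A″⊆A′ a))
          ; dimA′       = HasDim-resp {cl = clG n} A′⊆A″ A″⊆A′ (Situation.dimA′ situation)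
          ; dimB₁       = HasDim-resp {cl = clG n} B₁⊆B″ B″⊆B₁ (Situation.dimB₁ situation)
          ; dim<k       = d<k
          ; represented = represented-resp T″-iso (Situation.represented situation)
          }

        map-τσ : ∀ {m} (xs : Vec (Fin (size n)) m) (as : All ∣ A′ ∣ₛ xs) (bs : All ∣ B₁ ∣ₛ xs) →
                 Vec.map proj₁ (Vec.map (Iso.to τ) (liftEl xs bs)) ≡ Vec.map proj₁ (Vec.map (Iso.to σ) (liftEl xs as))
        map-τσ []       []       []       = refl
        map-τσ (x ∷ xs) (a ∷ as) (b ∷ bs) = cong₂ _∷_ (τ-extends x a b) (map-τσ xs as bs)

        -- Both sides read the relations of `N` on `A`: `M` through `σ`, and `T₀` through `τ`, which
        -- extends `σ`.
        agree-A″ : ∀ R xs → All ∣ A″ ∣ₛ xs → M R xs ≡ T″ R xs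
        agree-A″ R xs A″xs = begin
          M R xs                                                                  ≡⟨ cong (M R) (sym (map-liftEl xs as)) ⟩
          M R (Vec.map proj₁ (liftEl xs as))                                      ≡⟨ Iso.rel-pres σ (inj₂ R) (liftEl xs as) ⟩
          rel N (inj₂ R) (Vec.map proj₁ (Vec.map (Iso.to σ) (liftEl xs as)))      ≡⟨ cong (rel N (inj₂ R)) (sym (map-τσ xs as bs)) ⟩
          rel N (inj₂ R) (Vec.map proj₁ (Vec.map (Iso.to τ) (liftEl xs bs)))      ≡⟨ sym (extendExp-El B₁ _ R (liftEl xs bs)) ⟩
          T₀ R (Vec.map proj₁ (liftEl xs bs))                                     ≡⟨ cong (T₀ R) (map-liftEl xs bs) ⟩
          T₀ R xs                                                                 ≡⟨ sym (agree R xs (All.map B₁⊆B″ bs)) ⟩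
          T″ R xs                                                                 ∎
          where
            open ≡-Reasoning
            as = All.map A″⊆A′ A″xs
            bs = All.map A′⊆B₁ as

        from-copies : Copies n μ A″ B″ T″ M →
          Σ[ B′ ∈ (Fin μ → InK.ClosedSub (Struct M)) ]
          Σ[ ξ ∈ (∀ i → Iso (Struct M InK.↾ B′ i) (N InK.↾ B)) ]
              (∀ i → InK.⟦ A′K ⟧ ⊆ InK.⟦ B′ i ⟧)
            × (∀ i x (x∈A′ : InK.⟦ A′K ⟧ x) (x∈B′ : InK.⟦ B′ i ⟧ x) →
                 proj₁ (Iso.to (ξ i) (x , x∈B′)) ≡ proj₁ (Iso.to σ (x , x∈A′)))
            × (∀ i j → i ≢ j → ∀ x → InK.⟦ B′ i ⟧ x → InK.⟦ B′ j ⟧ x → InK.⟦ A′K ⟧ x)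
        from-copies (Cs , f , A″⊆Cs , f-fixes , disjoint) =
            (λ j → up (Struct M) (Cs j))
          , (λ j → iso-trans (f j) (iso-trans T″-iso iso₀))
          , (λ j x∈A′ → A″⊆Cs j (A′⊆A″ x∈A′))
          , (λ j x x∈A′ x∈C → trans (cong (λ y → proj₁ (Iso.to τ y)) (El-≡ (f-fixes j x (A′⊆A″ x∈A′) x∈C)))
                                    (τ-extends x x∈A′ (A′⊆B₁ x∈A′)))
          , (λ i j i≢j x x∈C x∈C′ → A″⊆A′ (disjoint i j i≢j x x∈C x∈C′))

  abstract
    closure-K : {D : Set} (N : Structure V D) → InK.Represented N → ∀ X →
                Σ[ S ∈ InK.ClosedSub N ] InG.cl (reduct N) X ⊆ InK.⟦ S ⟧ × InK.⟦ S ⟧ ⊆ InG.cl (reduct N) X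
    closure-K N rep X = up N (closure (reduct-represented rep) X) , fromWitness em , toWitness em

  module _ {n μ : ℕ} {M : Exp n} (one-step : OneStep μ M) (1≤μ : 1 ≤ μ)
           {D : Set} {N : Structure V D} (rep : InK.Represented N) (B : InK.ClosedSub N) {w : ℕ}
           (dimB : HasDim (InK.cl N) InK.⟦ B ⟧ w) (w≤k : w ≤ k) where

    private
      rep₀ = reduct-represented rep
      module PN = Pregeometry em (pregeometry₀ rep₀)

    Extends : (A : InK.ClosedSub N) (A′ : InK.ClosedSub (Struct M)) → Iso (Struct M InK.↾ A′) (N InK.↾ A) → Set
    Extends A A′ σ = Σ[ B′ ∈ InK.ClosedSub (Struct M) ] Σ[ τ ∈ Iso (Struct M InK.↾ B′) (N InK.↾ B) ]
      InK.⟦ A′ ⟧ ⊆ InK.⟦ B′ ⟧ × (∀ x (x∈A′ : InK.⟦ A′ ⟧ x) (x∈B′ : InK.⟦ B′ ⟧ x) →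
        proj₁ (Iso.to τ (x , x∈B′)) ≡ proj₁ (Iso.to σ (x , x∈A′)))

    record Enlarged (A : InK.ClosedSub N) (d : ℕ) : Set where
      field
        A₁    : InK.ClosedSub N
        A⊂A₁  : InK.⟦ A ⟧ ⊂ InK.⟦ A₁ ⟧
        A₁⊆B  : InK.⟦ A₁ ⟧ ⊆ InK.⟦ B ⟧
        dimA₁ : HasDim (InK.cl N) InK.⟦ A₁ ⟧ (suc d)
        1+d≤w : suc d ≤ w

    enlarge : (A : InK.ClosedSub N) {d : ℕ} → InK.⟦ A ⟧ ⊆ InK.⟦ B ⟧ → HasDim (InK.cl N) InK.⟦ A ⟧ d →
              (∃[ b ] InK.⟦ B ⟧ b × ¬ InK.⟦ A ⟧ b) → Enlarged A d
    enlarge A {d} A⊆B dimA (b , b∈B , b∉A) = make (closure-K N rep X)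
      where
        X : Pred D 0ℓ
        X = InK.⟦ A ⟧ ∪ ｛ b ｝
        clN = InG.cl (reduct N)
        make : (Σ[ S ∈ InK.ClosedSub N ] clN X ⊆ InK.⟦ S ⟧ × InK.⟦ S ⟧ ⊆ clN X) → Enlarged A d
        make (S , S⁺ , S⁻) = record
          { A₁ = S ; A⊂A₁ = (λ a → S⁺ (PN.extensive X (inj₁ a))) , (λ S⊆A → b∉A (S⊆A (S⁺ (PN.extensive X (inj₂ refl)))))
          ; A₁⊆B = S⊆B ; dimA₁ = HasDim-K N dimS
          ; 1+d≤w = PN.dim-mono dimS (HasDim-K⁻ N dimB) (λ q → PN.extensive InK.⟦ B ⟧ (S⊆B q)) }
          where
            S⊆B : InK.⟦ S ⟧ ⊆ InK.⟦ B ⟧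
            S⊆B q = InClass.ClosedSub.closed (down N B) (PN.monotone (λ { (inj₁ a) → A⊆B a ; (inj₂ refl) → b∈B }) (S⁻ q))
            dimS : HasDim clN InK.⟦ S ⟧ (suc d)
            dimS = case HasDim-K⁻ N dimA of λ { (as , Aas , ind , span) →
              HasDim-resp {cl = clN} S⁺ S⁻
                ( b ∷ as , PN.extensive X (inj₂ refl) ∷ All.map (λ a → PN.extensive X (inj₁ a)) Aas
                , PN.independent-∷ ind (λ c → b∉A (InClass.ClosedSub.closed (down N A) (PN.monotone (All⇒⊆ Aas) c)))
                , PN.cl-least (λ { (inj₁ a) → PN.monotone there (span a) ; (inj₂ refl) → PN.extensive _ (here refl) })) }

    -- The set `A` is enlarged by one dimension at a time inside `B`, with `fuel` bounding the
    -- dimensions still missing. Once `A` and `B` have the same elements, the isomorphism at hand is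
    -- already the answer.
    extend : ∀ fuel (A : InK.ClosedSub N) {d} → InK.⟦ A ⟧ ⊆ InK.⟦ B ⟧ → HasDim (InK.cl N) InK.⟦ A ⟧ d → w ≤ d + fuel →
             ∀ A′ σ → Extends A A′ σ
    extend-step : ∀ fuel (A : InK.ClosedSub N) {d} → HasDim (InK.cl N) InK.⟦ A ⟧ d → w ≤ d + fuel →
                  Enlarged A d → ∀ A′ σ → Extends A A′ σ
    extend fuel A A⊆B dimA w≤ A′ σ = by-cases (∃[ b ] InK.⟦ B ⟧ b × ¬ InK.⟦ A ⟧ b)
      (λ ex → extend-step fuel A dimA w≤ (enlarge A A⊆B dimA ex) A′ σ)
      (λ none → A′ , iso-trans σ (restrict-cong A B A⊆B (λ {x} p → decidable-stable em (λ ¬A → none (x , p , ¬A)))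
                       ((λ _ _ _ → refl) , λ _ _ _ → refl))
              , id , λ x x∈ x∈′ → cong (λ y → proj₁ (Iso.to σ y)) (El-≡ refl))
    extend-step zero A {d} dimA w≤ en A′ σ =
      contradiction (subst (w ≤_) (ℕₚ.+-identityʳ d) w≤) (ℕₚ.<⇒≱ (Enlarged.1+d≤w en))
    extend-step (suc fuel) A {d} dimA w≤ en A′ σ = compose
        (extend fuel A₁ A₁⊆B dimA₁ (subst (w ≤_) (ℕₚ.+-suc d fuel) w≤) (proj₁ copies i) (proj₁ (proj₂ copies) i))
      where
        open Enlarged en
        copies = one-step (record { N = N ; represented = rep ; A = A ; B = A₁ ; A⊂B = A⊂A₁ })
                   d dimA dimA₁ (ℕₚ.≤-trans 1+d≤w w≤k) A′ σ
        i = Fin.fromℕ< 1≤μ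
        A′⊆ : InK.⟦ A′ ⟧ ⊆ InK.⟦ proj₁ copies i ⟧
        A′⊆ = proj₁ (proj₂ (proj₂ copies)) i
        compose : Extends A₁ (proj₁ copies i) (proj₁ (proj₂ copies) i) → Extends A A′ σ
        compose (B′ , τ , ⊆B′ , ext) = B′ , τ , (λ a → ⊆B′ (A′⊆ a))
          , λ x x∈A′ x∈B′ → trans (ext x (A′⊆ x∈A′) x∈B′) (proj₁ (proj₂ (proj₂ (proj₂ copies))) i x x∈A′ (A′⊆ x∈A′))

  extension-axiom : ∀ {n μ} {M : Exp n} → OneStep μ M → 1 ≤ μ → ∀ p → (let open InK.ClosedPair p in
                    DimAtMost (InK.cl N) InK.⟦ B ⟧ k) → InK.ExtensionAxiom p (Struct M)
  extension-axiom {M = M} one-step 1≤μ p (w , dimB , w≤k) A′ σ =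
    case dimA-exists of λ { (d , dimA , _) →
      case extend one-step 1≤μ represented B dimB w≤k w A (proj₁ A⊂B) (HasDim-K N dimA) (ℕₚ.m≤n+m w d) A′ σ of λ
        { (B′ , τ , A′⊆B′ , ext) →
          (λ _ → B′) , (λ _ → τ) , (λ _ {x} → A′⊆B′ {x}) , (λ _ → ext)
          , λ { zero zero 0≢0 → contradiction refl 0≢0 } } }
    where
      open InK.ClosedPair p
      rep₀ = reduct-represented represented
      dimA-exists : DimAtMost (InG.cl (reduct N)) InK.⟦ A ⟧ w
      dimA-exists = Pregeometry.dimAtMost em (pregeometry₀ rep₀) (proj₁ dimB)
        (λ a → proj₂ (proj₂ (proj₂ (HasDim-K⁻ N dimB))) (proj₁ A⊂B a))

-- Asymptotics and the two conclusions

^-distrib-* : ∀ m n o → (m * n) ^ o ≡ m ^ o * n ^ o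
^-distrib-* m n zero    = refl
^-distrib-* m n (suc o) = trans (cong (m * n *_) (^-distrib-* m n o)) (ℕₚ.[m*n]*[o*p]≡[m*o]*[n*p] m n (m ^ o) (n ^ o))

module Asymptotics (em : ExcludedMiddle 0ℓ) (𝐒 : Setting) {k : ℕ} (accepts : Setting.AcceptsSubstitutions 𝐒 k)
                   (ub : Setting.UniformlyBounded 𝐒)
                   (satG : Setting.InG.PolynomiallySaturatedSeq 𝐒 k id) where
  open Setting 𝐒
  open Saturation em 𝐒 accepts ub

  lam : ℕ → ℕ
  lam = proj₁ satG

  μ : ℕ → ℕ
  μ n = proj₁ (sqrt (lam n))

  μ²≤lam : ∀ n → μ n * μ n ≤ lam n
  μ²≤lam n = proj₁ (proj₂ (sqrt (lam n)))

  μ→∞ : TendsToInfinity μ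
  μ→∞ = sqrt-unbounded (proj₁ (proj₂ (proj₂ satG)))

  private
    at = proj₂ (proj₂ (proj₂ satG))

  saturated : ∀ n → Saturated k n (lam n)
  saturated n = proj₂ (proj₂ (at n))

  1≤lam : ∀ n → 1 ≤ μ n → 1 ≤ lam n
  1≤lam n 1≤μ = ℕₚ.≤-trans (ℕₚ.*-mono-≤ 1≤μ 1≤μ) (μ²≤lam n)

  1≤^ : ∀ {m} → 1 ≤ m → ∀ b → 1 ≤ m ^ b
  1≤^ {m} 1≤m b = subst (_≤ m ^ b) (ℕₚ.^-zeroˡ b) (ℕₚ.^-monoˡ-≤ b 1≤m)

  -- For `1 ≤ μ n` one has `lam n < (μ n + 1)² ≤ (2 μ n)²`, so a polynomial bound in `lam n` becomes
  -- one in `μ n` of twice the degree.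
  size-bound : ∃[ a ] ∃[ b ] ∀ n → 1 ≤ μ n → size n ≤ a * μ n ^ b
  size-bound with c , D , le ← polynomial-bound (proj₁ (proj₂ satG)) =
    c * (2 ^ D * 2 ^ D) , D + D , λ n 1≤μ → begin
      size n                                              ≤⟨ fromℕ-cancel-≤ (ℚₚ.≤-trans (proj₁ (proj₂ (at n))) (le (lam n) (1≤lam n 1≤μ))) ⟩
      c * lam n ^ D                                       ≤⟨ ℕₚ.*-monoʳ-≤ c (ℕₚ.^-monoˡ-≤ D (lam≤ n 1≤μ)) ⟩
      c * ((2 * μ n) * (2 * μ n)) ^ D                     ≡⟨ cong (c *_) (powers (μ n)) ⟩
      c * ((2 ^ D * 2 ^ D) * μ n ^ (D + D))               ≡⟨ sym (ℕₚ.*-assoc c (2 ^ D * 2 ^ D) (μ n ^ (D + D))) ⟩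
      c * (2 ^ D * 2 ^ D) * μ n ^ (D + D)                 ∎
    where
      open ℕₚ.≤-Reasoning
      lam≤ : ∀ n → 1 ≤ μ n → lam n ≤ (2 * μ n) * (2 * μ n)
      lam≤ n 1≤μ = ℕₚ.≤-trans (ℕₚ.<⇒≤ (proj₂ (proj₂ (sqrt (lam n))))) (ℕₚ.*-mono-≤ 1+μ≤2μ 1+μ≤2μ)
        where
          1+μ≤2μ : suc (μ n) ≤ 2 * μ n
          1+μ≤2μ = subst (suc (μ n) ≤_) (cong (μ n +_) (sym (ℕₚ.+-identityʳ (μ n)))) (ℕₚ.+-monoˡ-≤ (μ n) 1≤μ)
      powers : ∀ m → ((2 * m) * (2 * m)) ^ D ≡ (2 ^ D * 2 ^ D) * m ^ (D + D)
      powers m = trans (^-distrib-* (2 * m) (2 * m) D)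
        (trans (cong₂ _*_ (^-distrib-* 2 m D) (^-distrib-* 2 m D))
        (trans (ℕₚ.[m*n]*[o*p]≡[m*o]*[n*p] (2 ^ D) (m ^ D) (2 ^ D) (m ^ D))
               (cong ((2 ^ D * 2 ^ D) *_) (sym (ℕₚ.^-distribˡ-+-* m D D)))))

  -- The additional factor `μ n` is the number of groups, which the bound for a single triple
  -- contributes.
  triples-bound : ∃[ c ] ∃[ D ] ∀ n → 1 ≤ μ n → length (triples n) * μ n ≤ c * μ n ^ D
  triples-bound with a , b , le ← size-bound =
    k * (suc a ^ k * tableCount) , suc (b * k) , λ n 1≤μ → begin
      length (triples n) * μ n                                     ≤⟨ ℕₚ.*-monoˡ-≤ (μ n) (length-triples n) ⟩
      k * (suc (size n) ^ k * tableCount) * μ n                    ≤⟨ ℕₚ.*-monoˡ-≤ (μ n) (ℕₚ.*-monoʳ-≤ k (ℕₚ.*-monoˡ-≤ tableCount (powers n 1≤μ))) ⟩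
      k * ((suc a ^ k * μ n ^ (b * k)) * tableCount) * μ n         ≡⟨ regroup k (suc a ^ k) (μ n ^ (b * k)) tableCount (μ n) ⟩
      k * (suc a ^ k * tableCount) * μ n ^ suc (b * k)             ∎
    where
      open ℕₚ.≤-Reasoning
      powers : ∀ n → 1 ≤ μ n → suc (size n) ^ k ≤ suc a ^ k * μ n ^ (b * k)
      powers n 1≤μ = subst (suc (size n) ^ k ≤_)
        (trans (^-distrib-* (suc a) (μ n ^ b) k) (cong (suc a ^ k *_) (ℕₚ.^-*-assoc (μ n) b k)))
        (ℕₚ.^-monoˡ-≤ k (ℕₚ.+-mono-≤ (1≤^ 1≤μ b) (le n 1≤μ)))
      open ℕ-Solver.+-*-Solver
      regroup : ∀ k x y C m → k * ((x * y) * C) * m ≡ (k * (x * C)) * (m * y)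
      regroup = solve 5 (λ k x y C m → k :* ((x :* y) :* C) :* m := (k :* (x :* C)) :* (m :* y)) refl

  private
    q₀ : ℚ
    q₀ = recip tableCount ^ℚ ρ

    q₀≥0 : 0ℚ ℚ.≤ q₀
    q₀≥0 = ^ℚ-≥0 ρ (recip-≥0 tableCount)

    q₀≤1 : q₀ ℚ.≤ 1ℚ
    q₀≤1 = subst (q₀ ℚ.≤_) (1^ℚ ρ) (^ℚ-mono ρ (recip-≥0 tableCount) (recip-≤1 tableCount≢0))

  -- Uses `polynomial-decay` with `p = q₀ / (D + 1)`. The inverse of this `p` is the natural number
  -- `K₀`, whence the constant `K₀ ^ suc D`.
  rate-decay : ∀ D → ∃[ K ] ∀ m → fromℕ m ^ℚ suc D ℚ.* rate ^ℚ m ℚ.≤ fromℕ K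
  rate-decay D = K₀ ^ suc D , λ m → begin
      x m                                             ≡⟨ sym (ℚₚ.*-identityʳ (x m)) ⟩
      x m ℚ.* 1ℚ                                      ≡⟨ cong (x m ℚ.*_) (sym p^D*K) ⟩
      x m ℚ.* (p ^ℚ suc D ℚ.* fromℕ (K₀ ^ suc D))     ≡⟨ sym (ℚₚ.*-assoc (x m) (p ^ℚ suc D) (fromℕ (K₀ ^ suc D))) ⟩
      x m ℚ.* p ^ℚ suc D ℚ.* fromℕ (K₀ ^ suc D)       ≤⟨ *-monoˡ-≤ (fromℕ-≥0 (K₀ ^ suc D)) (polynomial-decay (suc D) 0≤p p≤1 Dp≡q q₀≤1 m) ⟩
      1ℚ ℚ.* fromℕ (K₀ ^ suc D)                       ≡⟨ ℚₚ.*-identityˡ (fromℕ (K₀ ^ suc D)) ⟩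
      fromℕ (K₀ ^ suc D)                              ∎
    where
      open ℚₚ.≤-Reasoning
      x : ℕ → ℚ
      x m = fromℕ m ^ℚ suc D ℚ.* rate ^ℚ m
      K₀ = tableCount ^ ρ * suc D
      p = q₀ ℚ.* recip (suc D)
      0≤p : 0ℚ ℚ.≤ p
      0≤p = *-≥0 q₀≥0 (recip-≥0 (suc D))
      p≤1 : p ℚ.≤ 1ℚ
      p≤1 = subst (p ℚ.≤_) (ℚₚ.*-identityʳ 1ℚ) (*-mono-≤ q₀≥0 0≤1 q₀≤1 (recip-≤1 {suc D} λ ()))
      Dp≡q : fromℕ (suc D) ℚ.* p ≡ q₀
      Dp≡q = trans (*-swapˡ (fromℕ (suc D)) q₀ (recip (suc D)))
        (trans (cong (q₀ ℚ.*_) (trans (ℚₚ.*-comm (fromℕ (suc D)) (recip (suc D))) (recip-* (suc D) λ ()))) (ℚₚ.*-identityʳ q₀))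
      q₀-inverse : q₀ ℚ.* fromℕ (tableCount ^ ρ) ≡ 1ℚ
      q₀-inverse = trans (cong (q₀ ℚ.*_) (fromℕ-^ tableCount ρ))
        (trans (sym (^ℚ-distrib-* (recip tableCount) (fromℕ tableCount) ρ))
        (trans (cong (_^ℚ ρ) (recip-* tableCount tableCount≢0)) (1^ℚ ρ)))
      p*K₀ : p ℚ.* fromℕ K₀ ≡ 1ℚ
      p*K₀ = trans (cong (p ℚ.*_) (fromℕ-* (tableCount ^ ρ) (suc D)))
        (trans (*-interchange q₀ (recip (suc D)) (fromℕ (tableCount ^ ρ)) (fromℕ (suc D)))
        (trans (cong₂ ℚ._*_ q₀-inverse (recip-* (suc D) λ ())) (ℚₚ.*-identityʳ 1ℚ)))
      p^D*K : p ^ℚ suc D ℚ.* fromℕ (K₀ ^ suc D) ≡ 1ℚ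
      p^D*K = trans (cong (p ^ℚ suc D ℚ.*_) (fromℕ-^ K₀ (suc D)))
        (trans (sym (^ℚ-distrib-* p (fromℕ K₀) (suc D))) (trans (cong (_^ℚ suc D) p*K₀) (1^ℚ (suc D))))

  Pr-SomeBad-≤ : ∀ {c D} → (∀ n → 1 ≤ μ n → length (triples n) * μ n ≤ c * μ n ^ D) → ∀ n → 1 ≤ μ n →
                 Pr n (SomeBad n (μ n)) ℚ.≤ fromℕ (c * μ n ^ D) ℚ.* rate ^ℚ μ n
  Pr-SomeBad-≤ {c} {D} le n 1≤μ = begin
    Pr n (SomeBad n (μ n))                                          ≤⟨ Pr-SomeBad (saturated n) (μ²≤lam n) ⟩
    fromℕ (length (triples n)) ℚ.* (fromℕ (μ n) ℚ.* rate ^ℚ μ n)    ≡⟨ sym (ℚₚ.*-assoc (fromℕ (length (triples n))) (fromℕ (μ n)) (rate ^ℚ μ n)) ⟩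
    fromℕ (length (triples n)) ℚ.* fromℕ (μ n) ℚ.* rate ^ℚ μ n      ≡⟨ cong (ℚ._* rate ^ℚ μ n) (sym (fromℕ-* (length (triples n)) (μ n))) ⟩
    fromℕ (length (triples n) * μ n) ℚ.* rate ^ℚ μ n                ≤⟨ *-monoˡ-≤ (^ℚ-≥0 (μ n) rate-≥0) (fromℕ-mono (le n 1≤μ)) ⟩
    fromℕ (c * μ n ^ D) ℚ.* rate ^ℚ μ n                             ∎
    where open ℚₚ.≤-Reasoning

  Vanishes : ℚ → Set
  Vanishes ε = ∃[ N ] ∀ n → N ≤ n → 1 ≤ μ n × Pr n (SomeBad n (μ n)) ℚ.< ε

  SomeBad-vanishes : ∀ ε → 0ℚ ℚ.< ε → Vanishes ε
  SomeBad-vanishes ε 0<ε = case triples-bound of λ { (c , D , le) →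
    case tail-vanishes {q₀} rate-decay c D ε 0<ε of λ { (N₀ , small) →
    -- `suc N₀` rather than `N₀` also secures `1 ≤ μ n`.
    case μ→∞ (suc N₀) of λ { (N , large) →
      N , λ n N≤n → ℕₚ.≤-trans (s≤s z≤n) (large n N≤n)
                  , ℚₚ.≤-<-trans (Pr-SomeBad-≤ {c} {D} le n (ℕₚ.≤-trans (s≤s z≤n) (large n N≤n)))
                                 (small (μ n) (ℕₚ.≤-trans (ℕₚ.n≤1+n N₀) (large n N≤n))) } } }

  good⇒one-step : ∀ {n} {M : Exp n} → 1 ≤ μ n → M ∈ₗ 𝓚 n → ¬ SomeBad n (μ n) M → OneStep (μ n) M
  good⇒one-step {n} 1≤μ M∈ good p = one-step-at (saturated n) (1≤lam n 1≤μ) M∈ good p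

  𝓚-list : ∀ n → List (Exp n)
  𝓚-list n = deduplicate _≋?_ (𝓚 n)

  𝓚-list-⊆ : ∀ {n} {M : Exp n} → M ∈ₗ 𝓚-list n → M ∈ₗ 𝓚 n
  𝓚-list-⊆ {n} = ∈ₗ.∈-deduplicate⁻ _≋?_ (𝓚 n)

  δ-total : ∀ n → ∑ (λ E → δ n E ℚ.* 1ℚ) (𝓚-list n) ≡ 1ℚ
  δ-total n = trans (∑-δ n (λ _ → 1ℚ) (λ _ → 0≤1) (λ _ → refl)) (𝔼-total n ρ)

  δ-complement : ∀ n (Q : Pred (Structure V (Fin (size n))) 0ℓ) → δ[ n ] Q ℚ.+ Pr n (λ E → ¬ Q (Struct E)) ≡ 1ℚ
  δ-complement n Q = trans (cong (ℚ._+ Pr n (λ E → ¬ Q (Struct E))) (∑-filter (λ E → em {P = Q (Struct E)}) (δ n) (𝓚-list n)))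
    (trans (sym (∑-+ (λ E → ⟦ em {P = Q (Struct E)} ⟧? ℚ.* δ n E) (λ E → δ n E ℚ.* prob? (λ E → ¬ Q (Struct E)) E) (𝓚-list n)))
    (trans (∑-cong (𝓚-list n) (λ E _ → split E)) (δ-total n)))
    where
      split : ∀ E → ⟦ em {P = Q (Struct E)} ⟧? ℚ.* δ n E ℚ.+ δ n E ℚ.* prob? (λ E → ¬ Q (Struct E)) E ≡ δ n E ℚ.* 1ℚ
      split E = by-cases (Q (Struct E))
        (λ q → trans (cong₂ (λ x y → x ℚ.* δ n E ℚ.+ δ n E ℚ.* y) (⟦⟧?-yes em q) (⟦⟧?-no em (λ ¬q → ¬q q)))
                 (trans (cong₂ ℚ._+_ (ℚₚ.*-comm 1ℚ (δ n E)) (ℚₚ.*-zeroʳ (δ n E))) (ℚₚ.+-identityʳ (δ n E ℚ.* 1ℚ))))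
        (λ ¬q → trans (cong₂ (λ x y → x ℚ.* δ n E ℚ.+ δ n E ℚ.* y) (⟦⟧?-no em ¬q) (⟦⟧?-yes em ¬q))
                 (trans (cong (ℚ._+ δ n E ℚ.* 1ℚ) (ℚₚ.*-zeroˡ (δ n E))) (ℚₚ.+-identityˡ (δ n E ℚ.* 1ℚ))))

  Pr-mono : ∀ {n} {Q Q′ : Pred (Exp n) 0ℓ} → (∀ {E} → E ∈ₗ 𝓚 n → Q E → Q′ E) → Pr n Q ℚ.≤ Pr n Q′
  Pr-mono {n} {Q} {Q′} sub = ∑-mono (𝓚-list n) λ E E∈ → *-monoʳ-≤ (ℙ-≥0 n ρ E) (by-cases (Q E)
    (λ q → subst (prob? Q E ℚ.≤_) (sym (⟦⟧?-yes em (sub (𝓚-list-⊆ E∈) q))) (⟦⟧?-≤1 em))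
    (λ ¬q → subst (ℚ._≤ prob? Q′ E) (sym (⟦⟧?-no em ¬q)) (⟦⟧?-≥0 em)))

  Pr-≥0 : ∀ n Q → 0ℚ ℚ.≤ Pr n Q
  Pr-≥0 n Q = ∑-≥0 (𝓚-list n) (λ E → *-≥0 (ℙ-≥0 n ρ E) (⟦⟧?-≥0 em))

  ∣x-1∣≡y : ∀ x y → x ℚ.+ y ≡ 1ℚ → 0ℚ ℚ.≤ y → ℚ.∣ x ℚ.- 1ℚ ∣ ≡ y
  ∣x-1∣≡y x y eq 0≤y = trans (cong ℚ.∣_∣ (subst (λ z → x ℚ.- z ≡ ℚ.- y) eq (cancel x y)))
      (trans (ℚₚ.∣-p∣≡∣p∣ y) (ℚₚ.0≤p⇒∣p∣≡p 0≤y))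
    where
      open ℚ-Solver.+-*-Solver
      cancel : ∀ x y → x ℚ.- (x ℚ.+ y) ≡ ℚ.- y
      cancel = solve 2 (λ x y → x :- (x :+ y) := :- y) refl

  extension-axioms-almost-sure : 0 < k → (p : InK.ClosedPair) → InK.IsExtensionAxiomOf (k ∸ 1) p →
                                 TendsTo (λ n → δ[ n ] (InK.ExtensionAxiom p)) 1ℚ
  extension-axioms-almost-sure 0<k p small ε 0<ε = conclude (SomeBad-vanishes ε 0<ε)
    where
      Fails : ∀ n → Pred (Exp n) 0ℓ
      Fails n E = ¬ InK.ExtensionAxiom p (Struct E)

      small′ : DimAtMost (InK.cl (InK.ClosedPair.N p)) InK.⟦ InK.ClosedPair.B p ⟧ k
      -- A `(k ∸ 1)`-extension axiom allows dimension `suc (k ∸ 1)`, which equals `k` because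
      -- `0 < k`.
      small′ = DimAtMost-mono {cl = InK.cl (InK.ClosedPair.N p)} (ℕₚ.≤-reflexive (ℕₚ.m+[n∸m]≡n 0<k)) small

      fails⇒bad : ∀ {n E} → 1 ≤ μ n → E ∈ₗ 𝓚 n → Fails n E → SomeBad n (μ n) E
      fails⇒bad 1≤μ E∈ fails = decidable-stable em λ good →
        fails (extension-axiom (good⇒one-step 1≤μ E∈ good) 1≤μ p small′)

      conclude : Vanishes ε → ∃[ N ] ∀ n → N ≤ n → ℚ.∣ δ[ n ] (InK.ExtensionAxiom p) ℚ.- 1ℚ ∣ ℚ.< ε
      conclude (N , vanish) = N , λ n N≤n →
        subst (ℚ._< ε) (sym (∣x-1∣≡y (δ[ n ] (InK.ExtensionAxiom p)) (Pr n (Fails n))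
                               (δ-complement n (InK.ExtensionAxiom p)) (Pr-≥0 n (Fails n))))
          (ℚₚ.≤-<-trans (Pr-mono {n} {Fails n} (fails⇒bad (proj₁ (vanish n N≤n)))) (proj₂ (vanish n N≤n)))

  -- If every member of `𝓚 n` were bad, the probability would be the total mass `1`.
  good-exists : ∀ n → Pr n (SomeBad n (μ n)) ℚ.< 1ℚ → ∃[ E ] E ∈ₗ 𝓚 n × ¬ SomeBad n (μ n) E
  good-exists n Pr<1 = decidable-stable em λ none → ℚₚ.<-irrefl
    (trans (∑-cong (𝓚-list n) (λ E E∈ → cong (δ n E ℚ.*_) (⟦⟧?-yes em
      (decidable-stable em λ ¬bad → none (E , 𝓚-list-⊆ E∈ , ¬bad))))) (δ-total n)) Pr<1

  μ≤size : ∀ n → μ n ≤ size n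
  μ≤size n = ℕₚ.≤-trans (m≤m*m (μ n)) (ℕₚ.≤-trans (μ²≤lam n) (proj₁ (at n)))
    where
      m≤m*m : ∀ m → m ≤ m * m
      m≤m*m zero    = z≤n
      m≤m*m (suc m) = ℕₚ.m≤m*n (suc m) (suc m)

  -- The sequence starts at the index `N` from which on bad structures have probability below `1`
  -- and `μ` is positive. Each later index has a good member, and `μ (n + N)` is its multiplicity
  -- bound.
  K-saturated : InK.PolynomiallySaturated k
  K-saturated = build (SomeBad-vanishes 1ℚ (ℚₚ.positive⁻¹ 1ℚ)) size-bound
    where
      build : Vanishes 1ℚ → (∃[ a ] ∃[ b ] ∀ n → 1 ≤ μ n → size n ≤ a * μ n ^ b) → InK.PolynomiallySaturated k
      build (N , vanish) (a , b , size≤) =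
          (λ n → n + N , proj₁ (M n) , proj₁ (proj₂ (M n)))
        , (λ n → μ (n + N)) , monomial a b
        , (λ c → case μ→∞ c of λ { (N′ , le) → N′ , λ n N′≤n → le (n + N) (ℕₚ.≤-trans N′≤n (ℕₚ.m≤m+n n N)) })
        , λ n → μ≤size (n + N)
              , subst (fromℕ (size (n + N)) ℚ.≤_) (sym (eval-monomial a b (μ (n + N)))) (fromℕ-mono (size≤ (n + N) (1≤μ n)))
              , good⇒one-step (1≤μ n) (proj₁ (proj₂ (M n))) (proj₂ (proj₂ (M n)))
        where
          1≤μ : ∀ n → 1 ≤ μ (n + N)
          1≤μ n = proj₁ (vanish (n + N) (ℕₚ.m≤n+m N n))
          M : ∀ n → ∃[ E ] E ∈ₗ 𝓚 (n + N) × ¬ SomeBad (n + N) (μ (n + N)) E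
          M n = good-exists (n + N) (proj₂ (vanish (n + N) (ℕₚ.m≤n+m N n)))

theorem7p31 :
    (em : ExcludedMiddle 0ℓ) (𝐒 : Setting) →
    let open Setting 𝐒
        open Measure em 𝐒
    in
    (k : ℕ) → 0 < k →
    UniformlyBounded →
    InG.PolynomiallySaturatedSeq k id →
    AcceptsSubstitutions k →
    ((p : InK.ClosedPair) → InK.IsExtensionAxiomOf (k ∸ 1) p →
       TendsTo (λ n → δ[ n ] (InK.ExtensionAxiom p)) 1ℚ)
    × InK.PolynomiallySaturated k
theorem7p31 em 𝐒 k 0<k ub satG accepts = extension-axioms-almost-sure 0<k , K-saturated
  where open Asymptotics em 𝐒 accepts ub satG
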